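{- Let $q$ be a prime power and $2\le k\le r$, $m\ge1$ integers with $c:=\frac mr\binom rk\in\mathbb Z$, and $N=r+c$. Put $L_r=\frac{q^{r+1}-1}{q-1}$ and $$A_r=(r+1)\left(1+\frac{(k-1)c}{r+1-k}\right).$$ Then $$\mathbb E X_{N,r+1}\le C_q\,q^{ -A_r}.$$ Moreover, for every integer $2\le t\le L_r/2$, $$\log_q\mathbb E(X_{N,r})_t\ge tr-A_r-O(t),$$ where the implied constant is absolute (uniform in $q,k,r,m,t$). Consequently: (i) if $k=2$ and $m$ is fixed, then for every fixed integer $t>(m+2)/2$ one has $\mathbb E(X_{N,r})_t\to\infty$ as $r\to\infty$ along such parameters; (ii) fix $k\ge3$ and allow $m=m(r)\ge1$ to vary. For every $\varepsilon>0$, for all sufficiently large $r$ (in terms of $k,\varepsilon$), if $$t\ge\left(\frac{k-1}{k!}+\varepsilon\right)mr^{k-2},\qquad t\le L_r/2,$$ then, uniformly in $q$, $$\frac{\mathbb E(X_{N,r})_t}{\mu_{N,r}^t}\ge q^{(\varepsilon/2)mr^{k-1}}\longrightarrow\infty .$$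
   Context: Let $V_N=\mathbb F_q^N$ and let $\Theta_N$ be uniformly random in $\mathrm{Hom}(\Lambda^kV_N,\mathbb F_q^m)$. A subspace $H\le V_N$ is null if $\Theta_N(\Lambda^kH)=0$. For an integer $s$, $X_{N,s}$ is the number of $s$-dimensional null subspaces; $\mu_{N,r}=\mathbb E X_{N,r}$. $(X)_t=X(X-1)\cdots(X-t+1)$ is the falling factorial. $C_q=\prod_{j\ge1}(1-q^{ -j})^{ -1}$. -}

module Defs where

import Algebra.Definitions.RawSemiring as RawSemiring
open import Algebra.Apartness.Structures using (IsHeytingField)
open import Data.Bool using (Bool)
open import Data.Fin using (Fin; zero)
open import Data.Fin.Properties as Fin using (*↔×; 2↔Bool)
open import Data.Fin.Subset using (Subset) renaming (_∈_ to _∈ₛ_)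
open import Data.Fin.Subset.Properties using () renaming (_∈?_ to _∈ₛ?_)
open import Data.Integer using (ℤ; +_; -[1+_])
open import Data.List as List using (List; length; filter)
open import Data.List.Membership.Propositional using (_∈_)
open import Data.List.Membership.Propositional.Properties using (∈-filter⁺; ∈-tabulate⁺)
open import Data.List.Relation.Unary.Any using (here; there)
open import Data.Nat as ℕ using (ℕ; zero; suc; NonZero; NonTrivial)
open import Data.Nat.Combinatorics using (_C_)
open import Data.Nat.ListAction using (sum)
open import Data.Nat.Properties as ℕ using (_!≢0)
open import Data.Product using (∃; ∃-syntax; _×_; _,_; uncurry)
open import Data.Product.Function.NonDependent.Propositional using (_×-↔_)
open import Data.Rational as ℚ using (ℚ; 0ℚ; 1ℚ; _/_; _<_)
open import Data.Sum using (_⊎_)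
open import Data.Vec as Vec using (Vec; []; _∷_; lookup; zipWith; replicate; _[_]≔_)
open import Data.Vec.Properties as Vec using ()
open import Data.Vec.Relation.Unary.All as All using (All)
open import Function using (_↔_; Inverse; mk↔ₛ′; _∘_)
open import Function.Construct.Composition using (_↔-∘_)
open import Function.Construct.Symmetry using (↔-sym)
open import Relation.Binary.Definitions using (DecidableEquality)
open import Relation.Binary.PropositionalEquality
  using (_≡_; _≢_; refl; sym; trans; cong; cong₂; subst)
open import Relation.Nullary using (Dec; ¬?)
open import Relation.Nullary.Decidable using (map′; _×-dec_; _→-dec_)
open import Relation.Unary using (Decidable)

------------------------------------------------------------------------
-- Finite types

record Finite (A : Set) : Set where
  infix 4 _≟_

  field
    card : ℕ
    enum : A ↔ Fin card

  index : A → Fin card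
  index = Inverse.to enum

  element : Fin card → A
  element = Inverse.from enum

  element-index : ∀ x → element (index x) ≡ x
  element-index = Inverse.strictlyInverseʳ enum

  elements : List A
  elements = List.tabulate element

  ∈-elements : ∀ x → x ∈ elements
  ∈-elements x = subst (_∈ elements) (element-index x) (∈-tabulate⁺ (index x))

  _≟_ : DecidableEquality A
  x ≟ y = map′
    (λ e → trans (sym (element-index x)) (trans (cong element e) (element-index y)))
    (cong index)
    (index x Fin.≟ index y)

  all? : ∀ {P : A → Set} → Decidable P → Dec (∀ x → P x)
  all? {P} P? = map′
    (λ f x → subst P (element-index x) (f (index x)))
    (λ f i → f (element i))
    (Fin.all? (P? ∘ element))

  any? : ∀ {P : A → Set} → Decidable P → Dec (∃ P)
  any? {P} P? = map′
    (λ (i , p) → element i , p)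
    (λ (x , p) → index x , subst P (sym (element-index x)) p)
    (Fin.any? (P? ∘ element))

open Finite {{...}}

instance
  finite-Bool : Finite Bool
  finite-Bool = record { card = 2 ; enum = ↔-sym 2↔Bool }

  finite-Vec : ∀ {A : Set} {n} → {{Finite A}} → Finite (Vec A n)
  finite-Vec {n = zero} = record
    { card = 1
    ; enum = mk↔ₛ′ (λ _ → zero) (λ _ → []) (λ { zero → refl }) (λ { [] → refl })
    }
  finite-Vec {n = suc n} {{A}} = record
    { card = Finite.card A ℕ.* Finite.card rest
    ; enum = ↔-sym *↔× ↔-∘ ((Finite.enum A ×-↔ Finite.enum rest) ↔-∘ uncons↔)
    }
    where
    rest = finite-Vec {n = n} {{A}}
    uncons↔ = mk↔ₛ′ Vec.uncons (uncurry _∷_) (λ _ → refl) (λ { (_ ∷ _) → refl })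

-- Functions on a finite type are represented by their tables of values, so
-- that functions with equal values are equal and there are finitely many.

infixl 9 _⟪_⟫

Table : (A B : Set) → {{Finite A}} → Set
Table A B = Vec B (card {A})

_⟪_⟫ : ∀ {A B : Set} {{_ : Finite A}} → Table A B → A → B
f ⟪ x ⟫ = lookup f (index x)

------------------------------------------------------------------------
-- The field with q elements

-- The orders of such fields are exactly the prime powers, and q determines
-- the field up to isomorphism.

record FiniteField (q : ℕ) : Set₁ where
  field
    Carrier        : Set
    _+_ _*_        : Carrier → Carrier → Carrier
    -_             : Carrier → Carrier
    0# 1#          : Carrier
    isHeytingField : IsHeytingField _≡_ _≢_ _+_ _*_ -_ 0# 1#
    enumeration    : Carrier ↔ Fin q

  open IsHeytingField isHeytingField public

  instance
    finite-Carrier : Finite Carrier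
    finite-Carrier = record { card = q ; enum = enumeration }

------------------------------------------------------------------------
-- The random map Θ_N and the variables X_{N,s}

module Coordinates {q : ℕ} (F : FiniteField q) where
  open FiniteField F using (Carrier; _+_; _*_; 0#; finite-Carrier)

  infixl 6 _⊕_
  infixr 7 _∙_

  Space : ℕ → Set
  Space n = Vec Carrier n

  𝟎 : ∀ {n} → Space n
  𝟎 = replicate _ 0#

  _⊕_ : ∀ {n} → Space n → Space n → Space n
  _⊕_ = zipWith _+_

  _∙_ : ∀ {n} → Carrier → Space n → Space n
  a ∙ v = Vec.map (a *_) v

  combination : ∀ {n s} → Vec Carrier s → Vec (Space n) s → Space n
  combination []       []       = 𝟎
  combination (a ∷ as) (b ∷ bs) = a ∙ b ⊕ combination as bs

-- By the universal property of the exterior power, Hom(Λᵏ V_N , 𝔽_qᵐ) is the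
-- set of alternating k-linear maps V_N × ⋯ × V_N → 𝔽_qᵐ.

module RandomForm {q : ℕ} (F : FiniteField q) (N k m : ℕ) where
  open FiniteField F using (Carrier; _+_; _*_; 0#; finite-Carrier; +-identityˡ; zeroʳ)
  open Coordinates F public

  infix 4 _∈ⱽ_ _∈ⱽ?_

  V W Form : Set
  V    = Space N
  W    = Space m
  Form = Table (Vec V k) W

  Additive Homogeneous Alternating AlternatingMultilinear : Form → Set
  Additive θ = ∀ (vs : Vec V k) i x y →
    θ ⟪ vs [ i ]≔ (x ⊕ y) ⟫ ≡ θ ⟪ vs [ i ]≔ x ⟫ ⊕ θ ⟪ vs [ i ]≔ y ⟫
  Homogeneous θ = ∀ (vs : Vec V k) i a x →
    θ ⟪ vs [ i ]≔ (a ∙ x) ⟫ ≡ a ∙ θ ⟪ vs [ i ]≔ x ⟫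
  Alternating θ = ∀ (vs : Vec V k) i j →
    i ≢ j → lookup vs i ≡ lookup vs j → θ ⟪ vs ⟫ ≡ 𝟎
  AlternatingMultilinear θ = Additive θ × Homogeneous θ × Alternating θ

  alternatingMultilinear? : Decidable AlternatingMultilinear
  alternatingMultilinear? θ =
    (all? λ _ → Fin.all? λ _ → all? λ _ → all? λ _ → _ ≟ _) ×-dec
    (all? λ _ → Fin.all? λ _ → all? λ _ → all? λ _ → _ ≟ _) ×-dec
    (all? λ _ → Fin.all? λ i → Fin.all? λ j →
       ¬? (i Fin.≟ j) →-dec (_ ≟ _ →-dec _ ≟ _))

  forms : List Form
  forms = filter alternatingMultilinear? elements

  zeroForm : Form
  zeroForm = replicate _ 𝟎

  zeroForm∈forms : zeroForm ∈ forms
  zeroForm∈forms = ∈-filter⁺ alternatingMultilinear? (∈-elements zeroForm)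
    ( (λ vs i x y → trans (value _) (sym (trans (cong₂ _⊕_ (value _) (value _)) 𝟎⊕𝟎)))
    , (λ vs i a x → trans (value _) (sym (trans (cong (a ∙_) (value _)) (a∙𝟎 a))))
    , (λ vs i j _ _ → value vs) )
    where
    value : ∀ vs → zeroForm ⟪ vs ⟫ ≡ 𝟎
    value vs = Vec.lookup-replicate (index vs) 𝟎
    𝟎⊕𝟎 : 𝟎 ⊕ 𝟎 ≡ 𝟎 {m}
    𝟎⊕𝟎 = trans (Vec.zipWith-replicate _+_ 0# 0#) (cong (replicate m) (+-identityˡ 0#))
    a∙𝟎 : ∀ a → a ∙ 𝟎 ≡ 𝟎 {m}
    a∙𝟎 a = trans (Vec.map-replicate (a *_) 0# m) (cong (replicate m) (zeroʳ a))

  forms-nonZero : NonZero (length forms)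
  forms-nonZero = nonEmpty zeroForm∈forms
    where
    nonEmpty : ∀ {x : Form} {xs} → x ∈ xs → NonZero (length xs)
    nonEmpty (here _)  = _
    nonEmpty (there _) = _

  -- Expectation with respect to the uniform distribution on Hom(Λᵏ V_N , 𝔽_qᵐ).

  𝔼 : (Form → ℕ) → ℚ
  𝔼 f = (+ sum (List.map f forms) / length forms) {{forms-nonZero}}

  SubsetOfV : Set
  SubsetOfV = Subset (card {V})

  _∈ⱽ_ : V → SubsetOfV → Set
  v ∈ⱽ H = index v ∈ₛ H

  _∈ⱽ?_ : ∀ v H → Dec (v ∈ⱽ H)
  v ∈ⱽ? H = index v ∈ₛ? H

  IsSubspace : SubsetOfV → Set
  IsSubspace H =
    (𝟎 ∈ⱽ H) ×
    (∀ x y → x ∈ⱽ H → y ∈ⱽ H → (x ⊕ y) ∈ⱽ H) ×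
    (∀ a x → x ∈ⱽ H → (a ∙ x) ∈ⱽ H)

  IsBasis : ∀ {s} → SubsetOfV → Vec V s → Set
  IsBasis {s} H bs =
    All (_∈ⱽ H) bs ×
    (∀ (as : Vec Carrier s) → combination as bs ≡ 𝟎 → as ≡ 𝟎) ×
    (∀ v → v ∈ⱽ H → ∃[ as ] combination as bs ≡ v)

  HasDimension : SubsetOfV → ℕ → Set
  HasDimension H s = ∃[ bs ] IsBasis {s} H bs

  -- Λᵏ H is spanned by the products h₁ ∧ ⋯ ∧ hₖ with all hᵢ ∈ H.

  IsNull : Form → SubsetOfV → Set
  IsNull θ H = ∀ (hs : Vec V k) → All (_∈ⱽ H) hs → θ ⟪ hs ⟫ ≡ 𝟎

  NullSubspace : Form → ℕ → SubsetOfV → Set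
  NullSubspace θ s H = IsSubspace H × HasDimension H s × IsNull θ H

  nullSubspace? : ∀ θ s → Decidable (NullSubspace θ s)
  nullSubspace? θ s H = subspace? ×-dec dimension? ×-dec null?
    where
    subspace? : Dec (IsSubspace H)
    subspace? =
      (𝟎 ∈ⱽ? H) ×-dec
      (all? λ x → all? λ y → x ∈ⱽ? H →-dec (y ∈ⱽ? H →-dec (x ⊕ y) ∈ⱽ? H)) ×-dec
      (all? λ a → all? λ x → x ∈ⱽ? H →-dec (a ∙ x) ∈ⱽ? H)
    dimension? : Dec (HasDimension H s)
    dimension? = any? λ bs →
      All.all? (_∈ⱽ? H) bs ×-dec
      (all? λ as → combination as bs ≟ 𝟎 →-dec as ≟ 𝟎) ×-dec
      (all? λ v → v ∈ⱽ? H →-dec any? λ as → combination as bs ≟ v)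
    null? : Dec (IsNull θ H)
    null? = all? λ hs → All.all? (_∈ⱽ? H) hs →-dec θ ⟪ hs ⟫ ≟ 𝟎

  X : ℕ → Form → ℕ
  X s θ = length (filter (nullSubspace? θ s) elements)

------------------------------------------------------------------------
-- Real numbers

open RawSemiring ℚ.+-*-rawSemiring public using () renaming (_^_ to _^ℚ_)

ι : ℕ → ℚ
ι n = + n / 1

nonTrivial⇒pow-nonZero : ∀ q .{{_ : NonTrivial q}} n → NonZero (q ℕ.^ n)
nonTrivial⇒pow-nonZero q n = ℕ.m^n≢0 q n {{ℕ.nonTrivial⇒nonZero q}}

-- The rational q ^ z.

_^ℤ_ : (q : ℕ) .{{_ : NonTrivial q}} → ℤ → ℚ
q ^ℤ (+ n)    = ι (q ℕ.^ n)
q ^ℤ -[1+ n ] = (+ 1 / (q ℕ.^ suc n)) {{nonTrivial⇒pow-nonZero q (suc n)}}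

-- A real x is given by its lower Dedekind cut { p ∈ ℚ ∣ p < x }.  Arbitrary
-- predicates serve as cuts of extended reals: the empty one is −∞.

Cut : Set₁
Cut = ℚ → Set

record IsReal (x : Cut) : Set where
  field
    inhabited : ∃[ p ] x p
    bounded   : ∃[ b ] (∀ p → x p → p < b)
    downward  : ∀ {p p′} → p < p′ → x p′ → x p
    open′     : ∀ {p} → x p → ∃[ p′ ] p < p′ × x p′

infix  4 _≤ʳ_
infixl 6 _+ʳ_
infixl 7 _*ʳ_
infixr 8 _^ʳ_ _^ℤ_

⌜_⌝ : ℚ → Cut
⌜ x ⌝ p = p < x

_≤ʳ_ : Cut → Cut → Set
x ≤ʳ y = ∀ p → x p → y p

_+ʳ_ : Cut → Cut → Cut
(x +ʳ y) p = ∃[ a ] ∃[ b ] x a × y b × p < a ℚ.+ b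

-- The product of two positive reals.

_*ʳ_ : Cut → Cut → Cut
(x *ʳ y) p = ∃[ a ] ∃[ b ] 0ℚ < a × 0ℚ < b × x a × y b × p < a ℚ.* b

-- For s = n / d the conditions p < q ^ s and q ^ s < x (with x ≥ 0) are
-- expressed by d-th powers.

_<[_^_] : ℚ → (q : ℕ) .{{_ : NonTrivial q}} → ℚ → Set
p <[ q ^ s ] = p ℚ.≤ 0ℚ ⊎ p ^ℚ ℚ.denominatorℕ s < q ^ℤ ℚ.numerator s

[_^_]<_ : (q : ℕ) .{{_ : NonTrivial q}} → ℚ → ℚ → Set
[ q ^ s ]< x = q ^ℤ ℚ.numerator s < x ^ℚ ℚ.denominatorℕ s

-- q ^ e is the supremum of q ^ s over the rationals s < e.

_^ʳ_ : (q : ℕ) .{{_ : NonTrivial q}} → Cut → Cut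
(q ^ʳ e) p = ∃[ s ] e s × p <[ q ^ s ]

-- The base-q logarithm of a rational x ≥ 0; log 0 = −∞.

log : (q : ℕ) .{{_ : NonTrivial q}} → ℚ → Cut
log q x s = [ q ^ s ]< x

q^j∸1≢0 : ∀ q .{{_ : NonTrivial q}} j → NonZero (q ℕ.^ suc j ℕ.∸ 1)
q^j∸1≢0 q j = ℕ.>-nonZero (ℕ.m<n⇒0<n∸m
  (ℕ.<-≤-trans (ℕ.nonTrivial⇒n>1 q) (ℕ.m≤m*n q (q ℕ.^ j) {{nonTrivial⇒pow-nonZero q j}})))

-- ∏_{j=1}^{J} (1 − q^{-j})^{-1}, where (1 − q^{-j})^{-1} = q^j / (q^j − 1).

partialProduct : (q : ℕ) .{{_ : NonTrivial q}} → ℕ → ℚ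
partialProduct q zero    = 1ℚ
partialProduct q (suc j) =
  partialProduct q j ℚ.* (+ (q ℕ.^ suc j) / (q ℕ.^ suc j ℕ.∸ 1)) {{q^j∸1≢0 q j}}

-- The partial products increase, so their limit is their supremum.

Cq : (q : ℕ) .{{_ : NonTrivial q}} → Cut
Cq q p = ∃[ J ] p < partialProduct q J

------------------------------------------------------------------------
-- Parameters

record Admissible (k r m c : ℕ) : Set where
  field
    2≤k : 2 ℕ.≤ k
    k≤r : k ℕ.≤ r
    1≤m : 1 ℕ.≤ m
    c-eq : c ℕ.* r ≡ m ℕ.* (r C k)

pred-nonZero : ∀ q .{{_ : NonTrivial q}} → NonZero (q ℕ.∸ 1)
pred-nonZero (suc (suc _)) = _

L : (q : ℕ) .{{_ : NonTrivial q}} → ℕ → ℚ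
L q r = (+ (q ℕ.^ suc r ℕ.∸ 1) / (q ℕ.∸ 1)) {{pred-nonZero q}}

-- For k ≤ r the denominator suc (r ∸ k) is r + 1 − k.

A : (k r c : ℕ) → ℚ
A k r c = ι (suc r) ℚ.* (1ℚ ℚ.+ + ((k ℕ.∸ 1) ℕ.* c) / suc (r ℕ.∸ k))

threshold : ℕ → ℚ
threshold k = (+ (k ℕ.∸ 1) / (k ℕ.!)) {{k !≢0}}

{-# OPTIONS --safe #-}

-- A form vanishes on a subspace H of dimension s with probability
-- q^{-m C(s,k)}: the alternating forms on 𝔽_qˢ are parametrised by their
-- m C(s,k) coefficients, and every form on H extends along a linear retraction
-- onto H.  Counting independent tuples gives the number of s-dimensional
-- subspaces, hence E X_{N,s}; as ∏ (1 − q^{-j}) ≥ q^{-2}, this also bounds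
-- μ_{N,r} by q².
--
-- For the lower bound, all hyperplanes of a null (r+1)-space are null, and two
-- distinct hyperplanes determine the (r+1)-space they span.  The pairs of
-- distinct hyperplanes of the null (r+1)-spaces are therefore disjoint, which
-- gives (X_{N,r})_t ≥ X_{N,r+1} (L_r)_t for t ≥ 2; moreover
-- (L_r)_t ≥ (L_r / 2)^t ≥ q^{tr−t}.  Parts (i) and (ii) then compare exponents.

module Submission where

-- A null (r+1)-space is rare, with expected number about q^(-A_r), but it brings L_r null r-spaces
-- at once. Its contribution to the t-th factorial moment is of order q^(tr - A_r), up to q^(O(t)),
-- and this is what beats μ^t for large t. Two (r+1)-spaces can share one hyperplane but not two,
-- hence the condition t ≥ 2. No t-tuples of subspaces are enumerated: with x, M, l for X_{N,r},
-- X_{N,r+1}, L_r, the pairs give x(x - 1) ≥ M l(l - 1), and M ≠ 0 forces x ≥ l, so every further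
-- factor x - i dominates l - i. The relation c r = m C(r,k) balances the number of r-spaces, of
-- order q^(cr), against the probability q^(-m C(r,k)); this keeps μ bounded by a fixed power of q.
-- One dimension higher it gives A_r = m C(r+1,k) - (r+1)(c-1), an integer. So the estimates can be
-- made on natural numbers, multiplied by the number of forms, and passed to integer powers of q;
-- cuts matter only for C_q, the logarithm and ε.

-- Counting with duplicate-free lists

module Counting where

  open import Data.Empty using (⊥-elim)
  open import Data.Fin using (Fin)
  open import Data.Fin.Properties using (injective⇒≤)
  open import Data.List using (List; []; _∷_; length; filter; map; lookup; cartesianProduct; _++_)
  open import Data.List.Properties using (length-++; length-map)
  open import Data.List.Membership.Propositional using (_∈_)
  open import Data.List.Membership.Propositional.Properties
  open import Data.List.Relation.Unary.All as All using (All; []; _∷_)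
  open import Data.List.Relation.Unary.Any as Any using (here; there)
  open import Data.List.Relation.Unary.Any.Properties as Any using (lookup-index)
  open import Data.List.Relation.Unary.AllPairs using ([]; _∷_)
  open import Data.List.Relation.Unary.Unique.Propositional using (Unique)
  import Data.List.Relation.Unary.Unique.Propositional.Properties as Unique
  open import Data.Nat
  open import Data.Nat.ListAction using (sum)
  open import Data.Nat.Properties
  open import Algebra.Properties.CommutativeSemigroup +-commutativeSemigroup using (interchange)
  open import Data.Product using (_×_; _,_; proj₁; proj₂)
  open import Relation.Binary.PropositionalEquality
  open import Relation.Nullary using (Dec; yes; no; ¬?)
  open import Relation.Nullary.Decidable using (_×-dec_)
  open import Relation.Unary using (Pred; Decidable)
  open import Level using (0ℓ)
  open import Function using (_∘_)

  module _ {A B : Set} {xs : List A} {ys : List B} where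

    -- The position of `f x` in `ys` gives an injection of index sets, and the pigeonhole principle
    -- for `Fin` applies. Injectivity is asked on members only, because the maps used later are
    -- injective on sublists of `elements` and not on whole types.
    length-injection : Unique xs → (f : A → B) → (∀ {x} → x ∈ xs → f x ∈ ys) →
      (∀ {x x′} → x ∈ xs → x′ ∈ xs → f x ≡ f x′ → x ≡ x′) → length xs ≤ length ys
    length-injection u f f∈ inj = injective⇒≤ {f = position} λ {i} {j} eq →
      lookup-injective u (inj (∈-lookup i) (∈-lookup j)
        (trans (Any.lookup-index (f∈ (∈-lookup i)))
          (trans (cong (lookup ys) eq) (sym (Any.lookup-index (f∈ (∈-lookup j)))))))
      where
      position : Fin (length xs) → Fin (length ys)
      position i = Any.index (f∈ (∈-lookup {xs = xs} i))
      lookup-injective : ∀ {A : Set} {zs : List A} → Unique zs → ∀ {i j} → lookup zs i ≡ lookup zs j → i ≡ j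
      lookup-injective (z≢ ∷ u) {Fin.zero}  {Fin.zero}  _  = refl
      lookup-injective (z≢ ∷ u) {Fin.zero}  {Fin.suc j} eq = ⊥-elim (All.lookup z≢ (∈-lookup j) eq)
      lookup-injective (z≢ ∷ u) {Fin.suc i} {Fin.zero}  eq = ⊥-elim (All.lookup z≢ (∈-lookup i) (sym eq))
      lookup-injective (z≢ ∷ u) {Fin.suc i} {Fin.suc j} eq = cong Fin.suc (lookup-injective u eq)

  length-bijection : ∀ {A B : Set} {xs : List A} {ys : List B} → Unique xs → Unique ys →
    (f : A → B) (g : B → A) → (∀ {x} → x ∈ xs → f x ∈ ys) → (∀ {y} → y ∈ ys → g y ∈ xs) →
    (∀ {x} → x ∈ xs → g (f x) ≡ x) → (∀ {y} → y ∈ ys → f (g y) ≡ y) → length xs ≡ length ys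
  length-bijection ux uy f g f∈ g∈ gf fg = ≤-antisym
    (length-injection ux f f∈ λ x∈ x′∈ eq → trans (sym (gf x∈)) (trans (cong g eq) (gf x′∈)))
    (length-injection uy g g∈ λ y∈ y′∈ eq → trans (sym (fg y∈)) (trans (cong f eq) (fg y′∈)))

  length-cong : ∀ {A : Set} {xs ys : List A} → Unique xs → Unique ys →
    (∀ {x} → x ∈ xs → x ∈ ys) → (∀ {x} → x ∈ ys → x ∈ xs) → length xs ≡ length ys
  length-cong ux uy f g = length-bijection ux uy (λ x → x) (λ x → x) f g (λ _ → refl) (λ _ → refl)

  length-singleton : ∀ {A : Set} {xs : List A} → Unique xs → ∀ {x} → x ∈ xs → (∀ {y} → y ∈ xs → y ≡ x) →
    length xs ≡ 1
  length-singleton u x∈ only =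
    length-cong u ([] ∷ []) (λ y∈ → here (only y∈)) (λ { (here refl) → x∈ })

  module _ {A : Set} (f g : A → ℕ) where

    sum-cong : ∀ xs → (∀ {x} → x ∈ xs → f x ≡ g x) → sum (map f xs) ≡ sum (map g xs)
    sum-cong []       eq = refl
    sum-cong (x ∷ xs) eq = cong₂ _+_ (eq (here refl)) (sum-cong xs (eq ∘ there))

    sum-mono : ∀ xs → (∀ {x} → x ∈ xs → f x ≤ g x) → sum (map f xs) ≤ sum (map g xs)
    sum-mono []       le = ≤-refl
    sum-mono (x ∷ xs) le = +-mono-≤ (le (here refl)) (sum-mono xs (le ∘ there))

    sum-map-+ : ∀ xs → sum (map (λ x → f x + g x) xs) ≡ sum (map f xs) + sum (map g xs)
    sum-map-+ []       = refl
    sum-map-+ (x ∷ xs) = trans (cong (f x + g x +_) (sum-map-+ xs))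
      (interchange (f x) (g x) (sum (map f xs)) (sum (map g xs)))

  length-cartesianProduct : ∀ {A B : Set} (xs : List A) (ys : List B) →
    length (cartesianProduct xs ys) ≡ length xs * length ys
  length-cartesianProduct []       ys = refl
  length-cartesianProduct (x ∷ xs) ys = trans (length-++ (map (x ,_) ys))
    (cong₂ _+_ (length-map (x ,_) ys) (length-cartesianProduct xs ys))

  sum-const : ∀ {A : Set} c (xs : List A) → sum (map (λ _ → c) xs) ≡ length xs * c
  sum-const c []       = refl
  sum-const c (x ∷ xs) = cong (c +_) (sum-const c xs)

  sum-*ʳ : ∀ {A : Set} (f : A → ℕ) c xs → sum (map (λ x → f x * c) xs) ≡ sum (map f xs) * c
  sum-*ʳ f c []       = refl
  sum-*ʳ f c (x ∷ xs) = trans (cong (f x * c +_) (sum-*ʳ f c xs)) (sym (*-distribʳ-+ c (f x) (sum (map f xs))))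

  module _ {A B : Set} {R : A → B → Set} (R? : ∀ x y → Dec (R x y)) where

    private
      indicator : ∀ {P : Set} → Dec P → ℕ
      indicator (yes _) = 1
      indicator (no  _) = 0

      length-filter : ∀ {C : Set} {P : Pred C 0ℓ} (P? : Decidable P) zs →
        length (filter P? zs) ≡ sum (map (indicator ∘ P?) zs)
      length-filter P? []       = refl
      length-filter P? (z ∷ zs) with P? z
      ... | yes _ = cong suc (length-filter P? zs)
      ... | no  _ = length-filter P? zs

    -- Both sides count the related pairs. In `first-moment` this exchange is the linearity of
    -- expectation.
    sum-filter-swap : ∀ xs ys →
      sum (map (λ x → length (filter (R? x) ys)) xs) ≡ sum (map (λ y → length (filter (λ x → R? x y) xs)) ys)
    sum-filter-swap []       ys = sym (trans (sum-const 0 ys) (*-zeroʳ (length ys)))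
    sum-filter-swap (x ∷ xs) ys = begin
      length (filter (R? x) ys) + sum (map (λ x → length (filter (R? x) ys)) xs)
        ≡⟨ cong₂ _+_ (length-filter (R? x) ys) (sum-filter-swap xs ys) ⟩
      sum (map (λ y → indicator (R? x y)) ys) + sum (map (λ y → length (filter (λ x → R? x y) xs)) ys)
        ≡⟨ sum-map-+ _ _ ys ⟨
      sum (map (λ y → indicator (R? x y) + length (filter (λ x → R? x y) xs)) ys)
        ≡⟨ sum-cong _ _ ys (λ {y} _ → step y) ⟩
      sum (map (λ y → length (filter (λ x → R? x y) (x ∷ xs))) ys) ∎
      where
      open ≡-Reasoning
      step : ∀ y → indicator (R? x y) + length (filter (λ x → R? x y) xs) ≡ length (filter (λ x → R? x y) (x ∷ xs))
      step y with R? x y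
      ... | yes _ = refl
      ... | no  _ = refl

    -- Every application has `a` or `b` equal to 1 and so counts through the fibres of a map: a
    -- tuple to its tail, a basis to its span, a form to the coefficients of its restriction.
    doubleCount : ∀ {xs ys a b} →
      (∀ {x} → x ∈ xs → length (filter (R? x) ys) ≡ a) →
      (∀ {y} → y ∈ ys → length (filter (λ x → R? x y) xs) ≡ b) →
      length xs * a ≡ length ys * b
    doubleCount {xs} {ys} {a} {b} rows columns = begin
      length xs * a ≡⟨ sum-const a xs ⟨
      sum (map (λ _ → a) xs) ≡⟨ sum-cong _ _ xs rows ⟨
      sum (map (λ x → length (filter (R? x) ys)) xs) ≡⟨ sum-filter-swap xs ys ⟩
      sum (map (λ y → length (filter (λ x → R? x y) xs)) ys) ≡⟨ sum-cong _ _ ys columns ⟩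
      sum (map (λ _ → b) ys) ≡⟨ sum-const b ys ⟩
      length ys * b ∎
      where open ≡-Reasoning

  filter-unique : ∀ {A : Set} {R : A → Set} (R? : Decidable R) {xs : List A} → Unique xs →
    ∀ {x} → x ∈ xs → R x → (∀ {y} → y ∈ xs → R y → y ≡ x) → length (filter R? xs) ≡ 1
  filter-unique R? u x∈ Rx only = length-singleton (Unique.filter⁺ R? u) (∈-filter⁺ R? x∈ Rx)
    (λ y∈ → let y∈xs , Ry = ∈-filter⁻ R? y∈ in only y∈xs Ry)

  length-filter-split : ∀ {A : Set} {P : Pred A 0ℓ} (P? : Decidable P) xs →
    length (filter P? xs) + length (filter (¬? ∘ P?) xs) ≡ length xs
  length-filter-split P? []       = refl
  length-filter-split P? (x ∷ xs) with P? x
  ... | yes _ = cong suc (length-filter-split P? xs)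
  ... | no  _ = trans (+-suc _ _) (cong suc (length-filter-split P? xs))

  -- The families of ordered pairs of distinct points of the sets R u are disjoint.
  module _ {A B : Set} (_≟_ : (x y : A) → Dec (x ≡ y)) {R : B → A → Set} (R? : ∀ u x → Dec (R u x)) where

    pairs-in-members : ∀ {xs us l} → Unique xs → Unique us →
      (∀ {u} → u ∈ us → length (filter (R? u) xs) ≡ l) →
      (∀ {u v x y} → u ∈ us → v ∈ us → x ∈ xs → y ∈ xs → x ≢ y → R u x → R u y → R v x → R v y → u ≡ v) →
      length xs + length us * (l * l ∸ l) ≤ length xs * length xs
    pairs-in-members {xs} {us} {l} ux uu size meet = begin
      length xs + length us * (l * l ∸ l)
        ≡⟨ cong₂ _+_ diagonal triples ⟩
      length (filter same? pairs) + sum (map (λ p → length (filter (λ u → both? u p) us)) (filter (¬? ∘ same?) pairs))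
        ≤⟨ +-monoʳ-≤ (length (filter same? pairs)) (sum-mono _ _ (filter (¬? ∘ same?) pairs) atMostOne) ⟩
      length (filter same? pairs) + sum (map (λ _ → 1) (filter (¬? ∘ same?) pairs))
        ≡⟨ cong (length (filter same? pairs) +_) (trans (sum-const 1 (filter (¬? ∘ same?) pairs)) (*-identityʳ _)) ⟩
      length (filter same? pairs) + length (filter (¬? ∘ same?) pairs)
        ≡⟨ length-filter-split same? pairs ⟩
      length pairs
        ≡⟨ length-cartesianProduct xs xs ⟩
      length xs * length xs ∎
      where
      open ≤-Reasoning
      pairs = cartesianProduct xs xs
      uniquePairs : Unique pairs
      uniquePairs = Unique.cartesianProduct⁺ ux ux
      same? : Decidable (λ (p : A × A) → proj₁ p ≡ proj₂ p)
      same? (x , y) = x ≟ y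
      both? : ∀ u (p : A × A) → Dec (R u (proj₁ p) × R u (proj₂ p))
      both? u (x , y) = R? u x ×-dec R? u y
      diagonalOf : ∀ {zs} → Unique zs → length zs ≡ length (filter same? (cartesianProduct zs zs))
      diagonalOf {zs} uz = length-bijection uz (Unique.filter⁺ same? (Unique.cartesianProduct⁺ uz uz))
        (λ x → x , x) proj₁
        (λ x∈ → ∈-filter⁺ same? (∈-cartesianProduct⁺ x∈ x∈) refl)
        (λ p∈ → proj₁ (∈-cartesianProduct⁻ zs zs (proj₁ (∈-filter⁻ same? p∈))))
        (λ _ → refl)
        (λ {y} p∈ → cong (proj₁ y ,_) (proj₂ (∈-filter⁻ same? {xs = cartesianProduct zs zs} p∈)))
      diagonal : length xs ≡ length (filter same? pairs)
      diagonal = diagonalOf ux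
      offDiagonal : ∀ {zs} → Unique zs → length (filter (¬? ∘ same?) (cartesianProduct zs zs)) ≡ length zs * length zs ∸ length zs
      offDiagonal {zs} uz = sym (trans (cong₂ _∸_
        (trans (sym (length-cartesianProduct zs zs)) (sym (length-filter-split same? (cartesianProduct zs zs))))
        (diagonalOf uz)) (m+n∸m≡n (length (filter same? (cartesianProduct zs zs))) _))
      perMember : ∀ {u} → u ∈ us → length (filter (both? u) (filter (¬? ∘ same?) pairs)) ≡ l * l ∸ l
      perMember {u} u∈ = trans
        (length-cong (Unique.filter⁺ (both? u) (Unique.filter⁺ (¬? ∘ same?) uniquePairs))
          (Unique.filter⁺ (¬? ∘ same?) (Unique.cartesianProduct⁺ uM uM))
          (λ p∈ → let p∈off , Rx , Ry = ∈-filter⁻ (both? u) p∈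
                      p∈pairs , x≢y = ∈-filter⁻ (¬? ∘ same?) p∈off
                      x∈ , y∈ = ∈-cartesianProduct⁻ xs xs p∈pairs
                  in ∈-filter⁺ (¬? ∘ same?) (∈-cartesianProduct⁺ (∈-filter⁺ (R? u) x∈ Rx) (∈-filter⁺ (R? u) y∈ Ry)) x≢y)
          (λ p∈ → let p∈M , x≢y = ∈-filter⁻ (¬? ∘ same?) p∈
                      x∈M , y∈M = ∈-cartesianProduct⁻ (filter (R? u) xs) (filter (R? u) xs) p∈M
                      x∈ , Rx = ∈-filter⁻ (R? u) {xs = xs} x∈M
                      y∈ , Ry = ∈-filter⁻ (R? u) {xs = xs} y∈M
                  in ∈-filter⁺ (both? u) (∈-filter⁺ (¬? ∘ same?) (∈-cartesianProduct⁺ {xs = xs} {ys = xs} x∈ y∈) x≢y) (Rx , Ry)))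
        (trans (offDiagonal uM) (cong (λ n → n * n ∸ n) (size u∈)))
        where
        uM : Unique (filter (R? u) xs)
        uM = Unique.filter⁺ (R? u) ux
      triples : length us * (l * l ∸ l) ≡
        sum (map (λ p → length (filter (λ u → both? u p) us)) (filter (¬? ∘ same?) pairs))
      triples = trans (sym (sum-const (l * l ∸ l) us))
        (trans (sym (sum-cong _ _ us perMember)) (sum-filter-swap both? us (filter (¬? ∘ same?) pairs)))
      atMostOne : ∀ {p} → p ∈ filter (¬? ∘ same?) pairs → length (filter (λ u → both? u p) us) ≤ 1
      -- By `meet` the constant map into a one-element list is injective on the members that contain
      -- both points, so there is at most one of them.
      atMostOne {x , y} p∈ = length-injection {ys = 0 ∷ []} (Unique.filter⁺ (λ u → both? u (x , y)) uu) (λ _ → 0) (λ _ → here refl)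
        λ u∈ v∈ _ →
          let p∈pairs , x≢y = ∈-filter⁻ (¬? ∘ same?) p∈
              x∈ , y∈ = ∈-cartesianProduct⁻ xs xs p∈pairs
              u∈us , Rux , Ruy = ∈-filter⁻ (λ u → both? u (x , y)) u∈
              v∈us , Rvx , Rvy = ∈-filter⁻ (λ u → both? u (x , y)) v∈
          in meet u∈us v∈us x∈ y∈ x≢y Rux Ruy Rvx Rvy

-- Linear algebra over a finite field

module LinearAlgebra where

  open import Defs
  open import Data.Empty using (⊥-elim)
  open import Data.Fin.Base using (zero; suc)
  open import Data.List using (length)
  open import Data.List.Properties using (length-tabulate)
  open import Data.List.Relation.Unary.Unique.Propositional using (Unique)
  import Data.List.Relation.Unary.Unique.Propositional.Properties as Unique
  open import Data.Nat as ℕ using (ℕ; zero; suc)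
  import Data.Nat.Properties as ℕ
  open import Data.Product using (∃-syntax; _,_)
  open import Data.Vec as Vec using (Vec; []; _∷_; head; tail)
  import Data.Vec.Properties as Vec
  open import Data.Vec.Relation.Unary.All using ([]; _∷_)
  open import Function using (Inverse)
  open import Relation.Binary.PropositionalEquality
  open import Relation.Nullary using (yes; no; ¬_)

  open Finite {{...}}

  module _ {A : Set} {{finite : Finite A}} where

    index-element : ∀ i → index (element {A} i) ≡ i
    index-element = Inverse.strictlyInverseˡ (enum {A})

    elements-unique : Unique (elements {A})
    elements-unique = Unique.tabulate⁺ λ {i} {j} eq →
      trans (sym (index-element i)) (trans (cong index eq) (index-element j))

    length-elements : length (elements {A}) ≡ card {A}
    length-elements = length-tabulate (element {A})

  card-Vec : ∀ (A : Set) {{_ : Finite A}} n → card {Vec A n} ≡ card {A} ℕ.^ n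
  card-Vec A zero    = refl
  card-Vec A (suc n) = cong (card {A} ℕ.*_) (card-Vec A n)

  module VectorSpace {q : ℕ} (F : FiniteField q) where
    open FiniteField F
      hiding (sym; refl; trans; reflexive)
    open Coordinates F

    infix 8 ⊖_

    ⊖_ : ∀ {n} → Space n → Space n
    ⊖ x = (- 1#) ∙ x

    inverse : ∀ {a} → a ≢ 0# → ∃[ b ] b * a ≡ 1#
    inverse {a} a≢0 with #⇒invertible {a} {0#} a≢0
    ... | b , ba≡1 , _ = b , trans (cong (b *_) (sym a-0≡a)) ba≡1
      where
      a-0≡a : a + (- 0#) ≡ a
      a-0≡a = trans (cong (a +_) (trans (sym (+-identityˡ (- 0#))) (-‿inverseʳ 0#))) (+-identityʳ a)

    module _ {n : ℕ} where

      ⊕-assoc : (x y z : Space n) → (x ⊕ y) ⊕ z ≡ x ⊕ (y ⊕ z)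
      ⊕-assoc = Vec.zipWith-assoc +-assoc

      ⊕-comm : (x y : Space n) → x ⊕ y ≡ y ⊕ x
      ⊕-comm = Vec.zipWith-comm +-comm

      ⊕-identityˡ : (x : Space n) → 𝟎 ⊕ x ≡ x
      ⊕-identityˡ = Vec.zipWith-identityˡ +-identityˡ

      ⊕-identityʳ : (x : Space n) → x ⊕ 𝟎 ≡ x
      ⊕-identityʳ = Vec.zipWith-identityʳ +-identityʳ

      ⊕-interchange : (w x y z : Space n) → (w ⊕ x) ⊕ (y ⊕ z) ≡ (w ⊕ y) ⊕ (x ⊕ z)
      ⊕-interchange w x y z = begin
        (w ⊕ x) ⊕ (y ⊕ z) ≡⟨ ⊕-assoc w x (y ⊕ z) ⟩
        w ⊕ (x ⊕ (y ⊕ z)) ≡⟨ cong (w ⊕_) (⊕-assoc x y z) ⟨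
        w ⊕ ((x ⊕ y) ⊕ z) ≡⟨ cong (λ u → w ⊕ (u ⊕ z)) (⊕-comm x y) ⟩
        w ⊕ ((y ⊕ x) ⊕ z) ≡⟨ cong (w ⊕_) (⊕-assoc y x z) ⟩
        w ⊕ (y ⊕ (x ⊕ z)) ≡⟨ ⊕-assoc w y (x ⊕ z) ⟨
        (w ⊕ y) ⊕ (x ⊕ z) ∎
        where open ≡-Reasoning

    ∙-distribˡ : ∀ {n} a (x y : Space n) → a ∙ (x ⊕ y) ≡ a ∙ x ⊕ a ∙ y
    ∙-distribˡ a []      []      = refl
    ∙-distribˡ a (x ∷ v) (y ∷ w) = cong₂ _∷_ (distribˡ a x y) (∙-distribˡ a v w)

    ∙-distribʳ : ∀ {n} a b (x : Space n) → (a + b) ∙ x ≡ a ∙ x ⊕ b ∙ x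
    ∙-distribʳ a b []      = refl
    ∙-distribʳ a b (x ∷ v) = cong₂ _∷_ (distribʳ x a b) (∙-distribʳ a b v)

    ∙-assoc : ∀ {n} a b (x : Space n) → (a * b) ∙ x ≡ a ∙ b ∙ x
    ∙-assoc a b []      = refl
    ∙-assoc a b (x ∷ v) = cong₂ _∷_ (*-assoc a b x) (∙-assoc a b v)

    1∙ : ∀ {n} (x : Space n) → 1# ∙ x ≡ x
    1∙ []      = refl
    1∙ (x ∷ v) = cong₂ _∷_ (*-identityˡ x) (1∙ v)

    0∙ : ∀ {n} (x : Space n) → 0# ∙ x ≡ 𝟎
    0∙ []      = refl
    0∙ (x ∷ v) = cong₂ _∷_ (zeroˡ x) (0∙ v)

    ∙𝟎 : ∀ n a → a ∙ 𝟎 {n} ≡ 𝟎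
    ∙𝟎 zero    a = refl
    ∙𝟎 (suc n) a = cong₂ _∷_ (zeroʳ a) (∙𝟎 n a)

    ∙-comm : ∀ {n} a b (x : Space n) → a ∙ b ∙ x ≡ b ∙ a ∙ x
    ∙-comm a b x = trans (sym (∙-assoc a b x)) (trans (cong (_∙ x) (*-comm a b)) (∙-assoc b a x))

    module _ {n : ℕ} where

      ⊖-inverseʳ : (x : Space n) → x ⊕ ⊖ x ≡ 𝟎
      ⊖-inverseʳ x = begin
        x ⊕ ⊖ x ≡⟨ cong (_⊕ ⊖ x) (1∙ x) ⟨
        1# ∙ x ⊕ (- 1#) ∙ x ≡⟨ ∙-distribʳ 1# (- 1#) x ⟨
        (1# + (- 1#)) ∙ x ≡⟨ cong (_∙ x) (-‿inverseʳ 1#) ⟩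
        0# ∙ x ≡⟨ 0∙ x ⟩
        𝟎 ∎
        where open ≡-Reasoning

      ⊖-inverseˡ : (x : Space n) → ⊖ x ⊕ x ≡ 𝟎
      ⊖-inverseˡ x = trans (⊕-comm (⊖ x) x) (⊖-inverseʳ x)

      ⊕-⊖-cancelʳ : (x y : Space n) → (x ⊕ y) ⊕ ⊖ y ≡ x
      ⊕-⊖-cancelʳ x y = trans (⊕-assoc x y (⊖ y)) (trans (cong (x ⊕_) (⊖-inverseʳ y)) (⊕-identityʳ x))

      ⊖-⊕-cancelʳ : (x y : Space n) → (x ⊕ ⊖ y) ⊕ y ≡ x
      ⊖-⊕-cancelʳ x y = trans (⊕-assoc x (⊖ y) y) (trans (cong (x ⊕_) (⊖-inverseˡ y)) (⊕-identityʳ x))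

      ⊕-zero⇒≡⊖ : (x y : Space n) → x ⊕ y ≡ 𝟎 → x ≡ ⊖ y
      ⊕-zero⇒≡⊖ x y eq = trans (sym (⊕-⊖-cancelʳ x y)) (trans (cong (_⊕ ⊖ y) eq) (⊕-identityˡ (⊖ y)))

      ⊖-zero⇒≡ : (x y : Space n) → x ⊕ ⊖ y ≡ 𝟎 → x ≡ y
      ⊖-zero⇒≡ x y eq = trans (sym (⊖-⊕-cancelʳ x y)) (trans (cong (_⊕ y) eq) (⊕-identityˡ y))

    Linear : ∀ {n l} → (Space n → Space l) → Set
    Linear φ = ∀ a x y → φ (a ∙ x ⊕ y) ≡ a ∙ φ x ⊕ φ y

    Linear-𝟎 : ∀ {n l} {φ : Space n → Space l} → Linear φ → φ 𝟎 ≡ 𝟎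
    Linear-𝟎 {n} {φ = φ} linear = begin
      φ 𝟎 ≡⟨ cong φ (⊖-inverseˡ 𝟎) ⟨
      φ (⊖ 𝟎 ⊕ 𝟎) ≡⟨ linear (- 1#) 𝟎 𝟎 ⟩
      ⊖ φ 𝟎 ⊕ φ 𝟎 ≡⟨ ⊖-inverseˡ (φ 𝟎) ⟩
      𝟎 ∎
      where open ≡-Reasoning

    combination-linear : ∀ {n s} (bs : Vec (Space n) s) → Linear (λ as → combination as bs)
    combination-linear {n} [] a [] [] = sym (trans (⊕-identityʳ (a ∙ 𝟎)) (∙𝟎 n a))
    combination-linear (b ∷ bs) a (x ∷ xs) (y ∷ ys) = begin
      ((a * x) + y) ∙ b ⊕ combination (a ∙ xs ⊕ ys) bs
        ≡⟨ cong₂ _⊕_ (trans (∙-distribʳ (a * x) y b) (cong (_⊕ y ∙ b) (∙-assoc a x b))) (combination-linear bs a xs ys) ⟩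
      (a ∙ x ∙ b ⊕ y ∙ b) ⊕ (a ∙ combination xs bs ⊕ combination ys bs)
        ≡⟨ ⊕-interchange _ _ _ _ ⟩
      (a ∙ x ∙ b ⊕ a ∙ combination xs bs) ⊕ (y ∙ b ⊕ combination ys bs)
        ≡⟨ cong (_⊕ (y ∙ b ⊕ combination ys bs)) (∙-distribˡ a (x ∙ b) (combination xs bs)) ⟨
      a ∙ (x ∙ b ⊕ combination xs bs) ⊕ (y ∙ b ⊕ combination ys bs) ∎
      where open ≡-Reasoning

    Independent : ∀ {n s} → Vec (Space n) s → Set
    Independent {s = s} bs = ∀ (as : Vec Carrier s) → combination as bs ≡ 𝟎 → as ≡ 𝟎

    combination-injective : ∀ {n s} {bs : Vec (Space n) s} → Independent bs →
      ∀ {as as′} → combination as bs ≡ combination as′ bs → as ≡ as′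
    combination-injective {bs = bs} independent {as} {as′} eq = ⊖-zero⇒≡ as as′ (independent _ (begin
      combination (as ⊕ ⊖ as′) bs ≡⟨ cong (λ v → combination v bs) (⊕-comm as (⊖ as′)) ⟩
      combination (⊖ as′ ⊕ as) bs ≡⟨ combination-linear bs (- 1#) as′ as ⟩
      ⊖ combination as′ bs ⊕ combination as bs ≡⟨ cong (⊖ combination as′ bs ⊕_) eq ⟩
      ⊖ combination as′ bs ⊕ combination as′ bs ≡⟨ ⊖-inverseˡ _ ⟩
      𝟎 ∎))
      where open ≡-Reasoning

    independent-tail : ∀ {n s} {b : Space n} {bs : Vec (Space n) s} → Independent (b ∷ bs) → Independent bs
    independent-tail {b = b} {bs} independent as eq = cong tail (independent (0# ∷ as)
      (trans (cong₂ _⊕_ (0∙ b) eq) (⊕-identityˡ 𝟎)))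

    -- If 1 = 0, then the difference 0 - 0 is invertible, and the field axioms would make 0 apart
    -- from itself.
    1≢0 : 1# ≢ 0#
    1≢0 1≡0 = invertible⇒# {0#} {0#} (0# , trans (zeroˡ _) (sym 1≡0) , trans (zeroʳ _) (sym 1≡0)) refl

    independent-head : ∀ {n s} {b : Space n} {bs : Vec (Space n) s} → Independent (b ∷ bs) →
      ¬ (∃[ as ] combination as bs ≡ b)
    independent-head {b = b} {bs} independent (as , eq) = 1≢0 (begin
      1# ≡⟨ +-identityʳ 1# ⟨
      1# + 0# ≡⟨ cong (1# +_) -1≡0 ⟨
      1# + (- 1#) ≡⟨ -‿inverseʳ 1# ⟩
      0# ∎)
      where
      open ≡-Reasoning
      -1≡0 : - 1# ≡ 0#
      -1≡0 = cong head (independent ((- 1#) ∷ as) (trans (cong (⊖ b ⊕_) eq) (⊖-inverseˡ b)))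

    extend-independent : ∀ {n s} {b : Space n} {bs : Vec (Space n) s} → Independent bs →
      ¬ (∃[ as ] combination as bs ≡ b) → Independent (b ∷ bs)
    extend-independent {b = b} {bs} independent b∉ (a ∷ as) eq with a ≟ 0#
    ... | yes refl = cong (0# ∷_) (independent as (trans (sym (⊕-identityˡ _)) (trans (cong (_⊕ combination as bs) (sym (0∙ b))) eq)))
    ... | no  a≢0 with inverse a≢0
    ...   | c , ca≡1 = ⊥-elim (b∉ ((c * (- 1#)) ∙ as , (begin
      combination ((c * (- 1#)) ∙ as) bs ≡⟨ cong (λ v → combination v bs) (⊕-identityʳ ((c * (- 1#)) ∙ as)) ⟨
      combination ((c * (- 1#)) ∙ as ⊕ 𝟎) bs ≡⟨ combination-linear bs _ as 𝟎 ⟩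
      (c * (- 1#)) ∙ combination as bs ⊕ combination 𝟎 bs
        ≡⟨ cong ((c * (- 1#)) ∙ combination as bs ⊕_) (Linear-𝟎 (combination-linear bs)) ⟩
      (c * (- 1#)) ∙ combination as bs ⊕ 𝟎 ≡⟨ ⊕-identityʳ _ ⟩
      (c * (- 1#)) ∙ combination as bs ≡⟨ ∙-assoc c (- 1#) _ ⟩
      c ∙ ⊖ combination as bs ≡⟨ cong (c ∙_) (⊕-zero⇒≡⊖ _ _ eq) ⟨
      c ∙ a ∙ b ≡⟨ ∙-assoc c a b ⟨
      (c * a) ∙ b ≡⟨ cong (_∙ b) ca≡1 ⟩
      1# ∙ b ≡⟨ 1∙ b ⟩
      b ∎)))
      where open ≡-Reasoning

    standardBasis : ∀ n → Vec (Space n) n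
    standardBasis zero    = []
    standardBasis (suc n) = (1# ∷ 𝟎) ∷ Vec.map (0# ∷_) (standardBasis n)

    combination-map-0∷ : ∀ {n s} (as : Vec Carrier s) (bs : Vec (Space n) s) →
      combination as (Vec.map (0# ∷_) bs) ≡ 0# ∷ combination as bs
    combination-map-0∷ []       []       = refl
    combination-map-0∷ (a ∷ as) (b ∷ bs) = begin
      a ∙ (0# ∷ b) ⊕ combination as (Vec.map (0# ∷_) bs) ≡⟨ cong (a ∙ (0# ∷ b) ⊕_) (combination-map-0∷ as bs) ⟩
      ((a * 0#) + 0#) ∷ (a ∙ b ⊕ combination as bs) ≡⟨ cong (_∷ (a ∙ b ⊕ combination as bs)) (trans (+-identityʳ _) (zeroʳ a)) ⟩
      0# ∷ (a ∙ b ⊕ combination as bs) ∎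
      where open ≡-Reasoning

    combination-standardBasis : ∀ {n} (v : Space n) → combination v (standardBasis n) ≡ v
    combination-standardBasis []      = refl
    combination-standardBasis {suc n} (a ∷ v) = begin
      a ∙ (1# ∷ 𝟎) ⊕ combination v (Vec.map (0# ∷_) (standardBasis n))
        ≡⟨ cong (a ∙ (1# ∷ 𝟎) ⊕_) (combination-map-0∷ v (standardBasis n)) ⟩
      ((a * 1#) + 0#) ∷ (a ∙ 𝟎 ⊕ combination v (standardBasis n))
        ≡⟨ cong₂ _∷_ (trans (+-identityʳ _) (*-identityʳ a))
             (trans (cong₂ _⊕_ (∙𝟎 n a) (combination-standardBasis v)) (⊕-identityˡ v)) ⟩
      a ∷ v ∎
      where open ≡-Reasoning

-- Counting independent tuples and subspaces

module SubspaceCounts where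

  open import Defs
  open Counting
  open LinearAlgebra
  open import Data.Bool.Properties using (T-≡)
  open import Data.Empty using (⊥; ⊥-elim)
  open import Data.Fin.Base using (zero; suc)
  open import Data.Fin.Subset as Subset using (_⊆_)
  import Data.Fin.Subset.Properties as Subset
  open import Data.List using (List; length; filter)
  open import Data.List.Membership.Propositional using (_∈_)
  open import Data.List.Membership.Propositional.Properties using (∈-filter⁺; ∈-filter⁻)
  open import Data.List.Relation.Unary.Any using (here; there)
  open import Data.List.Relation.Unary.Unique.Propositional using (Unique)
  import Data.List.Relation.Unary.Unique.Propositional.Properties as Unique
  open import Data.Nat as ℕ using (ℕ; zero; suc)
  import Data.Nat.Properties as ℕ
  open import Data.Product using (∃-syntax; _×_; _,_; proj₁; proj₂)
  open import Data.Vec as Vec using (Vec; []; _∷_; tabulate; head; tail)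
  import Data.Vec.Properties as Vec
  open import Data.Vec.Relation.Unary.All as All using (All; []; _∷_)
  open import Data.Sum using (inj₁; inj₂)
  open import Function using (_∘_; Equivalence)
  open import Relation.Binary.PropositionalEquality
  open import Relation.Nullary using (Dec; yes; no; ¬?)
  open import Relation.Nullary.Decidable using (_×-dec_; _→-dec_; map′; isYes; fromWitness; toWitness)
  open import Relation.Unary using (Decidable)

  open Finite {{...}}

  -- The number of linearly independent s-tuples in a space of dimension u, that is the product of
  -- q^u - q^i over i < s. For s > u the factor with i = u makes it zero.
  frames : ℕ → ℕ → ℕ → ℕ
  frames q u zero    = 1
  frames q u (suc s) = frames q u s ℕ.* (q ℕ.^ u ℕ.∸ q ℕ.^ s)

  module Subspaces {q : ℕ} (F : FiniteField q) (N k m : ℕ) where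
    open FiniteField F using (Carrier; finite-Carrier; 0#; 1#)
    open RandomForm F N k m
    open VectorSpace F

    _⊆ⱽ_ : SubsetOfV → SubsetOfV → Set
    H ⊆ⱽ U = ∀ v → v ∈ⱽ H → v ∈ⱽ U

    _⊆ⱽ?_ : ∀ H U → Dec (H ⊆ⱽ U)
    H ⊆ⱽ? U = all? λ v → v ∈ⱽ? H →-dec v ∈ⱽ? U

    -- Subsets are bit vectors indexed by the enumeration of `V`, so subspaces with the same vectors
    -- are propositionally equal. Every uniqueness argument in the counts of subspaces rests on
    -- this.
    ⊆ⱽ-antisym : ∀ {H U} → H ⊆ⱽ U → U ⊆ⱽ H → H ≡ U
    ⊆ⱽ-antisym {H} {U} H⊆U U⊆H = Subset.⊆-antisym (toFin H⊆U) (toFin U⊆H)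
      where
      toFin : ∀ {H U} → H ⊆ⱽ U → H ⊆ U
      toFin {H} {U} H⊆U {i} i∈H = subst (Subset._∈ U) (index-element {V} i)
        (H⊆U (element i) (subst (Subset._∈ H) (sym (index-element {V} i)) i∈H))

    Combination : ∀ {s} → Vec V s → V → Set
    Combination bs v = ∃[ as ] combination as bs ≡ v

    combination? : ∀ {s} (bs : Vec V s) → Decidable (Combination bs)
    combination? bs v = any? λ as → combination as bs ≟ v

    span : ∀ {s} → Vec V s → SubsetOfV
    span bs = tabulate λ i → isYes (combination? bs (element i))

    ∈-span⁺ : ∀ {s} (bs : Vec V s) {v} → Combination bs v → v ∈ⱽ span bs
    ∈-span⁺ bs {v} p = Vec.lookup⇒[]= (index v) (span bs)
      (trans (Vec.lookup∘tabulate _ (index v))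
        (Equivalence.to T-≡ (fromWitness {a? = combination? bs (element (index v))}
          (subst (Combination bs) (sym (element-index v)) p))))

    ∈-span⁻ : ∀ {s} (bs : Vec V s) {v} → v ∈ⱽ span bs → Combination bs v
    ∈-span⁻ bs {v} v∈ = subst (Combination bs) (element-index v)
      (toWitness {a? = combination? bs (element (index v))}
        (Equivalence.from T-≡ (trans (sym (Vec.lookup∘tabulate _ (index v))) (Vec.[]=⇒lookup v∈))))

    combination-∈ : ∀ {H} → IsSubspace H → ∀ {s} (as : Vec Carrier s) {bs} → All (_∈ⱽ H) bs → combination as bs ∈ⱽ H
    combination-∈ (𝟎∈ , ⊕∈ , ∙∈) []       []         = 𝟎∈
    combination-∈ sub@(𝟎∈ , ⊕∈ , ∙∈) (a ∷ as) (b∈ ∷ bs∈) = ⊕∈ _ _ (∙∈ a _ b∈) (combination-∈ sub as bs∈)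

    span-⊆ : ∀ {H} → IsSubspace H → ∀ {s} {bs : Vec V s} → All (_∈ⱽ H) bs → span bs ⊆ⱽ H
    span-⊆ sub {bs = bs} bs∈ v v∈ with ∈-span⁻ bs v∈
    ... | as , refl = combination-∈ sub as bs∈

    span-isSubspace : ∀ {s} (bs : Vec V s) → IsSubspace (span bs)
    span-isSubspace bs =
      ∈-span⁺ bs (𝟎 , Linear-𝟎 (combination-linear bs)) ,
      (λ x y x∈ y∈ → let as , eq = ∈-span⁻ bs x∈ ; as′ , eq′ = ∈-span⁻ bs y∈ in
        ∈-span⁺ bs (1# ∙ as ⊕ as′ , trans (combination-linear bs 1# as as′)
          (cong₂ _⊕_ (trans (1∙ _) eq) eq′))) ,
      (λ a x x∈ → let as , eq = ∈-span⁻ bs x∈ in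
        ∈-span⁺ bs (a ∙ as ⊕ 𝟎 , trans (combination-linear bs a as 𝟎)
          (trans (cong₂ _⊕_ (cong (a ∙_) eq) (Linear-𝟎 (combination-linear bs))) (⊕-identityʳ _))))

    span-generators : ∀ {s} (bs : Vec V s) → All (_∈ⱽ span bs) bs
    span-generators []       = []
    span-generators (b ∷ bs) =
      ∈-span⁺ (b ∷ bs) (1# ∷ 𝟎 , trans (cong₂ _⊕_ (1∙ b) (Linear-𝟎 (combination-linear bs))) (⊕-identityʳ b)) ∷
      All.map (λ {v} v∈ → let as , eq = ∈-span⁻ bs v∈ in
        ∈-span⁺ (b ∷ bs) (0# ∷ as , trans (cong₂ _⊕_ (0∙ b) eq) (⊕-identityˡ v))) (span-generators bs)

    span-isBasis : ∀ {s} {bs : Vec V s} → Independent bs → IsBasis (span bs) bs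
    span-isBasis {bs = bs} independent = span-generators bs , independent , λ v → ∈-span⁻ bs

    basis⇒≡span : ∀ {s} {bs : Vec V s} {H} → IsSubspace H → IsBasis H bs → H ≡ span bs
    basis⇒≡span {bs = bs} sub (bs∈ , independent , spans) =
      ⊆ⱽ-antisym (λ v v∈ → ∈-span⁺ bs (spans v v∈)) (span-⊆ sub bs∈)

    independent? : ∀ {s} → Decidable (Independent {N} {s})
    independent? bs = all? λ as → combination as bs ≟ 𝟎 →-dec as ≟ 𝟎

    isBasis? : ∀ {s} H → Decidable (IsBasis {s} H)
    isBasis? H bs =
      All.all? (_∈ⱽ? H) bs ×-dec independent? bs ×-dec (all? λ v → v ∈ⱽ? H →-dec combination? bs v)

    members : SubsetOfV → List V
    members H = filter (_∈ⱽ? H) elements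

    members-unique : ∀ H → Unique (members H)
    members-unique H = Unique.filter⁺ (_∈ⱽ? H) elements-unique

    ∈-members : ∀ {H v} → v ∈ⱽ H → v ∈ members H
    ∈-members {H} v∈ = ∈-filter⁺ (_∈ⱽ? H) (∈-elements _) v∈

    length-members : ∀ {s} {bs : Vec V s} {H} → IsSubspace H → IsBasis H bs → length (members H) ≡ q ℕ.^ s
    length-members {s} {bs} {H} sub (bs∈ , independent , spans) = trans
      (length-bijection (members-unique H) elements-unique coordinates (λ as → combination as bs)
        (λ {v} _ → ∈-elements (coordinates v)) (λ {as} _ → ∈-members {H} (combination-∈ sub as bs∈))
        (λ v∈ → combination-coordinates (proj₂ (∈-filter⁻ (_∈ⱽ? H) {xs = elements} v∈)))
        (λ {as} _ → combination-injective independent (combination-coordinates (combination-∈ sub as bs∈))))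
      (trans (length-elements {Vec Carrier s}) (card-Vec Carrier s))
      where
      coordinates : V → Vec Carrier s
      coordinates v with combination? bs v
      ... | yes (as , _) = as
      -- A default outside `H`; `combination-coordinates` concerns vectors of `H`, where the other
      -- branch is taken.
      ... | no  _        = 𝟎
      combination-coordinates : ∀ {v} → v ∈ⱽ H → combination (coordinates v) bs ≡ v
      combination-coordinates {v} v∈ with combination? bs v
      ... | yes (as , eq) = eq
      ... | no  v∉        = ⊥-elim (v∉ (spans v v∈))

    independentIn? : ∀ U {s} → Decidable (λ (bs : Vec V s) → All (_∈ⱽ U) bs × Independent bs)
    independentIn? U bs = All.all? (_∈ⱽ? U) bs ×-dec independent? bs

    independents : SubsetOfV → (s : ℕ) → List (Vec V s)
    independents U s = filter (independentIn? U) elements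

    ∈-independents : ∀ {U s} {bs : Vec V s} → All (_∈ⱽ U) bs → Independent bs → bs ∈ independents U s
    ∈-independents {U} bs∈ independent = ∈-filter⁺ (independentIn? U) (∈-elements _) (bs∈ , independent)

    independents-∈ : ∀ {U s} {bs : Vec V s} → bs ∈ independents U s → All (_∈ⱽ U) bs × Independent bs
    independents-∈ {U} bs∈ = proj₂ (∈-filter⁻ (independentIn? U) {xs = elements} bs∈)

    independents-unique : ∀ U s → Unique (independents U s)
    independents-unique U s = Unique.filter⁺ (independentIn? U) elements-unique

    -- Induction on the length by the fibres of `tail`: above an independent tuple `bs` the possible
    -- heads are the q^u vectors of `U` without the q^s vectors of the span of `bs`.
    length-independents : ∀ {U u} → IsSubspace U → HasDimension U u → ∀ s →
      length (independents U s) ≡ frames q u s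
    length-independents {U} sub dim zero = length-singleton (independents-unique U zero) {[]}
      (∈-independents {U} [] (λ { [] _ → refl })) (λ { {[]} _ → refl })
    length-independents {U} {u} sub dim@(us , us-basis) (suc s) = begin
      length (independents U (suc s)) ≡⟨ ℕ.*-identityʳ _ ⟨
      length (independents U (suc s)) ℕ.* 1 ≡⟨ doubleCount (λ bs cs → tail bs ≟ cs) rows columns ⟩
      length (independents U s) ℕ.* (q ℕ.^ u ℕ.∸ q ℕ.^ s)
        ≡⟨ cong (ℕ._* (q ℕ.^ u ℕ.∸ q ℕ.^ s)) (length-independents sub dim s) ⟩
      frames q u s ℕ.* (q ℕ.^ u ℕ.∸ q ℕ.^ s) ∎
      where
      open ≡-Reasoning
      rows : ∀ {bs} → bs ∈ independents U (suc s) → length (filter (λ cs → tail bs ≟ cs) (independents U s)) ≡ 1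
      rows {b ∷ bs} b∷bs∈ with independents-∈ {U} b∷bs∈
      ... | _ ∷ bs∈ , independent = filter-unique (bs ≟_) (independents-unique U s)
        (∈-independents {U} bs∈ (independent-tail independent)) refl (λ _ → sym)
      columns : ∀ {bs} → bs ∈ independents U s →
        length (filter (λ bs′ → tail bs′ ≟ bs) (independents U (suc s))) ≡ q ℕ.^ u ℕ.∸ q ℕ.^ s
      columns {bs} bs∈ with independents-∈ {U} bs∈
      ... | bs⊆U , independent = begin
        length (filter (λ bs′ → tail bs′ ≟ bs) (independents U (suc s)))
          ≡⟨ length-bijection (Unique.filter⁺ (λ bs′ → tail bs′ ≟ bs) (independents-unique U (suc s)))
               (Unique.filter⁺ (¬? ∘ combination? bs) (members-unique U)) head (_∷ bs)
               (λ bs′∈ → head∈ (∈-filter⁻ (λ bs′ → tail bs′ ≟ bs) bs′∈)) ∷∈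
               (λ bs′∈ → head∷ (proj₂ (∈-filter⁻ (λ bs′ → tail bs′ ≟ bs) {xs = independents U (suc s)} bs′∈)))
               (λ _ → refl) ⟩
        length (filter (¬? ∘ combination? bs) (members U))
          ≡⟨ ℕ.m+n∸m≡n (length (filter (combination? bs) (members U))) _ ⟨
        length (filter (combination? bs) (members U)) ℕ.+ length (filter (¬? ∘ combination? bs) (members U))
          ℕ.∸ length (filter (combination? bs) (members U))
          ≡⟨ cong₂ ℕ._∸_ (length-filter-split (combination? bs) (members U))
               (length-cong (Unique.filter⁺ (combination? bs) (members-unique U)) (members-unique (span bs))
                 (λ v∈ → ∈-members {span bs} (∈-span⁺ bs (proj₂ (∈-filter⁻ (combination? bs) {xs = members U} v∈))))
                 (λ v∈ → let v∈span = proj₂ (∈-filter⁻ (_∈ⱽ? span bs) {xs = elements} v∈) in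
                   ∈-filter⁺ (combination? bs) (∈-members {U} (span-⊆ sub bs⊆U _ v∈span)) (∈-span⁻ bs v∈span))) ⟩
        length (members U) ℕ.∸ length (members (span bs))
          ≡⟨ cong₂ ℕ._∸_ (length-members sub us-basis)
               (length-members (span-isSubspace bs) (span-isBasis independent)) ⟩
        q ℕ.^ u ℕ.∸ q ℕ.^ s ∎
        where
        head∷ : ∀ {bs′ : Vec V (suc s)} → tail bs′ ≡ bs → head bs′ ∷ bs ≡ bs′
        head∷ {_ ∷ _} refl = refl
        head∈ : ∀ {bs′} → bs′ ∈ independents U (suc s) × tail bs′ ≡ bs → head bs′ ∈ filter (¬? ∘ combination? bs) (members U)
        head∈ {b ∷ _} (bs′∈ , refl) with independents-∈ {U} bs′∈
        ... | b∈ ∷ _ , independent′ = ∈-filter⁺ (¬? ∘ combination? bs) (∈-members {U} b∈) (independent-head independent′)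
        ∷∈ : ∀ {b} → b ∈ filter (¬? ∘ combination? bs) (members U) → b ∷ bs ∈ filter (λ bs′ → tail bs′ ≟ bs) (independents U (suc s))
        ∷∈ b∈ with ∈-filter⁻ (¬? ∘ combination? bs) {xs = members U} b∈
        ... | b∈U , b∉ = ∈-filter⁺ (λ bs′ → tail bs′ ≟ bs)
          (∈-independents {U} (proj₂ (∈-filter⁻ (_∈ⱽ? U) {xs = elements} b∈U) ∷ bs⊆U) (extend-independent independent b∉)) refl

    frames-overflow : ∀ u → frames q u (suc u) ≡ 0
    frames-overflow u = trans (cong (frames q u u ℕ.*_) (ℕ.n∸n≡0 (q ℕ.^ u))) (ℕ.*-zeroʳ (frames q u u))

    -- Takes the place of the exchange lemma: the number of independent tuples of length u + 1
    -- contains the factor q^u - q^u.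
    no-long-independent : ∀ {U u} → IsSubspace U → HasDimension U u →
      (bs : Vec V (suc u)) → All (_∈ⱽ U) bs → Independent bs → ⊥
    no-long-independent {U} {u} sub dim bs bs∈ independent = empty (∈-independents {U} bs∈ independent)
      (trans (length-independents sub dim (suc u)) (frames-overflow u))
      where
      empty : ∀ {A : Set} {x : A} {xs} → x ∈ xs → length xs ≢ 0
      empty (here _) ()
      empty (there _) ()

    -- A vector outside the span would prolong the tuple to u + 1 independent vectors.
    independent⇒basis : ∀ {U u} → IsSubspace U → HasDimension U u →
      (bs : Vec V u) → All (_∈ⱽ U) bs → Independent bs → IsBasis U bs
    independent⇒basis {U} sub dim bs bs∈ independent = bs∈ , independent , spans
      where
      spans : ∀ v → v ∈ⱽ U → Combination bs v
      spans v v∈ with combination? bs v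
      ... | yes p  = p
      ... | no  v∉ = ⊥-elim (no-long-independent sub dim (v ∷ bs) (v∈ ∷ bs∈) (extend-independent independent v∉))

    equal-dimension⇒≡ : ∀ {H U s} → IsSubspace H → IsSubspace U → HasDimension H s → HasDimension U s → H ⊆ⱽ U → H ≡ U
    equal-dimension⇒≡ {H} {U} subH subU (bs , bs∈ , independent , spans) dimU H⊆U = trans
      (basis⇒≡span subH (bs∈ , independent , spans))
      (sym (basis⇒≡span subU (independent⇒basis subU dimU bs (All.map (λ {v} → H⊆U v) bs∈) independent)))

    Subspace : ℕ → SubsetOfV → Set
    Subspace s H = IsSubspace H × HasDimension H s

    -- Every subspace is null for the zero form, so the decision procedure for null subspaces can be
    -- reused.
    subspace? : ∀ s → Decidable (Subspace s)
    subspace? s H = map′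
      (λ (sub , dim , _) → sub , dim)
      (λ (sub , dim) → sub , dim , λ hs _ → Vec.lookup-replicate (index hs) 𝟎)
      (nullSubspace? zeroForm s H)

    subspaces : ℕ → List SubsetOfV
    subspaces s = filter (subspace? s) elements

    ∈-subspaces : ∀ {s H} → Subspace s H → H ∈ subspaces s
    ∈-subspaces {s} = ∈-filter⁺ (subspace? s) (∈-elements _)

    subspaces-∈ : ∀ {s H} → H ∈ subspaces s → Subspace s H
    subspaces-∈ {s} H∈ = proj₂ (∈-filter⁻ (subspace? s) {xs = elements} H∈)

    subspaces-unique : ∀ s → Unique (subspaces s)
    subspaces-unique s = Unique.filter⁺ (subspace? s) elements-unique

    -- Pairs of a subspace of `U` and a basis of it: an independent tuple is a basis of its span
    -- alone, and an s-space has `frames q s s` bases. The Gaussian binomial coefficient is thus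
    -- kept as a product without division. With `U` the full space it serves the first moment, with
    -- `U` of dimension r + 1 it counts hyperplanes.
    length-subspacesIn : ∀ {U u} → Subspace u U → ∀ s →
      length (filter (_⊆ⱽ? U) (subspaces s)) ℕ.* frames q s s ≡ frames q u s
    length-subspacesIn {U} {u} (subU , dimU) s = begin
      length (filter (_⊆ⱽ? U) (subspaces s)) ℕ.* frames q s s
        ≡⟨ doubleCount (λ H bs → isBasis? H bs) columns rows ⟩
      length (independents U s) ℕ.* 1 ≡⟨ ℕ.*-identityʳ _ ⟩
      length (independents U s) ≡⟨ length-independents subU dimU s ⟩
      frames q u s ∎
      where
      open ≡-Reasoning
      columns : ∀ {H} → H ∈ filter (_⊆ⱽ? U) (subspaces s) → length (filter (isBasis? H) (independents U s)) ≡ frames q s s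
      columns {H} H∈ with ∈-filter⁻ (_⊆ⱽ? U) {xs = subspaces s} H∈
      ... | H∈′ , H⊆U with subspaces-∈ H∈′
      ...   | subH , dimH = trans
        (length-cong (Unique.filter⁺ (isBasis? H) (independents-unique U s)) (independents-unique H s)
          (λ bs∈ → let bs∈H , independent , _ = proj₂ (∈-filter⁻ (isBasis? H) {xs = independents U s} bs∈) in
            ∈-independents {H} bs∈H independent)
          (λ bs∈ → let bs∈H , independent = independents-∈ {H} bs∈ in
            ∈-filter⁺ (isBasis? H) (∈-independents {U} (All.map (λ {v} → H⊆U v) bs∈H) independent)
              (independent⇒basis subH dimH _ bs∈H independent)))
        (length-independents subH dimH s)
      rows : ∀ {bs} → bs ∈ independents U s → length (filter (λ H → isBasis? H bs) (filter (_⊆ⱽ? U) (subspaces s))) ≡ 1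
      rows {bs} bs∈ with independents-∈ {U} bs∈
      ... | bs∈U , independent = filter-unique (λ H → isBasis? H bs) (Unique.filter⁺ (_⊆ⱽ? U) (subspaces-unique s))
        (∈-filter⁺ (_⊆ⱽ? U) (∈-subspaces (span-isSubspace bs , bs , span-isBasis independent)) (span-⊆ subU bs∈U))
        (span-isBasis independent)
        (λ {H} H∈ basis → basis⇒≡span (proj₁ (subspaces-∈ (proj₁ (∈-filter⁻ (_⊆ⱽ? U) {xs = subspaces s} H∈)))) basis)

    full : Subspace N Subset.⊤
    full = (Subset.∈⊤ , (λ _ _ _ _ → Subset.∈⊤) , (λ _ _ _ → Subset.∈⊤)) ,
      standardBasis N , all∈⊤ (standardBasis N) ,
      (λ as eq → trans (sym (combination-standardBasis as)) eq) , λ v _ → v , combination-standardBasis v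
      where
      all∈⊤ : ∀ {s} (bs : Vec V s) → All (_∈ⱽ Subset.⊤) bs
      all∈⊤ = All.universal (λ _ → Subset.∈⊤)

    length-subspaces : ∀ s → length (subspaces s) ℕ.* frames q s s ≡ frames q N s
    length-subspaces s = trans
      (cong (ℕ._* frames q s s) (length-cong (subspaces-unique s) (Unique.filter⁺ (_⊆ⱽ? Subset.⊤) (subspaces-unique s))
        (λ H∈ → ∈-filter⁺ (_⊆ⱽ? Subset.⊤) H∈ (λ _ _ → Subset.∈⊤))
        (λ H∈ → proj₁ (∈-filter⁻ (_⊆ⱽ? Subset.⊤) {xs = subspaces s} H∈))))
      (length-subspacesIn full s)

    -- A vector `v` of `H′` outside `H`, together with a basis of `H`, is independent of length r +
    -- 1. It is therefore a basis of every (r+1)-space that contains `H` and `H′`. If there is no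
    -- such `v`, then `H′` lies in `H` and equality of dimensions contradicts `H ≢ H′`.
    hyperplanes-span : ∀ {r H H′ U U′} → Subspace r H → Subspace r H′ → Subspace (suc r) U → Subspace (suc r) U′ →
      H ≢ H′ → H ⊆ⱽ U → H′ ⊆ⱽ U → H ⊆ⱽ U′ → H′ ⊆ⱽ U′ → U ≡ U′
    hyperplanes-span {r} {H} {H′} (subH , bs , basis@(bs∈ , independent , spans)) (subH′ , dimH′) (subU , dimU) (subU′ , dimU′)
      H≢H′ H⊆U H′⊆U H⊆U′ H′⊆U′ with any? (λ v → v ∈ⱽ? H′ ×-dec ¬? (v ∈ⱽ? H))
    ... | yes (v , v∈ , v∉) = trans (≡span subU dimU H⊆U H′⊆U) (sym (≡span subU′ dimU′ H⊆U′ H′⊆U′))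
      where
      ≡span : ∀ {U} → IsSubspace U → HasDimension U (suc r) → H ⊆ⱽ U → H′ ⊆ⱽ U → U ≡ span (v ∷ bs)
      ≡span sub dim H⊆ H′⊆ = basis⇒≡span sub (independent⇒basis sub dim (v ∷ bs)
        (H′⊆ v v∈ ∷ All.map (λ {w} → H⊆ w) bs∈)
        (extend-independent independent (λ { (as , refl) → v∉ (combination-∈ subH as bs∈) })))
    ... | no  none = ⊥-elim (H≢H′ (sym (equal-dimension⇒≡ subH′ subH dimH′ (bs , basis) H′⊆H)))
      where
      H′⊆H : H′ ⊆ⱽ H
      H′⊆H v v∈ with v ∈ⱽ? H
      ... | yes v∈H = v∈H
      ... | no  v∉H = ⊥-elim (none (v , v∈ , v∉H))

    -- The tuple is completed to a basis of `V`, whose coordinate map is linear by uniqueness of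
    -- coordinates; the coordinates of the added vectors are then dropped, one `tail` for each.
    linear-retraction : ∀ {s} {bs : Vec V s} → Independent bs →
      ∃[ φ ] Linear φ × (∀ as → φ (combination as bs) ≡ as)
    linear-retraction {s} {bs} = extend (suc N) (ℕ.m≤m+n (suc N) s)
      where
      -- `d` is fuel for the vectors still to be added. It starts at N + 1, so that running out of
      -- it would leave more than N independent vectors.
      extend : ∀ d {s} {bs : Vec V s} → suc N ℕ.≤ d ℕ.+ s → Independent bs →
        ∃[ φ ] Linear φ × (∀ as → φ (combination as bs) ≡ as)
      extend zero {suc s} {bs} (ℕ.s≤s N≤s) independent = ⊥-elim (shorten N≤s bs independent)
        where
        shorten : ∀ {s} → N ℕ.≤ s → (bs : Vec V (suc s)) → Independent bs → ⊥
        shorten {s} N≤s bs independent with ℕ.m≤n⇒m<n∨m≡n N≤s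
        ... | inj₂ refl = no-long-independent (proj₁ full) (proj₂ full) bs (All.universal (λ _ → Subset.∈⊤) bs) independent
        shorten {suc s} N≤s (b ∷ bs) independent | inj₁ (ℕ.s≤s N≤s′) = shorten N≤s′ bs (independent-tail independent)
      extend (suc d) {s} {bs} le independent with any? (¬? ∘ combination? bs)
      ... | yes (v , v∉) with extend d {bs = v ∷ bs} (subst (suc N ℕ.≤_) (sym (ℕ.+-suc d s)) le) (extend-independent independent v∉)
      ...   | φ , linear , section = tail ∘ φ ,
        (λ a x y → trans (cong tail (linear a x y)) (tail-linear a (φ x) (φ y))) ,
        (λ as → cong tail (trans (cong φ (sym (trans (cong (_⊕ combination as bs) (0∙ v)) (⊕-identityˡ _)))) (section (0# ∷ as))))
        where
        tail-linear : Linear (tail {n = s})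
        tail-linear a (_ ∷ _) (_ ∷ _) = refl
      extend (suc d) {s} {bs} le independent | no none = (proj₁ ∘ spans) ,
        (λ a x y → combination-injective independent (trans (proj₂ (spans (a ∙ x ⊕ y)))
          (sym (trans (combination-linear bs a (proj₁ (spans x)) (proj₁ (spans y))) (cong₂ _⊕_ (cong (a ∙_) (proj₂ (spans x))) (proj₂ (spans y))))))) ,
        (λ as → combination-injective independent (proj₂ (spans (combination as bs))))
        where
        spans : ∀ v → Combination bs v
        spans v with combination? bs v
        ... | yes p  = p
        ... | no  v∉ = ⊥-elim (none (v , v∉))

-- Coordinates of alternating forms

module AlternatingMaps where

  open import Defs
  open LinearAlgebra
  open import Data.Empty using (⊥-elim)
  open import Data.Fin.Base using (zero; suc)
  open import Data.Nat as ℕ using (ℕ; zero; suc)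
  import Data.Nat.Properties as ℕ
  open import Data.Nat.Combinatorics using (_C_; nCk+nC[k+1]≡[n+1]C[k+1]; k>n⇒nCk≡0)
  open import Data.Product using (_×_; _,_; proj₁; proj₂)
  open import Data.Unit using (⊤; tt)
  open import Data.Vec as Vec using (Vec; []; _∷_; _++_; map; take; drop; head; tail; lookup; _[_]≔_)
  import Data.Vec.Properties as Vec
  open import Function using (_∘_)
  open import Relation.Binary.PropositionalEquality

  -- The rank of the k-th exterior power, with the two summands in the order in which `build` and
  -- `read` split coefficient vectors: first the coefficients that avoid e₀, then those that involve
  -- it.
  dim : ℕ → ℕ → ℕ
  dim n       zero    = 1
  dim zero    (suc k) = 0
  dim (suc n) (suc k) = dim n (suc k) ℕ.+ dim n k

  dim≡C : ∀ n k → dim n k ≡ n C k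
  dim≡C n       zero    = refl
  dim≡C zero    (suc k) = sym (k>n⇒nCk≡0 {0} {suc k} (ℕ.s≤s ℕ.z≤n))
  dim≡C (suc n) (suc k) = begin
    dim n (suc k) ℕ.+ dim n k ≡⟨ ℕ.+-comm (dim n (suc k)) (dim n k) ⟩
    dim n k ℕ.+ dim n (suc k) ≡⟨ cong₂ ℕ._+_ (dim≡C n k) (dim≡C n (suc k)) ⟩
    n C k ℕ.+ n C suc k ≡⟨ nCk+nC[k+1]≡[n+1]C[k+1] n k ⟩
    suc n C suc k ∎
    where open ≡-Reasoning

  module AlternatingForms {q : ℕ} (F : FiniteField q) (m : ℕ) where
    open FiniteField F using (Carrier; _+_; _*_; -_; 0#; 1#; +-identityʳ; zeroʳ; *-comm)
    open Coordinates F
    open VectorSpace F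

    private
      W : Set
      W = Space m

    HeadAlternates : ∀ {n} k → (Vec (Space n) (suc k) → W) → Set
    HeadAlternates zero    g = ⊤
    HeadAlternates (suc k) g = ∀ v vs → g (v ∷ v ∷ vs) ≡ 𝟎

    -- Only neighbouring arguments are compared; antisymmetry then handles the
    -- other pairs (see alternatesAt).
    Alternates : ∀ {n} k → (Vec (Space n) k → W) → Set
    Alternates zero    g = ⊤
    Alternates (suc k) g =
      (∀ v → Alternates k (g ∘ (v ∷_))) × (∀ vs → Linear (λ v → g (v ∷ vs))) × HeadAlternates k g

    alternates-cong : ∀ {n} k {g h : Vec (Space n) k → W} → (∀ vs → g vs ≡ h vs) → Alternates k g → Alternates k h
    alternates-cong zero    eq _ = tt
    alternates-cong (suc k) eq (slices , linear , alt) =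
      (λ v → alternates-cong k (λ vs → eq (v ∷ vs)) (slices v)) ,
      (λ vs a x y → trans (sym (eq _)) (trans (linear vs a x y) (cong₂ _⊕_ (cong (a ∙_) (eq _)) (eq _)))) ,
      head-cong k eq alt
      where
      head-cong : ∀ {n} k {g h : Vec (Space n) (suc k) → W} → (∀ vs → g vs ≡ h vs) → HeadAlternates k g → HeadAlternates k h
      head-cong zero    eq _   = tt
      head-cong (suc k) eq alt = λ v vs → trans (sym (eq _)) (alt v vs)

    combine-linear : ∀ {n} (φ ψ : Space n → W) a b → Linear φ → Linear ψ → Linear (λ v → a ∙ φ v ⊕ b ∙ ψ v)
    combine-linear φ ψ a b lφ lψ c x y = begin
      a ∙ φ (c ∙ x ⊕ y) ⊕ b ∙ ψ (c ∙ x ⊕ y)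
        ≡⟨ cong₂ _⊕_ (distribute a (lφ c x y)) (distribute b (lψ c x y)) ⟩
      (c ∙ a ∙ φ x ⊕ a ∙ φ y) ⊕ (c ∙ b ∙ ψ x ⊕ b ∙ ψ y)
        ≡⟨ ⊕-interchange _ _ _ _ ⟩
      (c ∙ a ∙ φ x ⊕ c ∙ b ∙ ψ x) ⊕ (a ∙ φ y ⊕ b ∙ ψ y)
        ≡⟨ cong (_⊕ (a ∙ φ y ⊕ b ∙ ψ y)) (∙-distribˡ c (a ∙ φ x) (b ∙ ψ x)) ⟨
      c ∙ (a ∙ φ x ⊕ b ∙ ψ x) ⊕ (a ∙ φ y ⊕ b ∙ ψ y) ∎
      where
      open ≡-Reasoning
      distribute : ∀ a {u v w} → u ≡ c ∙ v ⊕ w → a ∙ u ≡ c ∙ a ∙ v ⊕ a ∙ w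
      distribute a {v = v} {w} refl = trans (∙-distribˡ a (c ∙ v) w) (cong (_⊕ a ∙ w) (∙-comm a c v))

    𝟎⊕𝟎 : ∀ {n} {x y : Space n} → x ≡ 𝟎 → y ≡ 𝟎 → x ⊕ y ≡ 𝟎
    𝟎⊕𝟎 refl refl = ⊕-identityˡ 𝟎

    ∙≡𝟎 : ∀ {n} a {x : Space n} → x ≡ 𝟎 → a ∙ x ≡ 𝟎
    ∙≡𝟎 {n} a refl = ∙𝟎 n a

    alternates-combine : ∀ {n} k {g h : Vec (Space n) k → W} a b → Alternates k g → Alternates k h →
      Alternates k (λ vs → a ∙ g vs ⊕ b ∙ h vs)
    alternates-combine zero    a b _ _ = tt
    alternates-combine (suc k) {g} {h} a b (slices , linear , alt) (slices′ , linear′ , alt′) =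
      (λ v → alternates-combine k a b (slices v) (slices′ v)) ,
      (λ vs → combine-linear (λ v → g (v ∷ vs)) (λ v → h (v ∷ vs)) a b (linear vs) (linear′ vs)) ,
      head-combine k alt alt′
      where
      head-combine : ∀ {n} k {g h : Vec (Space n) (suc k) → W} → HeadAlternates k g → HeadAlternates k h →
        HeadAlternates k (λ vs → a ∙ g vs ⊕ b ∙ h vs)
      head-combine zero    _ _      = tt
      head-combine (suc k) alt alt′ = λ v vs → 𝟎⊕𝟎 (∙≡𝟎 a (alt v vs)) (∙≡𝟎 b (alt′ v vs))

    alternates-pullback : ∀ {n l} k {g : Vec (Space l) k → W} {φ : Space n → Space l} → Linear φ →
      Alternates k g → Alternates k (g ∘ map φ)
    alternates-pullback zero    lφ _ = tt
    alternates-pullback (suc k) {g} {φ} lφ (slices , linear , alt) =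
      (λ v → alternates-pullback k lφ (slices (φ v))) ,
      (λ vs a x y → trans (cong (λ u → g (u ∷ map φ vs)) (lφ a x y)) (linear (map φ vs) a (φ x) (φ y))) ,
      head-pullback k alt
      where
      head-pullback : ∀ k {g : Vec (Space _) (suc k) → W} → HeadAlternates k g → HeadAlternates k (g ∘ map φ)
      head-pullback zero    _   = tt
      head-pullback (suc k) alt = λ v vs → alt (φ v) (map φ vs)

    module _ {n l : ℕ} {φ : Space n → Space l} (linear : Linear φ) where

      Linear-⊕ : ∀ x y → φ (x ⊕ y) ≡ φ x ⊕ φ y
      Linear-⊕ x y = trans (cong (λ u → φ (u ⊕ y)) (sym (1∙ x))) (trans (linear 1# x y) (cong (_⊕ φ y) (1∙ (φ x))))

      Linear-∙ : ∀ a x → φ (a ∙ x) ≡ a ∙ φ x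
      Linear-∙ a x = trans (cong φ (sym (⊕-identityʳ (a ∙ x))))
        (trans (linear a x 𝟎) (trans (cong (a ∙ φ x ⊕_) (Linear-𝟎 linear)) (⊕-identityʳ (a ∙ φ x))))

    -- Polarisation: expand the vanishing value at v + w, v + w, where the two diagonal terms vanish
    -- as well.
    antisymmetric : ∀ {n} k {g : Vec (Space n) (suc (suc k)) → W} → Alternates (suc (suc k)) g →
      ∀ v w vs → g (v ∷ w ∷ vs) ≡ ⊖ g (w ∷ v ∷ vs)
    antisymmetric k {g} (slices , linear , alt) v w vs = ⊕-zero⇒≡⊖ _ _ (begin
      g (v ∷ w ∷ vs) ⊕ g (w ∷ v ∷ vs)
        ≡⟨ cong₂ _⊕_ (sym (trans (cong (_⊕ g (v ∷ w ∷ vs)) (alt v vs)) (⊕-identityˡ _)))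
             (sym (trans (cong (g (w ∷ v ∷ vs) ⊕_) (alt w vs)) (⊕-identityʳ _))) ⟩
      (g (v ∷ v ∷ vs) ⊕ g (v ∷ w ∷ vs)) ⊕ (g (w ∷ v ∷ vs) ⊕ g (w ∷ w ∷ vs))
        ≡⟨ cong₂ _⊕_ (second v) (second w) ⟨
      g (v ∷ (v ⊕ w) ∷ vs) ⊕ g (w ∷ (v ⊕ w) ∷ vs)
        ≡⟨ Linear-⊕ (linear ((v ⊕ w) ∷ vs)) v w ⟨
      g ((v ⊕ w) ∷ (v ⊕ w) ∷ vs)
        ≡⟨ alt (v ⊕ w) vs ⟩
      𝟎 ∎)
      where
      open ≡-Reasoning
      second : ∀ u → g (u ∷ (v ⊕ w) ∷ vs) ≡ g (u ∷ v ∷ vs) ⊕ g (u ∷ w ∷ vs)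
      second u = Linear-⊕ (proj₁ (proj₂ (slices u)) vs) v w

    linearAt : ∀ {n} k {g : Vec (Space n) k → W} → Alternates k g → ∀ vs i → Linear (λ v → g (vs [ i ]≔ v))
    linearAt (suc k) (slices , linear , _) (v ∷ vs) zero    = linear vs
    linearAt (suc k) (slices , linear , _) (v ∷ vs) (suc i) = linearAt k (slices v) vs i

    alternatesAt : ∀ {n} k {g : Vec (Space n) k → W} → Alternates k g → ∀ vs i j →
      i ≢ j → lookup vs i ≡ lookup vs j → g vs ≡ 𝟎
    alternatesAt (suc k) {g} alt (v ∷ vs) i j i≢j eq = cases i j i≢j eq
      where
      -- The head is exchanged with its right neighbour, at the cost of a sign, until it stands next
      -- to its equal.
      headAt : ∀ {n} k {g : Vec (Space n) (suc k) → W} → Alternates (suc k) g → ∀ v vs j → v ≡ lookup vs j → g (v ∷ vs) ≡ 𝟎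
      headAt (suc k) (_ , _ , alt) v (_ ∷ vs) zero refl = alt v vs
      headAt (suc k) {g} alt@(slices , _) v (w ∷ vs) (suc j) eq =
        trans (antisymmetric k {g} alt v w vs) (∙≡𝟎 (- 1#) (headAt k (slices w) v vs j eq))
      cases : ∀ i j → i ≢ j → lookup (v ∷ vs) i ≡ lookup (v ∷ vs) j → g (v ∷ vs) ≡ 𝟎
      cases zero    zero    i≢j eq = ⊥-elim (i≢j refl)
      cases zero    (suc j) i≢j eq = headAt k alt v vs j eq
      cases (suc i) zero    i≢j eq = headAt k alt v vs i (sym eq)
      cases (suc i) (suc j) i≢j eq = alternatesAt k (proj₁ alt v) vs i j (i≢j ∘ cong suc) eq

    alternates⁺ : ∀ {n} k {g : Vec (Space n) k → W} →
      (∀ vs i x y → g (vs [ i ]≔ (x ⊕ y)) ≡ g (vs [ i ]≔ x) ⊕ g (vs [ i ]≔ y)) →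
      (∀ vs i a x → g (vs [ i ]≔ (a ∙ x)) ≡ a ∙ g (vs [ i ]≔ x)) →
      (∀ vs i j → i ≢ j → lookup vs i ≡ lookup vs j → g vs ≡ 𝟎) → Alternates k g
    alternates⁺ zero    additive homogeneous alternating = tt
    alternates⁺ (suc k) {g} additive homogeneous alternating =
      (λ v → alternates⁺ k (λ vs i → additive (v ∷ vs) (suc i)) (λ vs i → homogeneous (v ∷ vs) (suc i))
        (λ vs i j i≢j → alternating (v ∷ vs) (suc i) (suc j) (λ { refl → i≢j refl }))) ,
      -- The head `𝟎` is a placeholder that the update at position `zero` overwrites.
      (λ vs a x y → trans (additive (𝟎 ∷ vs) zero (a ∙ x) y) (cong (_⊕ g (y ∷ vs)) (homogeneous (𝟎 ∷ vs) zero a x))) ,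
      head⁺ k alternating
      where
      head⁺ : ∀ k {g : Vec (Space _) (suc k) → W} →
        (∀ vs i j → i ≢ j → lookup vs i ≡ lookup vs j → g vs ≡ 𝟎) → HeadAlternates k g
      head⁺ zero    _           = tt
      head⁺ (suc k) alternating = λ v vs → alternating (v ∷ v ∷ vs) zero (suc zero) (λ ()) refl

    -- The exterior product f ∧ β, by expansion along the first argument.
    wedge : ∀ {n} → (Space n → Carrier) → ∀ k → (Vec (Space n) k → W) → Vec (Space n) (suc k) → W
    wedge f zero    β (v ∷ []) = f v ∙ β []
    wedge f (suc k) β (v ∷ vs) = f v ∙ β vs ⊕ ⊖ wedge f k (β ∘ (v ∷_)) vs

    module _ {n : ℕ} (f : Space n → Carrier) where

      wedge-cong : ∀ k {β γ} → (∀ vs → β vs ≡ γ vs) → ∀ vs → wedge f k β vs ≡ wedge f k γ vs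
      wedge-cong zero    eq (v ∷ []) = cong (f v ∙_) (eq [])
      wedge-cong (suc k) eq (v ∷ vs) =
        cong₂ _⊕_ (cong (f v ∙_) (eq vs)) (cong ⊖_ (wedge-cong k (λ us → eq (v ∷ us)) vs))

      wedge-𝟎 : ∀ k {β} → (∀ vs → β vs ≡ 𝟎) → ∀ vs → wedge f k β vs ≡ 𝟎
      wedge-𝟎 zero    eq (v ∷ []) = ∙≡𝟎 (f v) (eq [])
      wedge-𝟎 (suc k) eq (v ∷ vs) =
        𝟎⊕𝟎 (∙≡𝟎 (f v) (eq vs)) (∙≡𝟎 (- 1#) (wedge-𝟎 k (λ us → eq (v ∷ us)) vs))

      wedge-combine : ∀ k β γ a vs →
        wedge f k (λ us → a ∙ β us ⊕ γ us) vs ≡ a ∙ wedge f k β vs ⊕ wedge f k γ vs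
      wedge-combine zero    β γ a (v ∷ []) =
        trans (∙-distribˡ (f v) _ _) (cong (_⊕ f v ∙ γ []) (∙-comm (f v) a (β [])))
      wedge-combine (suc k) β γ a (v ∷ vs) = begin
        f v ∙ (a ∙ β vs ⊕ γ vs) ⊕ ⊖ wedge f k (λ us → a ∙ β (v ∷ us) ⊕ γ (v ∷ us)) vs
          ≡⟨ cong₂ _⊕_ (spread (f v) (β vs) (γ vs))
               (trans (cong ⊖_ (wedge-combine k (β ∘ (v ∷_)) (γ ∘ (v ∷_)) a vs)) (spread (- 1#) _ _)) ⟩
        (a ∙ f v ∙ β vs ⊕ f v ∙ γ vs) ⊕ (a ∙ ⊖ wedge f k (β ∘ (v ∷_)) vs ⊕ ⊖ wedge f k (γ ∘ (v ∷_)) vs)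
          ≡⟨ ⊕-interchange _ _ _ _ ⟩
        (a ∙ f v ∙ β vs ⊕ a ∙ ⊖ wedge f k (β ∘ (v ∷_)) vs) ⊕ wedge f (suc k) γ (v ∷ vs)
          ≡⟨ cong (_⊕ wedge f (suc k) γ (v ∷ vs)) (∙-distribˡ a _ _) ⟨
        a ∙ wedge f (suc k) β (v ∷ vs) ⊕ wedge f (suc k) γ (v ∷ vs) ∎
        where
        open ≡-Reasoning
        spread : ∀ b (x y : W) → b ∙ (a ∙ x ⊕ y) ≡ a ∙ b ∙ x ⊕ b ∙ y
        spread b x y = trans (∙-distribˡ b (a ∙ x) y) (cong (_⊕ b ∙ y) (∙-comm b a x))

      wedge-vanishing : ∀ k β {l} (ι : Space l → Space n) → (∀ v → f (ι v) ≡ 0#) → ∀ vs → wedge f k β (map ι vs) ≡ 𝟎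
      wedge-vanishing zero    β ι f≡0 (v ∷ []) = trans (cong (_∙ β []) (f≡0 v)) (0∙ _)
      wedge-vanishing (suc k) β ι f≡0 (v ∷ vs) =
        𝟎⊕𝟎 (trans (cong (_∙ β (map ι vs)) (f≡0 v)) (0∙ _))
          (∙≡𝟎 (- 1#) (wedge-vanishing k (β ∘ (ι v ∷_)) ι f≡0 vs))

    module _ {n : ℕ} {f : Space n → Carrier} (f-linear : ∀ a x y → f (a ∙ x ⊕ y) ≡ (a * f x) + f y) where

      private
        f∙-linear : ∀ (w : W) → Linear (λ v → f v ∙ w)
        f∙-linear w a x y = trans (cong (_∙ w) (f-linear a x y))
          (trans (∙-distribʳ _ _ w) (cong (_⊕ f y ∙ w) (∙-assoc a (f x) w)))

      wedge-alternates : ∀ k {β} → Alternates k β → Alternates (suc k) (wedge f k β)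
      wedge-alternates zero    {β} _ = (λ _ → tt) , (λ { [] → f∙-linear (β []) }) , tt
      wedge-alternates (suc k) {β} alt@(slices , linear , headAlt) =
        (λ v → alternates-combine (suc k) (f v) (- 1#) alt (wedge-alternates k (slices v))) ,
        (λ vs a x y → begin
          f (a ∙ x ⊕ y) ∙ β vs ⊕ ⊖ wedge f k (β ∘ ((a ∙ x ⊕ y) ∷_)) vs
            ≡⟨ cong₂ _⊕_ (f∙-linear (β vs) a x y) (trans (cong ⊖_ (trans
                 (wedge-cong f k (λ us → linear us a x y) vs) (wedge-combine f k (β ∘ (x ∷_)) (β ∘ (y ∷_)) a vs)))
                 (trans (∙-distribˡ (- 1#) _ _) (cong (_⊕ _) (∙-comm (- 1#) a _)))) ⟩
          (a ∙ f x ∙ β vs ⊕ f y ∙ β vs) ⊕ (a ∙ ⊖ wedge f k (β ∘ (x ∷_)) vs ⊕ ⊖ wedge f k (β ∘ (y ∷_)) vs)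
            ≡⟨ ⊕-interchange _ _ _ _ ⟩
          (a ∙ f x ∙ β vs ⊕ a ∙ ⊖ wedge f k (β ∘ (x ∷_)) vs) ⊕ wedge f (suc k) β (y ∷ vs)
            ≡⟨ cong (_⊕ wedge f (suc k) β (y ∷ vs)) (∙-distribˡ a _ _) ⟨
          a ∙ wedge f (suc k) β (x ∷ vs) ⊕ wedge f (suc k) β (y ∷ vs) ∎) ,
        repeated k alt
        where
        open ≡-Reasoning
        -- Expansion along both copies of `v` produces `f v ∙ β (v ∷ vs)` twice with opposite signs;
        -- what remains evaluates β on a tuple that begins with `v`, `v`.
        repeated : ∀ k {β} → Alternates (suc k) β → ∀ v vs → wedge f (suc k) β (v ∷ v ∷ vs) ≡ 𝟎
        repeated zero    alt v [] = ⊖-inverseʳ _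
        repeated (suc k) {β} (_ , _ , headAlt) v vs = begin
          f v ∙ β (v ∷ vs) ⊕ ⊖ (f v ∙ β (v ∷ vs) ⊕ ⊖ wedge f k (λ us → β (v ∷ v ∷ us)) vs)
            ≡⟨ cong (λ w → f v ∙ β (v ∷ vs) ⊕ ⊖ (f v ∙ β (v ∷ vs) ⊕ w)) (∙≡𝟎 (- 1#) (wedge-𝟎 f k (headAlt v) vs)) ⟩
          f v ∙ β (v ∷ vs) ⊕ ⊖ (f v ∙ β (v ∷ vs) ⊕ 𝟎)
            ≡⟨ cong (λ w → f v ∙ β (v ∷ vs) ⊕ ⊖ w) (⊕-identityʳ _) ⟩
          f v ∙ β (v ∷ vs) ⊕ ⊖ (f v ∙ β (v ∷ vs))
            ≡⟨ ⊖-inverseʳ _ ⟩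
          𝟎 ∎

    head-linear : ∀ {n} a (x y : Space (suc n)) → head (a ∙ x ⊕ y) ≡ (a * head x) + head y
    head-linear a (_ ∷ _) (_ ∷ _) = refl

    tail-linear : ∀ {n} → Linear (tail {n = n})
    tail-linear a (_ ∷ _) (_ ∷ _) = refl

    -- Every alternating form in n + 1 variables is g₁ + e₀* ∧ g₂ with g₁ and g₂ pulled back along
    -- `tail`; the dual vector e₀* is `head`. `decompose` supplies this form, and `read` recovers
    -- the coefficients.
    build : ∀ n k → Vec W (dim n k) → Vec (Space n) k → W
    build n       zero    c vs = head c
    build zero    (suc k) c vs = 𝟎
    build (suc n) (suc k) c vs =
      build n (suc k) (take (dim n (suc k)) c) (map tail vs) ⊕
      wedge head k (build n k (drop (dim n (suc k)) c) ∘ map tail) vs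

    e₀ : ∀ {n} → Space (suc n)
    e₀ = 1# ∷ 𝟎

    -- The values of the form on the increasing k-tuples of standard basis vectors; at each level
    -- the tuples that contain e₀ come last.
    read : ∀ n k → (Vec (Space n) k → W) → Vec W (dim n k)
    read n       zero    g = g [] ∷ []
    read zero    (suc k) g = []
    read (suc n) (suc k) g =
      read n (suc k) (g ∘ map (0# ∷_)) ++ read n k (λ vs → g (e₀ ∷ map (0# ∷_) vs))

    read-cong : ∀ n k {g h} → (∀ vs → g vs ≡ h vs) → read n k g ≡ read n k h
    read-cong n       zero    eq = cong (_∷ []) (eq [])
    read-cong zero    (suc k) eq = refl
    read-cong (suc n) (suc k) eq = cong₂ _++_ (read-cong n (suc k) (λ vs → eq _)) (read-cong n k (λ vs → eq _))

    build-alternates : ∀ n k c → Alternates k (build n k c)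
    build-alternates n       zero    c = tt
    build-alternates zero    (suc k) c = 𝟎-alternates (suc k)
      where
      𝟎-alternates : ∀ {n} k → Alternates {n} k (λ _ → 𝟎)
      𝟎-alternates zero    = tt
      𝟎-alternates (suc k) = (λ _ → 𝟎-alternates k) , (λ _ a _ _ → sym (𝟎⊕𝟎 (∙≡𝟎 a refl) refl)) , head-𝟎 k
        where
        head-𝟎 : ∀ {n} k → HeadAlternates {n} k (λ _ → 𝟎)
        head-𝟎 zero    = tt
        head-𝟎 (suc k) = λ _ _ → refl
    build-alternates (suc n) (suc k) c = alternates-cong (suc k) (λ vs → cong₂ _⊕_ (1∙ _) (1∙ _))
      (alternates-combine (suc k) 1# 1#
        (alternates-pullback (suc k) tail-linear (build-alternates n (suc k) _))
        (wedge-alternates head-linear k (alternates-pullback k tail-linear (build-alternates n k _))))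

    map-tail-0∷ : ∀ {n k} (vs : Vec (Space n) k) → map tail (map (0# ∷_) vs) ≡ vs
    map-tail-0∷ []       = refl
    map-tail-0∷ (v ∷ vs) = cong (v ∷_) (map-tail-0∷ vs)

    -- The two summands of `build` are separated by evaluation. On vectors with head 0 the wedge
    -- with `head` vanishes; if e₀ is the first argument, then the pulled-back summand vanishes
    -- because the tail of e₀ is 0.
    read-build : ∀ n k c → read n k (build n k c) ≡ c
    read-build n       zero    (c ∷ []) = refl
    read-build zero    (suc k) []       = refl
    read-build (suc n) (suc k) c = begin
      read n (suc k) (build (suc n) (suc k) c ∘ map (0# ∷_)) ++ read n k (λ vs → build (suc n) (suc k) c (e₀ ∷ map (0# ∷_) vs))
        ≡⟨ cong₂ _++_ (read-cong n (suc k) without-e₀) (read-cong n k with-e₀) ⟩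
      read n (suc k) (build n (suc k) c₁) ++ read n k (build n k c₂)
        ≡⟨ cong₂ _++_ (read-build n (suc k) c₁) (read-build n k c₂) ⟩
      c₁ ++ c₂
        ≡⟨ Vec.take++drop≡id (dim n (suc k)) c ⟩
      c ∎
      where
      open ≡-Reasoning
      c₁ = take (dim n (suc k)) c
      c₂ = drop (dim n (suc k)) c
      without-e₀ : ∀ vs → build (suc n) (suc k) c (map (0# ∷_) vs) ≡ build n (suc k) c₁ vs
      without-e₀ vs = trans (cong₂ _⊕_ (cong (build n (suc k) c₁) (map-tail-0∷ vs))
        (wedge-vanishing head k _ (0# ∷_) (λ _ → refl) vs)) (⊕-identityʳ _)
      wedge-e₀ : ∀ k β (vs : Vec (Space n) k) → wedge head k (β ∘ map tail) (e₀ ∷ map (0# ∷_) vs) ≡ β vs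
      wedge-e₀ zero    β []       = 1∙ (β [])
      wedge-e₀ (suc k) β vs = trans (cong₂ _⊕_ (trans (1∙ _) (cong β (map-tail-0∷ vs)))
        (∙≡𝟎 (- 1#) (wedge-vanishing head k _ (0# ∷_) (λ _ → refl) vs))) (⊕-identityʳ _)
      with-e₀ : ∀ vs → build (suc n) (suc k) c (e₀ ∷ map (0# ∷_) vs) ≡ build n k c₂ vs
      with-e₀ vs = trans (cong₂ _⊕_
        (Linear-𝟎 (proj₁ (proj₂ (build-alternates n (suc k) c₁)) (map tail (map (0# ∷_) vs))))
        (wedge-e₀ k (build n k c₂) vs)) (⊕-identityˡ _)

    project : ∀ {n} → Space (suc n) → Space (suc n)
    project v = 0# ∷ tail v

    split-head : ∀ {n} (v : Space (suc n)) → v ≡ head v ∙ e₀ ⊕ project v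
    split-head {n} (a ∷ v) = cong₂ _∷_
      (sym (trans (+-identityʳ _) (trans (*-comm a 1#) (FiniteField.*-identityˡ F a))))
      (sym (trans (cong (_⊕ v) (∙𝟎 n a)) (⊕-identityˡ v)))

    -- Split the first argument as `head v ∙ e₀ ⊕ project v` and apply the induction hypothesis to
    -- both slices. In the slice at e₀ the correction term has e₀ twice and vanishes. In the slice
    -- at `project v` moving e₀ to the front yields exactly the sign in the expansion of `wedge`.
    decompose : ∀ {n} k {g : Vec (Space (suc n)) (suc k) → W} → Alternates (suc k) g → ∀ vs →
      g vs ≡ g (map project vs) ⊕ wedge head k (λ us → g (e₀ ∷ map project us)) vs
    decompose zero    {g} (slices , linear , _) (v ∷ []) = begin
      g (v ∷ []) ≡⟨ cong (λ u → g (u ∷ [])) (split-head v) ⟩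
      g ((head v ∙ e₀ ⊕ project v) ∷ []) ≡⟨ linear [] (head v) e₀ (project v) ⟩
      head v ∙ g (e₀ ∷ []) ⊕ g (project v ∷ []) ≡⟨ ⊕-comm _ _ ⟩
      g (project v ∷ []) ⊕ head v ∙ g (e₀ ∷ []) ∎
      where open ≡-Reasoning
    decompose (suc k) {g} alt@(slices , linear , headAlt) (v ∷ vs) = begin
      g (v ∷ vs)
        ≡⟨ cong (λ u → g (u ∷ vs)) (split-head v) ⟩
      g ((head v ∙ e₀ ⊕ project v) ∷ vs)
        ≡⟨ linear vs (head v) e₀ (project v) ⟩
      head v ∙ g (e₀ ∷ vs) ⊕ g (project v ∷ vs)
        ≡⟨ cong₂ (λ x y → head v ∙ x ⊕ y) e₀-slice (decompose k (slices (project v)) vs) ⟩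
      x ⊕ (y ⊕ wedge head k (λ us → g (project v ∷ e₀ ∷ map project us)) vs)
        ≡⟨ cong (λ z → x ⊕ (y ⊕ z)) swapped ⟩
      x ⊕ (y ⊕ z)
        ≡⟨ ⊕-assoc x y z ⟨
      (x ⊕ y) ⊕ z
        ≡⟨ cong (_⊕ z) (⊕-comm x y) ⟩
      (y ⊕ x) ⊕ z
        ≡⟨ ⊕-assoc y x z ⟩
      y ⊕ (x ⊕ z) ∎
      where
      open ≡-Reasoning
      x = head v ∙ g (e₀ ∷ map project vs)
      y = g (project v ∷ map project vs)
      z = ⊖ wedge head k (λ us → g (e₀ ∷ project v ∷ map project us)) vs
      e₀-slice : g (e₀ ∷ vs) ≡ g (e₀ ∷ map project vs)
      e₀-slice = trans (decompose k (slices e₀) vs)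
        (trans (cong (g (e₀ ∷ map project vs) ⊕_) (wedge-𝟎 head k (λ us → headAlt e₀ (map project us)) vs)) (⊕-identityʳ _))
      swapped : wedge head k (λ us → g (project v ∷ e₀ ∷ map project us)) vs ≡ z
      swapped = trans
        (wedge-cong head k (λ us → trans (antisymmetric k {g} alt (project v) e₀ (map project us)) (sym (⊕-identityʳ _))) vs)
        -- With the zero form as second summand, `wedge-combine` takes the scalar -1 out of the
        -- wedge.
        (trans (wedge-combine head k (λ us → g (e₀ ∷ project v ∷ map project us)) (λ _ → 𝟎) (- 1#) vs)
          (trans (cong (z ⊕_) (wedge-𝟎 head k (λ _ → refl) vs)) (⊕-identityʳ z)))

    map-project : ∀ {n k} (vs : Vec (Space (suc n)) k) → map (0# ∷_) (map tail vs) ≡ map project vs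
    map-project []       = refl
    map-project (v ∷ vs) = cong (project v ∷_) (map-project vs)

    0∷-linear : ∀ {n} → Linear {n} (0# ∷_)
    0∷-linear a x y = cong (_∷ (a ∙ x ⊕ y)) (sym (trans (+-identityʳ _) (zeroʳ a)))

    build-read : ∀ n k {g} → Alternates k g → ∀ vs → build n k (read n k g) vs ≡ g vs
    build-read n       zero    alt [] = refl
    build-read zero    (suc k) (_ , linear , _) ([] ∷ vs) = sym (Linear-𝟎 (linear vs))
    build-read (suc n) (suc k) {g} alt@(slices , _) vs = begin
      build n (suc k) (take d (r₁ ++ r₂)) (map tail vs) ⊕ wedge head k (build n k (drop d (r₁ ++ r₂)) ∘ map tail) vs
        ≡⟨ cong₂ (λ c₁ c₂ → build n (suc k) c₁ (map tail vs) ⊕ wedge head k (build n k c₂ ∘ map tail) vs)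
             (proj₁ (Vec.++-injective _ r₁ (Vec.take++drop≡id d (r₁ ++ r₂))))
             (proj₂ (Vec.++-injective _ r₁ (Vec.take++drop≡id d (r₁ ++ r₂)))) ⟩
      build n (suc k) r₁ (map tail vs) ⊕ wedge head k (build n k r₂ ∘ map tail) vs
        ≡⟨ cong₂ _⊕_
             (trans (build-read n (suc k) (alternates-pullback (suc k) 0∷-linear alt) (map tail vs)) (cong g (map-project vs)))
             (wedge-cong head k (λ us → trans
               (build-read n k (alternates-pullback k 0∷-linear (slices e₀)) (map tail us))
               (cong (λ ws → g (e₀ ∷ ws)) (map-project us))) vs) ⟩
      g (map project vs) ⊕ wedge head k (λ us → g (e₀ ∷ map project us)) vs
        ≡⟨ decompose k alt vs ⟨
      g vs ∎
      where
      open ≡-Reasoning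
      d = dim n (suc k)
      r₁ = read n (suc k) (g ∘ map (0# ∷_))
      r₂ = read n k (λ us → g (e₀ ∷ map (0# ∷_) us))

-- Null subspaces of a random form

module NullCounts where

  open import Defs
  open Counting
  open LinearAlgebra
  open SubspaceCounts
  open AlternatingMaps
  open import Data.Empty using (⊥-elim)
  open import Data.List as List using (List; []; _∷_; length; filter)
  open import Data.List.Properties using (length-filter)
  open import Data.List.Membership.Propositional using (_∈_)
  open import Data.List.Membership.Propositional.Properties using (∈-filter⁺; ∈-filter⁻)
  open import Data.List.Relation.Unary.Any using (here)
  open import Data.List.Relation.Unary.Unique.Propositional using (Unique)
  import Data.List.Relation.Unary.Unique.Propositional.Properties as Unique
  open import Data.Nat as ℕ using (ℕ; suc)
  open import Data.Nat.ListAction using (sum)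
  import Data.Nat.Properties as ℕ
  open import Data.Product using (∃-syntax; _,_; proj₁; proj₂)
  open import Data.Vec as Vec using (Vec; []; _∷_; tabulate; lookup; map)
  import Data.Vec.Properties as Vec
  open import Data.Vec.Relation.Unary.All as All using (All; []; _∷_)
  open import Function using (_∘_)
  open import Relation.Binary.PropositionalEquality
  open import Relation.Nullary.Decidable using (_→-dec_)
  open import Relation.Unary using (Decidable)

  open Finite {{...}}

  module _ {A B : Set} {{_ : Finite A}} where

    table : (A → B) → Table A B
    table g = tabulate (g ∘ element)

    table-value : ∀ (g : A → B) x → table g ⟪ x ⟫ ≡ g x
    table-value g x = trans (Vec.lookup∘tabulate (g ∘ element) (index x)) (cong g (element-index x))

    table-ext : ∀ {f g : Table A B} → (∀ (x : A) → f ⟪ x ⟫ ≡ g ⟪ x ⟫) → f ≡ g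
    table-ext {f} {g} eq = trans (sym (Vec.tabulate∘lookup f))
      (trans (Vec.tabulate-cong λ i → subst (λ j → lookup f j ≡ lookup g j) (index-element {A} i) (eq (element i)))
        (Vec.tabulate∘lookup g))

  module NullForms {q : ℕ} (F : FiniteField q) (N k m : ℕ) where
    open FiniteField F using (Carrier; finite-Carrier; -_; 1#)
    open RandomForm F N k m
    open VectorSpace F
    open Subspaces F N k m
    open AlternatingForms F m

    forms-alternate : ∀ {θ} → θ ∈ forms → Alternates {N} k (θ ⟪_⟫)
    forms-alternate θ∈ with proj₂ (∈-filter⁻ alternatingMultilinear? {xs = elements} θ∈)
    ... | additive , homogeneous , alternating = alternates⁺ k additive homogeneous alternating

    table∈forms : ∀ {g : Vec V k → W} → Alternates k g → table g ∈ forms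
    table∈forms {g} alt = ∈-filter⁺ alternatingMultilinear? (∈-elements _)
      ( (λ vs i x y → trans (value _) (trans (Linear-⊕ (linearAt k alt vs i) x y)
          (sym (cong₂ _⊕_ (value _) (value _)))))
      , (λ vs i a x → trans (value _) (trans (Linear-∙ (linearAt k alt vs i) a x) (sym (cong (a ∙_) (value _)))))
      , (λ vs i j i≢j eq → trans (value vs) (alternatesAt k alt vs i j i≢j eq)) )
      where
      value : ∀ vs → table g ⟪ vs ⟫ ≡ g vs
      value = table-value g

    forms-unique : Unique forms
    forms-unique = Unique.filter⁺ alternatingMultilinear? elements-unique

    isNull? : ∀ θ → Decidable (IsNull θ)
    isNull? θ H = all? λ hs → All.all? (_∈ⱽ? H) hs →-dec θ ⟪ hs ⟫ ≟ 𝟎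

    -- The reciprocal of the probability that a random form vanishes on a given s-space. It is
    -- written as the cardinality of the coefficient vectors in `W`; `codim≡` turns it into a power
    -- of q.
    codim : ℕ → ℕ
    codim s = (q ℕ.^ m) ℕ.^ dim s k

    module _ {s H} (sub : IsSubspace H) {bs : Vec V s} (basis : IsBasis H bs)
      {φ : V → Space s} (φ-linear : Linear φ) (retracts : ∀ as → φ (combination as bs) ≡ as) where

      open ≡-Reasoning

      private
        bs∈ : All (_∈ⱽ H) bs
        bs∈ = proj₁ basis

      inclusion : Space s → V
      inclusion as = combination as bs
      restrict : Form → Vec W (dim s k)
      restrict θ = read s k (λ as → θ ⟪ map inclusion as ⟫)
      extension : Vec W (dim s k) → Form
      extension c = table (build s k c ∘ map φ)
      extension-alternates : ∀ c → Alternates k (build s k c ∘ map φ)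
      extension-alternates c = alternates-pullback k φ-linear (build-alternates s k c)
      map-retracts : ∀ {l} (as : Vec (Space s) l) → map φ (map inclusion as) ≡ as
      map-retracts []       = refl
      map-retracts (a ∷ as) = cong₂ _∷_ (retracts a) (map-retracts as)
      extension-inclusion : ∀ c as → extension c ⟪ map inclusion as ⟫ ≡ build s k c as
      extension-inclusion c as = trans (table-value (build s k c ∘ map φ) _) (cong (build s k c) (map-retracts as))
      lift : ∀ {l} {hs : Vec V l} → All (_∈ⱽ H) hs → ∃[ as ] map inclusion as ≡ hs
      lift []         = [] , refl
      lift (h∈ ∷ hs∈) = let a , eq = proj₂ (proj₂ basis) _ h∈ ; as , eqs = lift hs∈ in a ∷ as , cong₂ _∷_ eq eqs
      inclusion∈ : ∀ {l} (as : Vec (Space s) l) → All (_∈ⱽ H) (map inclusion as)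
      inclusion∈ []       = []
      inclusion∈ (a ∷ as) = combination-∈ sub a bs∈ ∷ inclusion∈ as
      _⊞_∙_ : Form → Carrier → Form → Form
      θ ⊞ a ∙ η = table (λ (vs : Vec V k) → 1# ∙ θ ⟪ vs ⟫ ⊕ a ∙ η ⟪ vs ⟫)
      ⊞-value : ∀ θ a η vs → (θ ⊞ a ∙ η) ⟪ vs ⟫ ≡ θ ⟪ vs ⟫ ⊕ a ∙ η ⟪ vs ⟫
      ⊞-value θ a η vs = trans (table-value (λ (vs : Vec V k) → 1# ∙ θ ⟪ vs ⟫ ⊕ a ∙ η ⟪ vs ⟫) vs) (cong (_⊕ a ∙ η ⟪ vs ⟫) (1∙ _))
      extension∈ : ∀ c → extension c ∈ forms
      extension∈ c = table∈forms (extension-alternates c)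
      ⊞∈forms : ∀ {θ} a {η} → θ ∈ forms → η ∈ forms → (θ ⊞ a ∙ η) ∈ forms
      ⊞∈forms a θ∈ η∈ = table∈forms (alternates-combine k 1# a (forms-alternate θ∈) (forms-alternate η∈))
      -- The fibres of `restrict` are translates of one another: subtracting `extension c` carries
      -- the fibre over `c` onto the forms that are null on `H`, and adding it back is the inverse.
      columns : ∀ c → length (filter (λ θ → restrict θ ≟ c) forms) ≡ length (filter (λ θ → isNull? θ H) forms)
      columns c = length-bijection
        (Unique.filter⁺ (λ θ → restrict θ ≟ c) forms-unique) (Unique.filter⁺ (λ θ → isNull? θ H) forms-unique)
        (λ θ → θ ⊞ (- 1#) ∙ extension c) (λ θ → θ ⊞ 1# ∙ extension c)
        (λ {θ} θ∈ → let θ∈forms , eq = ∈-filter⁻ (λ θ → restrict θ ≟ c) {xs = forms} θ∈ in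
          ∈-filter⁺ (λ θ → isNull? θ H) (⊞∈forms (- 1#) θ∈forms (extension∈ c)) (difference-null θ∈forms eq))
        (λ {θ} θ∈ → let θ∈forms , null = ∈-filter⁻ (λ θ → isNull? θ H) {xs = forms} θ∈ in
          ∈-filter⁺ (λ θ → restrict θ ≟ c) (⊞∈forms 1# θ∈forms (extension∈ c)) (restrict-sum {θ} null))
        (λ {θ} _ → subtract-add θ) (λ {θ} _ → add-subtract θ)
        where
        subtract-add : ∀ θ → (θ ⊞ (- 1#) ∙ extension c) ⊞ 1# ∙ extension c ≡ θ
        subtract-add θ = table-ext λ (vs : Vec V k) → begin
          ((θ ⊞ (- 1#) ∙ extension c) ⊞ 1# ∙ extension c) ⟪ vs ⟫
            ≡⟨ ⊞-value (θ ⊞ (- 1#) ∙ extension c) 1# (extension c) vs ⟩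
          (θ ⊞ (- 1#) ∙ extension c) ⟪ vs ⟫ ⊕ 1# ∙ extension c ⟪ vs ⟫
            ≡⟨ cong₂ _⊕_ (⊞-value θ (- 1#) (extension c) vs) (1∙ (extension c ⟪ vs ⟫)) ⟩
          (θ ⟪ vs ⟫ ⊕ ⊖ (extension c ⟪ vs ⟫)) ⊕ extension c ⟪ vs ⟫
            ≡⟨ ⊖-⊕-cancelʳ (θ ⟪ vs ⟫) (extension c ⟪ vs ⟫) ⟩
          θ ⟪ vs ⟫ ∎
        add-subtract : ∀ θ → (θ ⊞ 1# ∙ extension c) ⊞ (- 1#) ∙ extension c ≡ θ
        add-subtract θ = table-ext λ (vs : Vec V k) → begin
          ((θ ⊞ 1# ∙ extension c) ⊞ (- 1#) ∙ extension c) ⟪ vs ⟫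
            ≡⟨ ⊞-value (θ ⊞ 1# ∙ extension c) (- 1#) (extension c) vs ⟩
          (θ ⊞ 1# ∙ extension c) ⟪ vs ⟫ ⊕ ⊖ (extension c ⟪ vs ⟫)
            ≡⟨ cong (_⊕ ⊖ (extension c ⟪ vs ⟫)) (trans (⊞-value θ 1# (extension c) vs)
                 (cong (θ ⟪ vs ⟫ ⊕_) (1∙ (extension c ⟪ vs ⟫)))) ⟩
          (θ ⟪ vs ⟫ ⊕ extension c ⟪ vs ⟫) ⊕ ⊖ (extension c ⟪ vs ⟫)
            ≡⟨ ⊕-⊖-cancelʳ (θ ⟪ vs ⟫) (extension c ⟪ vs ⟫) ⟩
          θ ⟪ vs ⟫ ∎
        difference-vanishes : ∀ {θ} → θ ∈ forms → restrict θ ≡ c → ∀ as → (θ ⊞ (- 1#) ∙ extension c) ⟪ map inclusion as ⟫ ≡ 𝟎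
        difference-vanishes {θ} θ∈ refl as = begin
          (θ ⊞ (- 1#) ∙ extension c) ⟪ map inclusion as ⟫
            ≡⟨ ⊞-value θ (- 1#) (extension c) _ ⟩
          θ ⟪ map inclusion as ⟫ ⊕ ⊖ (extension c ⟪ map inclusion as ⟫)
            ≡⟨ cong (λ w → θ ⟪ map inclusion as ⟫ ⊕ ⊖ w) (trans (extension-inclusion c as)
                 (build-read s k (alternates-pullback k (combination-linear bs) (forms-alternate θ∈)) as)) ⟩
          θ ⟪ map inclusion as ⟫ ⊕ ⊖ (θ ⟪ map inclusion as ⟫)
            ≡⟨ ⊖-inverseʳ _ ⟩
          𝟎 ∎
        difference-null : ∀ {θ} → θ ∈ forms → restrict θ ≡ c → IsNull (θ ⊞ (- 1#) ∙ extension c) H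
        difference-null {θ} θ∈ eq hs hs∈ = let as , eqs = lift hs∈ in
          subst (λ hs → (θ ⊞ (- 1#) ∙ extension c) ⟪ hs ⟫ ≡ 𝟎) eqs (difference-vanishes θ∈ eq as)
        restrict-sum : ∀ {θ} → IsNull θ H → restrict (θ ⊞ 1# ∙ extension c) ≡ c
        restrict-sum {θ} null = trans
          (read-cong s k λ as → trans (⊞-value θ 1# (extension c) _)
            (trans (cong₂ _⊕_ (null _ (inclusion∈ as)) (trans (1∙ _) (extension-inclusion c as))) (⊕-identityˡ _)))
          (read-build s k c)

      length-nullForms′ : length (filter (λ θ → isNull? θ H) forms) ℕ.* codim s ≡ length forms
      length-nullForms′ = begin
        length (filter (λ θ → isNull? θ H) forms) ℕ.* codim s
          ≡⟨ ℕ.*-comm _ (codim s) ⟩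
        codim s ℕ.* length (filter (λ θ → isNull? θ H) forms)
          ≡⟨ cong (ℕ._* length (filter (λ θ → isNull? θ H) forms))
               (trans (length-elements {Vec W (dim s k)})
                 (trans (card-Vec W (dim s k)) (cong (ℕ._^ dim s k) (card-Vec Carrier m)))) ⟨
        length (elements {Vec W (dim s k)}) ℕ.* length (filter (λ θ → isNull? θ H) forms)
          ≡⟨ doubleCount (λ θ c → restrict θ ≟ c) {forms} {elements}
               (λ {θ} _ → filter-unique (restrict θ ≟_) elements-unique (∈-elements (restrict θ)) refl (λ _ → sym))
               (λ {c} _ → columns c) ⟨
        length forms ℕ.* 1
          ≡⟨ ℕ.*-identityʳ _ ⟩
        length forms ∎

    length-nullForms : ∀ {s H} → Subspace s H →
      length (filter (λ θ → isNull? θ H) forms) ℕ.* codim s ≡ length forms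
    length-nullForms (sub , bs , basis@(_ , independent , _)) =
      let φ , φ-linear , retracts = linear-retraction independent in length-nullForms′ sub basis φ-linear retracts

    nullSubspaces : Form → ℕ → List SubsetOfV
    nullSubspaces θ s = filter (nullSubspace? θ s) elements

    nullSubspaces-unique : ∀ θ s → Unique (nullSubspaces θ s)
    nullSubspaces-unique θ s = Unique.filter⁺ (nullSubspace? θ s) elements-unique

    nullSubspaces-∈ : ∀ {θ s H} → H ∈ nullSubspaces θ s → NullSubspace θ s H
    nullSubspaces-∈ {θ} {s} H∈ = proj₂ (∈-filter⁻ (nullSubspace? θ s) {xs = elements} H∈)

    ∈-nullSubspaces : ∀ {θ s H} → NullSubspace θ s H → H ∈ nullSubspaces θ s
    ∈-nullSubspaces {θ} {s} = ∈-filter⁺ (nullSubspace? θ s) (∈-elements _)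

    -- Linearity of expectation with the denominators cleared: after exchanging the sums, every
    -- s-space contributes the same number of forms, by `length-nullForms`.
    first-moment : ∀ s → sum (List.map (X s) forms) ℕ.* codim s ≡ length (subspaces s) ℕ.* length forms
    first-moment s = begin
      sum (List.map (X s) forms) ℕ.* codim s
        ≡⟨ cong (ℕ._* codim s) (sum-cong (X s) _ forms (λ {θ} _ → X≡ θ)) ⟩
      sum (List.map (λ θ → length (filter (isNull? θ) (subspaces s))) forms) ℕ.* codim s
        ≡⟨ cong (ℕ._* codim s) (sum-filter-swap isNull? forms (subspaces s)) ⟩
      sum (List.map (λ H → length (filter (λ θ → isNull? θ H) forms)) (subspaces s)) ℕ.* codim s
        ≡⟨ sum-*ʳ (λ H → length (filter (λ θ → isNull? θ H) forms)) (codim s) (subspaces s) ⟨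
      sum (List.map (λ H → length (filter (λ θ → isNull? θ H) forms) ℕ.* codim s) (subspaces s))
        ≡⟨ sum-cong _ _ (subspaces s) (λ H∈ → length-nullForms (subspaces-∈ {s} H∈)) ⟩
      sum (List.map (λ _ → length forms) (subspaces s))
        ≡⟨ sum-const (length forms) (subspaces s) ⟩
      length (subspaces s) ℕ.* length forms ∎
      where
      open ≡-Reasoning
      X≡ : ∀ θ → X s θ ≡ length (filter (isNull? θ) (subspaces s))
      X≡ θ = length-cong (nullSubspaces-unique θ s) (Unique.filter⁺ (isNull? θ) (subspaces-unique s))
        (λ {H} H∈ → let sub , dim , null = nullSubspaces-∈ {θ} {s} {H} H∈ in ∈-filter⁺ (isNull? θ) (∈-subspaces {s} {H} (sub , dim)) null)
        (λ {H} H∈ → let H∈′ , null = ∈-filter⁻ (isNull? θ) {xs = subspaces s} H∈ ; sub , dim = subspaces-∈ {s} {H} H∈′ in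
          ∈-nullSubspaces {θ} {s} {H} (sub , dim , null))

    module _ (θ : Form) {r l : ℕ} (hyperplanes : ∀ n → n ℕ.* frames q r r ≡ frames q (suc r) r → n ≡ l) where

      -- Nullity passes to subspaces, so the null r-spaces in `U` are all its hyperplanes. Their
      -- number is available only through the product equation of `length-subspacesIn`, which the
      -- module parameter solves for `l`.
      length-hyperplanes : ∀ {U} → U ∈ nullSubspaces θ (suc r) → length (filter (_⊆ⱽ? U) (nullSubspaces θ r)) ≡ l
      length-hyperplanes {U} U∈ = let subU , dimU , nullU = nullSubspaces-∈ {θ} {suc r} {U} U∈ in trans
        (length-cong (Unique.filter⁺ (_⊆ⱽ? U) (nullSubspaces-unique θ r)) (Unique.filter⁺ (_⊆ⱽ? U) (subspaces-unique r))
          (λ {H} H∈ → let H∈′ , H⊆U = ∈-filter⁻ (_⊆ⱽ? U) {xs = nullSubspaces θ r} H∈ ; sub , dim , _ = nullSubspaces-∈ {θ} {r} {H} H∈′ in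
            ∈-filter⁺ (_⊆ⱽ? U) (∈-subspaces {r} {H} (sub , dim)) H⊆U)
          (λ {H} H∈ → let H∈′ , H⊆U = ∈-filter⁻ (_⊆ⱽ? U) {xs = subspaces r} H∈ ; sub , dim = subspaces-∈ {r} {H} H∈′ in
            ∈-filter⁺ (_⊆ⱽ? U) (∈-nullSubspaces {θ} {r} {H} (sub , dim , λ hs hs∈ → nullU hs (All.map (λ {v} → H⊆U v) hs∈))) H⊆U))
        (hyperplanes _ (length-subspacesIn (subU , dimU) r))

      -- One null (r+1)-space already provides `l` null r-spaces. This comparison carries the
      -- induction in `falling-superadditive` from pairs to longer tuples.
      hyperplanes≤X : X (suc r) θ ≢ 0 → l ℕ.≤ X r θ
      hyperplanes≤X X≢0 = let U , U∈ = inhabited (nullSubspaces θ (suc r)) X≢0 in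
        ℕ.≤-trans (ℕ.≤-reflexive (sym (length-hyperplanes U∈))) (length-filter (_⊆ⱽ? U) (nullSubspaces θ r))
        where
        inhabited : ∀ {A : Set} (xs : List A) → length xs ≢ 0 → ∃[ x ] x ∈ xs
        inhabited []      ≢0 = ⊥-elim (≢0 refl)
        inhabited (x ∷ _) _  = x , here refl

      null-pairs : X r θ ℕ.+ X (suc r) θ ℕ.* (l ℕ.* l ℕ.∸ l) ℕ.≤ X r θ ℕ.* X r θ
      null-pairs = pairs-in-members _≟_ (λ U H → H ⊆ⱽ? U) (nullSubspaces-unique θ r) (nullSubspaces-unique θ (suc r))
        length-hyperplanes
        (λ {U} {U′} {H} {H′} U∈ U′∈ H∈ H′∈ H≢H′ H⊆U H′⊆U H⊆U′ H′⊆U′ →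
          hyperplanes-span (dimensionOf {H} H∈) (dimensionOf {H′} H′∈) (dimensionOf {U} U∈) (dimensionOf {U′} U′∈)
            H≢H′ H⊆U H′⊆U H⊆U′ H′⊆U′)
        where
        dimensionOf : ∀ {H s} → H ∈ nullSubspaces θ s → Subspace s H
        dimensionOf {H} {s} H∈ = let sub , dim , _ = nullSubspaces-∈ {θ} {s} {H} H∈ in sub , dim

-- Inequalities for frame counts and falling factorials

module FrameBounds where

  open SubspaceCounts using (frames)
  open import Data.Nat
  open import Data.Nat.Combinatorics using (_P_; nPk≡n!/[n∸k]!; k>n⇒nPk≡0)
  open import Data.Nat.Combinatorics.Base using (_P′_)
  open import Data.Nat.Combinatorics.Specification using (nP′k≡n!/[n∸k]!)
  open import Data.Nat.Properties
  open import Data.Nat.Solver using (module +-*-Solver)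
  open import Relation.Binary.PropositionalEquality
  open import Relation.Nullary using (yes; no)

  open +-*-Solver using (solve; _:=_; _:+_; _:*_; con)

  *-cancelʳ-≤′ : ∀ {a b} c → 0 < c → a * c ≤ b * c → a ≤ b
  *-cancelʳ-≤′ {a} {b} c 0<c = *-cancelʳ-≤ a b c {{>-nonZero 0<c}}

  *-mono-<ˡ : ∀ {a b c d} → a < b → c ≤ d → 0 < d → a * c < b * d
  *-mono-<ˡ {a} {b} {c} {d} a<b c≤d 0<d =
    ≤-<-trans (*-monoʳ-≤ a c≤d) (*-monoˡ-< d {{>-nonZero 0<d}} a<b)

  module _ {q : ℕ} (1<q : 1 < q) where

    private
      0<q : 0 < q
      0<q = <-trans z<s 1<q

    0<q^ : ∀ n → 0 < q ^ n
    0<q^ n = >-nonZero⁻¹ (q ^ n) {{m^n≢0 q n {{>-nonZero 0<q}}}}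

    -- Apart from q^(u+1) - 1, each of the remaining s factors is q times a factor of
    -- `frames q u s`. Thus the product can be unfolded at its first factor, whereas the definition
    -- unfolds it at the last.
    frames-shift : ∀ u s → frames q (suc u) (suc s) ≡ (q ^ suc u ∸ 1) * (q ^ s * frames q u s)
    frames-shift u zero    = trans (*-identityˡ (q ^ suc u ∸ 1)) (sym (*-identityʳ (q ^ suc u ∸ 1)))
    frames-shift u (suc s) = begin
      frames q (suc u) (suc s) * (q * q ^ u ∸ q * q ^ s)
        ≡⟨ cong₂ _*_ (frames-shift u s) (sym (*-distribˡ-∸ q (q ^ u) (q ^ s))) ⟩
      (q ^ suc u ∸ 1) * (q ^ s * frames q u s) * (q * (q ^ u ∸ q ^ s))
        ≡⟨ solve 5 (λ e x f q d → (e :* (x :* f)) :* (q :* d) := e :* ((q :* x) :* (f :* d))) refl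
             (q ^ suc u ∸ 1) (q ^ s) (frames q u s) q (q ^ u ∸ q ^ s) ⟩
      (q ^ suc u ∸ 1) * (q ^ suc s * frames q u (suc s)) ∎
      where open ≡-Reasoning

    frames-positive : ∀ {u s} → s ≤ u → 0 < frames q u s
    frames-positive {u} {zero}  _   = z<s
    frames-positive {u} {suc s} s<u = *-mono-< (frames-positive (<⇒≤ s<u)) (m<n⇒0<n∸m (^-monoʳ-< q 1<q s<u))

    -- Factor by factor, q^d (q^u - q^i) ≤ q^(d+u) - q^i. With u = s it says that the Gaussian
    -- binomial coefficient is at least q^(ds).
    frames-lower : ∀ d u s → (q ^ d) ^ s * frames q u s ≤ frames q (d + u) s
    frames-lower d u zero    = ≤-refl
    frames-lower d u (suc s) = begin
      q ^ d * (q ^ d) ^ s * (frames q u s * (q ^ u ∸ q ^ s))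
        ≡⟨ solve 4 (λ x y f e → (x :* y) :* (f :* e) := (y :* f) :* (x :* e)) refl
             (q ^ d) ((q ^ d) ^ s) (frames q u s) (q ^ u ∸ q ^ s) ⟩
      (q ^ d) ^ s * frames q u s * (q ^ d * (q ^ u ∸ q ^ s))
        ≤⟨ *-mono-≤ (frames-lower d u s) factor ⟩
      frames q (d + u) s * (q ^ (d + u) ∸ q ^ s) ∎
      where
      open ≤-Reasoning
      factor : q ^ d * (q ^ u ∸ q ^ s) ≤ q ^ (d + u) ∸ q ^ s
      factor = begin
        q ^ d * (q ^ u ∸ q ^ s) ≡⟨ *-distribˡ-∸ (q ^ d) (q ^ u) (q ^ s) ⟩
        q ^ d * q ^ u ∸ q ^ d * q ^ s ≤⟨ ∸-monoʳ-≤ (q ^ d * q ^ u) (m≤n*m (q ^ s) (q ^ d) {{>-nonZero (0<q^ d)}}) ⟩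
        q ^ d * q ^ u ∸ q ^ s ≡⟨ cong (_∸ q ^ s) (^-distribˡ-+-* q d u) ⟨
        q ^ (d + u) ∸ q ^ s ∎

    frames-upper : ∀ u s → frames q u s ≤ (q ^ u) ^ s
    frames-upper u zero    = ≤-refl
    frames-upper u (suc s) = begin
      frames q u s * (q ^ u ∸ q ^ s) ≤⟨ *-mono-≤ (frames-upper u s) (m∸n≤m (q ^ u) (q ^ s)) ⟩
      (q ^ u) ^ s * q ^ u ≡⟨ *-comm ((q ^ u) ^ s) (q ^ u) ⟩
      (q ^ u) ^ suc s ∎
      where open ≤-Reasoning

    -- The factor q^u - 1 already gives strictness. The upper bound on the expectation needs it,
    -- since a product of cuts is approached only by strictly smaller factors.
    frames-upper-< : ∀ u s → frames q u (suc s) < (q ^ u) ^ suc s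
    frames-upper-< u zero    = begin-strict
      1 * (q ^ u ∸ 1) ≡⟨ *-identityˡ _ ⟩
      q ^ u ∸ 1 <⟨ ∸-monoʳ-< z<s (0<q^ u) ⟩
      q ^ u ≡⟨ *-identityʳ (q ^ u) ⟨
      q ^ u * 1 ∎
      where open ≤-Reasoning
    frames-upper-< u (suc s) = begin-strict
      frames q u (suc s) * (q ^ u ∸ q ^ suc s)
        <⟨ *-mono-<ˡ (frames-upper-< u s) (m∸n≤m (q ^ u) (q ^ suc s)) (0<q^ u) ⟩
      (q ^ u) ^ suc s * q ^ u ≡⟨ *-comm ((q ^ u) ^ suc s) (q ^ u) ⟩
      (q ^ u) ^ suc (suc s) ∎
      where open ≤-Reasoning

    -- ∏_{j ≤ s} (1 − q^{-j}) ≥ q^{-2} (1 + 2 q^{-s}) without denominators; the extra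
    -- term makes the bound inductive.
    frames-product : ∀ s → q ^ (suc s * suc s) * (q ^ suc s + 2) ≤ frames q (suc s) (suc s) * (q ^ suc s * (q * q))
    frames-product zero    = begin
      q * 1 * (q * 1 + 2) ≡⟨ cong (λ x → x * (x + 2)) (*-identityʳ q) ⟩
      q * (q + 2) ≤⟨ *-monoʳ-≤ q (base 1<q) ⟩
      q * ((q ∸ 1) * (q * q)) ≡⟨ solve 2 (λ q e → q :* (e :* (q :* q)) := (e :* (q :* (q :* q)))) refl q (q ∸ 1) ⟩
      (q ∸ 1) * (q * (q * q)) ≡⟨ cong₂ (λ x y → x * (y * (q * q))) 1*[q*1∸1]≡q∸1 (*-identityʳ q) ⟨
      1 * (q * 1 ∸ 1) * (q * 1 * (q * q)) ∎
      where
      open ≤-Reasoning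
      1*[q*1∸1]≡q∸1 : 1 * (q * 1 ∸ 1) ≡ q ∸ 1
      1*[q*1∸1]≡q∸1 = trans (*-identityˡ _) (cong (_∸ 1) (*-identityʳ q))
      -- Equality holds at q = 2, so the extra term could not be larger than 2 here; with 1 in its
      -- place the inductive step would fail at q = 2.
      base : ∀ {q} → 1 < q → q + 2 ≤ (q ∸ 1) * (q * q)
      base {suc (suc p)} _ = begin
        2 + p + 2 ≤⟨ m≤m+n (2 + p + 2) (p * (7 + (5 * p + p * p))) ⟩
        2 + p + 2 + (p * (7 + (5 * p + p * p)))
          ≡⟨ solve 1 (λ p → con 2 :+ p :+ con 2 :+ (p :* (con 7 :+ (con 5 :* p :+ p :* p)))
               := (con 1 :+ p) :* ((con 2 :+ p) :* (con 2 :+ p))) refl p ⟩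
        (1 + p) * ((2 + p) * (2 + p)) ∎
      base {suc zero} (s≤s ())
    frames-product (suc s) = begin
      q ^ (suc (suc s) * suc (suc s)) * (q * y + 2)
        ≡⟨ cong (_* (q * y + 2)) square ⟩
      E * (y * (q * y)) * (q * y + 2)
        ≡⟨ solve 3 (λ e y z → (e :* (y :* z)) :* (z :+ con 2) := z :* (e :* (y :* (z :+ con 2)))) refl E y (q * y) ⟩
      q * y * (E * (y * (q * y + 2)))
        ≤⟨ *-monoʳ-≤ (q * y) (*-monoʳ-≤ E (improve (q * y) y 2≤y (*-monoˡ-≤ y 1<q))) ⟩
      q * y * (E * ((q * y ∸ 1) * (y + 2)))
        ≡⟨ solve 4 (λ z e p y → z :* (e :* (p :* (y :+ con 2))) := (p :* z) :* (e :* (y :+ con 2))) refl (q * y) E (q * y ∸ 1) y ⟩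
      (q * y ∸ 1) * (q * y) * (E * (y + 2))
        ≤⟨ *-monoʳ-≤ ((q * y ∸ 1) * (q * y)) (frames-product s) ⟩
      (q * y ∸ 1) * (q * y) * (frames q (suc s) (suc s) * (y * (q * q)))
        ≡⟨ solve 5 (λ p z f y q² → (p :* z) :* (f :* (y :* q²)) := (p :* (y :* f)) :* (z :* q²)) refl
             (q * y ∸ 1) (q * y) (frames q (suc s) (suc s)) y (q * q) ⟩
      (q * y ∸ 1) * (y * frames q (suc s) (suc s)) * (q * y * (q * q))
        ≡⟨ cong (_* (q * y * (q * q))) (frames-shift (suc s) (suc s)) ⟨
      frames q (suc (suc s)) (suc (suc s)) * (q * y * (q * q)) ∎
      where
      open ≤-Reasoning
      y = q ^ suc s
      E = q ^ (suc s * suc s)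
      2≤y : 2 ≤ y
      2≤y = ≤-trans 1<q (m≤m*n q (q ^ s) {{>-nonZero (0<q^ s)}})
      square : q ^ (suc (suc s) * suc (suc s)) ≡ E * (y * (q * y))
      square = begin-equality
        q ^ (suc (suc s) * suc (suc s))
          ≡⟨ cong (q ^_) (solve 1 (λ s → (con 2 :+ s) :* (con 2 :+ s) := (con 1 :+ s) :* (con 1 :+ s) :+ ((con 1 :+ s) :+ (con 2 :+ s))) refl s) ⟩
        q ^ (suc s * suc s + (suc s + suc (suc s)))
          ≡⟨ trans (^-distribˡ-+-* q (suc s * suc s) (suc s + suc (suc s))) (cong (E *_) (^-distribˡ-+-* q (suc s) (suc (suc s)))) ⟩
        E * (y * (q * y)) ∎
      -- Expanded, the claim is 3y + 2 ≤ 2z, which follows from z ≥ 2y and y ≥ 2.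
      improve : ∀ z y → 2 ≤ y → 2 * y ≤ z → y * (z + 2) ≤ (z ∸ 1) * (y + 2)
      improve z y 2≤y 2y≤z with z ∸ 1 in eq
      ... | p = begin
        y * (z + 2) ≡⟨ cong (λ z → y * (z + 2)) z≡ ⟩
        y * (suc p + 2) ≡⟨ solve 2 (λ y p → y :* (con 1 :+ p :+ con 2) := p :* y :+ con 3 :* y) refl y p ⟩
        p * y + 3 * y ≤⟨ +-monoʳ-≤ (p * y) 3y≤2p ⟩
        p * y + p * 2 ≡⟨ *-distribˡ-+ p y 2 ⟨
        p * (y + 2) ∎
        where
        z≡ : z ≡ suc p
        z≡ = trans (sym (m+[n∸m]≡n (≤-trans (s≤s z≤n) (≤-trans (*-monoʳ-≤ 2 2≤y) 2y≤z)))) (cong suc eq)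
        3y≤2p : 3 * y ≤ p * 2
        3y≤2p = +-cancelˡ-≤ 2 (3 * y) (p * 2) (begin
          2 + 3 * y ≤⟨ +-monoˡ-≤ (3 * y) 2≤y ⟩
          y + 3 * y ≡⟨ solve 1 (λ y → y :+ con 3 :* y := (con 2 :* y) :* con 2) refl y ⟩
          2 * y * 2 ≤⟨ *-monoˡ-≤ 2 2y≤z ⟩
          z * 2 ≡⟨ cong (_* 2) z≡ ⟩
          2 + p * 2 ∎)

    frames-almost-all : ∀ s → (q ^ s) ^ s ≤ q ^ 2 * frames q s s
    frames-almost-all zero    = *-mono-≤ (0<q^ 2) ≤-refl
    frames-almost-all (suc s) = *-cancelʳ-≤′ (q ^ suc s) (0<q^ (suc s)) (begin
      (q ^ suc s) ^ suc s * q ^ suc s ≡⟨ cong (_* q ^ suc s) (^-*-assoc q (suc s) (suc s)) ⟩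
      q ^ (suc s * suc s) * q ^ suc s ≤⟨ *-monoʳ-≤ (q ^ (suc s * suc s)) (m≤m+n (q ^ suc s) 2) ⟩
      q ^ (suc s * suc s) * (q ^ suc s + 2) ≤⟨ frames-product s ⟩
      frames q (suc s) (suc s) * (q ^ suc s * (q * q))
        ≡⟨ solve 3 (λ f y q → f :* (y :* (q :* q)) := ((q :* (q :* con 1)) :* f) :* y) refl (frames q (suc s) (suc s)) (q ^ suc s) q ⟩
      q ^ 2 * frames q (suc s) (suc s) * q ^ suc s ∎)
      where open ≤-Reasoning

    -- Both frame counts contain the factor q^r `frames q (suc r) r`: on the left beside q - 1 from
    -- the last factor, on the right beside q^(r+2) - 1 by `frames-shift`. Cancelling it leaves the
    -- geometric sum.
    hyperplane-number : ∀ r n → n * frames q (suc r) (suc r) ≡ frames q (suc (suc r)) (suc r) →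
      n * (q ∸ 1) ≡ q ^ suc (suc r) ∸ 1
    hyperplane-number r n eq = *-cancelʳ-≡ _ _ x {{>-nonZero 0<x}} (begin
      n * (q ∸ 1) * x ≡⟨ solve 4 (λ n e f y → (n :* e) :* (f :* y) := n :* (f :* (e :* y))) refl n (q ∸ 1) (frames q (suc r) r) (q ^ r) ⟩
      n * (frames q (suc r) r * ((q ∸ 1) * q ^ r)) ≡⟨ cong (λ d → n * (frames q (suc r) r * d)) difference ⟩
      n * frames q (suc r) (suc r) ≡⟨ eq ⟩
      frames q (suc (suc r)) (suc r) ≡⟨ frames-shift (suc r) r ⟩
      (q ^ suc (suc r) ∸ 1) * (q ^ r * frames q (suc r) r)
        ≡⟨ cong ((q ^ suc (suc r) ∸ 1) *_) (*-comm (q ^ r) (frames q (suc r) r)) ⟩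
      (q ^ suc (suc r) ∸ 1) * x ∎)
      where
      open ≡-Reasoning
      x = frames q (suc r) r * q ^ r
      0<x : 0 < x
      0<x = *-mono-< (frames-positive (n≤1+n r)) (0<q^ r)
      difference : (q ∸ 1) * q ^ r ≡ q ^ suc r ∸ q ^ r
      difference = trans (*-distribʳ-∸ (q ^ r) q 1) (cong (q ^ suc r ∸_) (*-identityˡ (q ^ r)))

    power≤hyperplanes : ∀ r n → n * (q ∸ 1) ≡ q ^ suc r ∸ 1 → q ^ r ≤ n
    power≤hyperplanes r n eq = *-cancelʳ-≤′ (q ∸ 1) (m<n⇒0<n∸m 1<q) (begin
      q ^ r * (q ∸ 1) ≡⟨ *-distribˡ-∸ (q ^ r) q 1 ⟩
      q ^ r * q ∸ q ^ r * 1 ≡⟨ cong₂ _∸_ (*-comm (q ^ r) q) (*-identityʳ (q ^ r)) ⟩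
      q ^ suc r ∸ q ^ r ≤⟨ ∸-monoʳ-≤ (q ^ suc r) (0<q^ r) ⟩
      q ^ suc r ∸ 1 ≡⟨ eq ⟨
      n * (q ∸ 1) ∎)
      where open ≤-Reasoning

  -- `_P′_` is the recursive product on which the inductions run. For t > n both sides are zero, in
  -- `_P′_` because a truncated factor n ∸ n occurs.
  P≡P′ : ∀ n t → n P t ≡ n P′ t
  P≡P′ n t with t ≤? n
  ... | yes t≤n = trans (nPk≡n!/[n∸k]! t≤n) (sym (nP′k≡n!/[n∸k]! t≤n))
  ... | no  t≰n = trans (k>n⇒nPk≡0 (≰⇒> t≰n)) (sym (vanish n t (≰⇒> t≰n)))
    where
    vanish : ∀ n t → n < t → n P′ t ≡ 0
    vanish n (suc t) (s≤s n≤t) = cong (_* (n P′ t)) (m≤n⇒m∸n≡0 n≤t)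

  -- As long as 2t ≤ l, each of the t factors l - i is at least l / 2.
  power≤falling : ∀ {l} t → 2 * t ≤ l → l ^ t ≤ 2 ^ t * (l P′ t)
  power≤falling         zero    _    = ≤-refl
  power≤falling {l}     (suc t) 2t≤l = begin
    l * l ^ t ≤⟨ *-mono-≤ half (power≤falling t 2t≤l′) ⟩
    2 * (l ∸ t) * (2 ^ t * (l P′ t)) ≡⟨ solve 3 (λ d y p → (con 2 :* d) :* (y :* p) := (con 2 :* y) :* (d :* p)) refl (l ∸ t) (2 ^ t) (l P′ t) ⟩
    2 ^ suc t * ((l ∸ t) * (l P′ t)) ∎
    where
    open ≤-Reasoning
    2t≤l′ : 2 * t ≤ l
    2t≤l′ = ≤-trans (*-monoʳ-≤ 2 (n≤1+n t)) 2t≤l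
    half : l ≤ 2 * (l ∸ t)
    half = begin
      l ≡⟨ m+n∸n≡m l l ⟨
      l + l ∸ l ≤⟨ ∸-monoʳ-≤ (l + l) 2t≤l′ ⟩
      l + l ∸ 2 * t ≡⟨ cong (λ x → l + x ∸ 2 * t) (+-identityʳ l) ⟨
      2 * l ∸ 2 * t ≡⟨ *-distribˡ-∸ 2 l t ⟨
      2 * (l ∸ t) ∎

  -- The case t = 2 is the pair inequality with the diagonal removed. Each further factor on the
  -- right is x - i, at least l - i, because M ≠ 0 forces x ≥ l; for M = 0 the left side vanishes.
  falling-superadditive : ∀ {x M l} → x + M * (l * l ∸ l) ≤ x * x → (M ≢ 0 → l ≤ x) →
    ∀ t → 2 ≤ t → M * (l P′ t) ≤ x P′ t
  falling-superadditive _ _ (suc zero) (s≤s ())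
  falling-superadditive {x} {M} {l} pairs l≤x (suc (suc t)) _ = go t
    where
    open ≤-Reasoning
    pair : ∀ n → n P′ 2 ≡ n * n ∸ n
    pair n = trans (cong ((n ∸ 1) *_) (*-identityʳ n)) (trans (*-distribʳ-∸ n n 1) (cong (n * n ∸_) (*-identityˡ n)))
    go : ∀ t → M * (l P′ suc (suc t)) ≤ x P′ suc (suc t)
    go zero    = begin
      M * (l P′ 2) ≡⟨ cong (M *_) (pair l) ⟩
      M * (l * l ∸ l) ≡⟨ m+n∸m≡n x (M * (l * l ∸ l)) ⟨
      x + M * (l * l ∸ l) ∸ x ≤⟨ ∸-monoˡ-≤ x pairs ⟩
      x * x ∸ x ≡⟨ pair x ⟨
      x P′ 2 ∎
    go (suc t) with M ≟ 0
    ... | yes refl = z≤n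
    ... | no  M≢0  = begin
      M * ((l ∸ suc (suc t)) * (l P′ suc (suc t)))
        ≡⟨ solve 3 (λ M d p → M :* (d :* p) := d :* (M :* p)) refl M (l ∸ suc (suc t)) (l P′ suc (suc t)) ⟩
      (l ∸ suc (suc t)) * (M * (l P′ suc (suc t)))
        ≤⟨ *-mono-≤ (∸-monoˡ-≤ (suc (suc t)) (l≤x M≢0)) (go t) ⟩
      (x ∸ suc (suc t)) * (x P′ suc (suc t)) ∎

-- Moments with denominators cleared

module Moments where

  open import Defs
  open Counting
  open SubspaceCounts
  open AlternatingMaps
  open NullCounts
  open FrameBounds
  open import Data.List as List using (length)
  open import Data.Nat
  open import Data.Nat.Combinatorics using (_C_; _P_)
  open import Data.Nat.Combinatorics.Base using (_P′_)
  open import Data.Nat.ListAction using (sum)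
  open import Data.Nat.Properties
  open import Data.Nat.Solver using (module +-*-Solver)
  open import Relation.Binary.PropositionalEquality

  open +-*-Solver using (solve; _:=_; _:+_; _:*_; con)

  -- The geometric sum 1 + q + ... + q^r in Horner form: the quotient L_r as a natural number, and
  -- the number of hyperplanes of an (r+1)-space.
  hyperplanes : ℕ → ℕ → ℕ
  hyperplanes q zero    = 1
  hyperplanes q (suc r) = 1 + q * hyperplanes q r

  module _ {q : ℕ} (1<q : 1 < q) where

    private
      0<q : 0 < q
      0<q = <-trans z<s 1<q

    hyperplanes-number : ∀ r → hyperplanes q r * (q ∸ 1) ≡ q ^ suc r ∸ 1
    hyperplanes-number r = trans (sym (m+n∸n≡m (hyperplanes q r * (q ∸ 1)) 1)) (cong (_∸ 1) (go r))
      where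
      open ≡-Reasoning
      q≡ : q ∸ 1 + 1 ≡ q
      q≡ = m∸n+n≡m 0<q
      go : ∀ r → hyperplanes q r * (q ∸ 1) + 1 ≡ q ^ suc r
      go zero    = trans (cong (_+ 1) (*-identityˡ (q ∸ 1))) (trans q≡ (sym (*-identityʳ q)))
      go (suc r) = begin
        (1 + q * hyperplanes q r) * (q ∸ 1) + 1
          ≡⟨ solve 3 (λ q h e → (con 1 :+ q :* h) :* e :+ con 1 := q :* (h :* e) :+ (e :+ con 1)) refl q (hyperplanes q r) (q ∸ 1) ⟩
        q * (hyperplanes q r * (q ∸ 1)) + (q ∸ 1 + 1)
          ≡⟨ cong (q * (hyperplanes q r * (q ∸ 1)) +_) q≡ ⟩
        q * (hyperplanes q r * (q ∸ 1)) + q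
          ≡⟨ solve 2 (λ q y → q :* y :+ q := q :* (y :+ con 1)) refl q (hyperplanes q r * (q ∸ 1)) ⟩
        q * (hyperplanes q r * (q ∸ 1) + 1)
          ≡⟨ cong (q *_) (go r) ⟩
        q ^ suc (suc r) ∎

  module MomentBounds {q : ℕ} (1<q : 1 < q) (F : FiniteField q) {k r m c : ℕ} (admissible : Admissible k r m c) where

    open Admissible admissible
    open RandomForm F (r + c) k m
    open Subspaces F (r + c) k m
    open NullForms F (r + c) k m

    private
      0<r : 0 < r
      0<r = <-≤-trans z<s (≤-trans 2≤k k≤r)

      0<q^′ : ∀ n → 0 < q ^ n
      0<q^′ = 0<q^ 1<q

    total : ℕ
    total = length forms

    moment : ℕ → ℕ
    moment s = sum (List.map (X s) forms)

    falling-moment : ℕ → ℕ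
    falling-moment t = sum (List.map (λ θ → X r θ P t) forms)

    0<total : 0 < total
    0<total = >-nonZero⁻¹ total {{forms-nonZero}}

    codim≡ : ∀ s → codim s ≡ q ^ (m * (s C k))
    codim≡ s = trans (cong ((q ^ m) ^_) (dim≡C s k)) (^-*-assoc q m (s C k))

    subspaces-lower : ∀ d s → d + s ≡ r + c → (q ^ d) ^ s ≤ length (subspaces s)
    subspaces-lower d s eq = *-cancelʳ-≤′ (frames q s s) (frames-positive 1<q {s} {s} ≤-refl) (begin
      (q ^ d) ^ s * frames q s s ≤⟨ frames-lower 1<q d s s ⟩
      frames q (d + s) s ≡⟨ cong (λ u → frames q u s) eq ⟩
      frames q (r + c) s ≡⟨ length-subspaces s ⟨
      length (subspaces s) * frames q s s ∎)
      where open ≤-Reasoning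

    first-moment≡ : ∀ s → moment s * q ^ (m * (s C k)) ≡ length (subspaces s) * total
    first-moment≡ s = trans (cong (moment s *_) (sym (codim≡ s))) (first-moment s)

    -- The factor `frames q (suc r) (suc r)` is left on the smaller side because its quotient with
    -- q^((r+1)²) is a partial product of C_q, by `partialProduct-frames`.
    moment-above : moment (suc r) * q ^ (m * (suc r C k)) * frames q (suc r) (suc r) < (q ^ (r + c)) ^ suc r * total
    moment-above = begin-strict
      moment (suc r) * q ^ (m * (suc r C k)) * frames q (suc r) (suc r)
        ≡⟨ cong (_* frames q (suc r) (suc r)) (first-moment≡ (suc r)) ⟩
      length (subspaces (suc r)) * total * frames q (suc r) (suc r)
        ≡⟨ solve 3 (λ x y z → (x :* y) :* z := (x :* z) :* y) refl (length (subspaces (suc r))) total (frames q (suc r) (suc r)) ⟩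
      length (subspaces (suc r)) * frames q (suc r) (suc r) * total
        ≡⟨ cong (_* total) (length-subspaces (suc r)) ⟩
      frames q (r + c) (suc r) * total
        <⟨ *-monoˡ-< total {{forms-nonZero}} (frames-upper-< 1<q (r + c) r) ⟩
      (q ^ (r + c)) ^ suc r * total ∎
      where open ≤-Reasoning

    -- Here `c-eq` acts: of q^((r+c) r), the part q^(cr) cancels the reciprocal q^(m C(r,k)) of the
    -- probability, and q^(r²) exceeds the number of bases of an r-space by at most q².
    moment≤q²total : moment r ≤ q ^ 2 * total
    moment≤q²total = *-cancelʳ-≤′ (q ^ (c * r) * frames q r r)
      (*-mono-< (0<q^′ (c * r)) (frames-positive 1<q {r} {r} ≤-refl)) (begin
      moment r * (q ^ (c * r) * frames q r r)
        ≡⟨ *-assoc (moment r) (q ^ (c * r)) (frames q r r) ⟨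
      moment r * q ^ (c * r) * frames q r r
        ≡⟨ cong (λ e → moment r * q ^ e * frames q r r) c-eq ⟩
      moment r * q ^ (m * (r C k)) * frames q r r
        ≡⟨ cong (_* frames q r r) (first-moment≡ r) ⟩
      length (subspaces r) * total * frames q r r
        ≡⟨ solve 3 (λ x y z → (x :* y) :* z := (x :* z) :* y) refl (length (subspaces r)) total (frames q r r) ⟩
      length (subspaces r) * frames q r r * total
        ≡⟨ cong (_* total) (length-subspaces r) ⟩
      frames q (r + c) r * total
        ≤⟨ *-monoˡ-≤ total (frames-upper 1<q (r + c) r) ⟩
      (q ^ (r + c)) ^ r * total
        ≡⟨ cong (_* total) splitPower ⟩
      (q ^ r) ^ r * q ^ (c * r) * total
        ≤⟨ *-monoˡ-≤ total (*-monoˡ-≤ (q ^ (c * r)) (frames-almost-all 1<q r)) ⟩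
      q ^ 2 * frames q r r * q ^ (c * r) * total
        ≡⟨ solve 4 (λ a f y t → ((a :* f) :* y) :* t := (a :* t) :* (y :* f)) refl (q ^ 2) (frames q r r) (q ^ (c * r)) total ⟩
      q ^ 2 * total * (q ^ (c * r) * frames q r r) ∎)
      where
      open ≤-Reasoning
      splitPower : (q ^ (r + c)) ^ r ≡ (q ^ r) ^ r * q ^ (c * r)
      splitPower = begin-equality
        (q ^ (r + c)) ^ r ≡⟨ ^-*-assoc q (r + c) r ⟩
        q ^ ((r + c) * r) ≡⟨ cong (q ^_) (*-distribʳ-+ r r c) ⟩
        q ^ (r * r + c * r) ≡⟨ ^-distribˡ-+-* q (r * r) (c * r) ⟩
        q ^ (r * r) * q ^ (c * r) ≡⟨ cong (_* q ^ (c * r)) (^-*-assoc q r r) ⟨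
        (q ^ r) ^ r * q ^ (c * r) ∎

    0<moment : 0 < moment r
    0<moment = n≢0⇒n>0 λ eq → <⇒≢ (*-mono-< 0<subspaces 0<total)
      (trans (cong (_* q ^ (m * (r C k))) (sym eq)) (first-moment≡ r))
      where
      0<subspaces : 0 < length (subspaces r)
      0<subspaces = <-≤-trans (0<[q^c]^r r) (subspaces-lower c r (+-comm c r))
        where
        0<[q^c]^r : ∀ s → 0 < (q ^ c) ^ s
        0<[q^c]^r s = subst (0 <_) (sym (^-*-assoc q c s)) (0<q^′ (c * s))

    only-hyperplanes : ∀ n → n * frames q r r ≡ frames q (suc r) r → n ≡ hyperplanes q r
    only-hyperplanes n = step r 0<r n
      where
      step : ∀ r → 0 < r → ∀ n → n * frames q r r ≡ frames q (suc r) r → n ≡ hyperplanes q r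
      step (suc r) _ n eq = *-cancelʳ-≡ _ _ (q ∸ 1) {{>-nonZero (m<n⇒0<n∸m 1<q)}}
        (trans (hyperplane-number 1<q r n eq) (sym (hyperplanes-number 1<q (suc r))))

    moment*falling≤ : ∀ t → 2 ≤ t → moment (suc r) * (hyperplanes q r P′ t) ≤ falling-moment t
    moment*falling≤ t 2≤t = begin
      moment (suc r) * (hyperplanes q r P′ t)
        ≡⟨ sum-*ʳ (X (suc r)) (hyperplanes q r P′ t) forms ⟨
      sum (List.map (λ θ → X (suc r) θ * (hyperplanes q r P′ t)) forms)
        ≤⟨ sum-mono _ _ forms (λ {θ} _ → ≤-trans
             (falling-superadditive (null-pairs θ only-hyperplanes) (hyperplanes≤X θ only-hyperplanes) t 2≤t)
             (≤-reflexive (sym (P≡P′ (X r θ) t)))) ⟩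
      falling-moment t ∎
      where open ≤-Reasoning

    -- Makes `pred c` the true codimension of an (r+1)-space in V_N.
    0<c : 0 < c
    0<c = n≢0⇒n>0 λ { refl → <⇒≢ (*-mono-< 1≤m (C-positive r k k≤r)) c-eq }
      where
      C-positive : ∀ n k → k ≤ n → 0 < n C k
      C-positive n k k≤n = subst (0 <_) (dim≡C n k) (dim-positive n k k≤n)
        where
        dim-positive : ∀ n k → k ≤ n → 0 < dim n k
        dim-positive n       zero    _         = z<s
        dim-positive (suc n) (suc k) (s≤s k≤n) = <-≤-trans (dim-positive n k k≤n) (m≤n+m (dim n k) (dim n (suc k)))

    -- The number of (r+1)-spaces is at least q^((r+1)(c-1)), and each null one contributes (L_r)_t.
    -- Replacing (L_r)_t by (L_r / 2)^t loses 2^t ≤ q^t, which is the summand t in the exponent on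
    -- the right.
    falling-moment-below : ∀ t → 2 ≤ t → 2 * t ≤ hyperplanes q r →
      q ^ (suc r * pred c + t * r) * total ≤ falling-moment t * q ^ (m * (suc r C k) + t)
    falling-moment-below t 2≤t 2t≤l = begin
      q ^ (suc r * pred c + t * r) * total
        ≡⟨ cong (_* total) (trans (^-distribˡ-+-* q (suc r * pred c) (t * r)) (cong₂ _*_
             (trans (cong (q ^_) (*-comm (suc r) (pred c))) (sym (^-*-assoc q (pred c) (suc r))))
             (trans (cong (q ^_) (*-comm t r)) (sym (^-*-assoc q r t))))) ⟩
      (q ^ pred c) ^ suc r * (q ^ r) ^ t * total
        ≤⟨ *-monoˡ-≤ total (*-mono-≤ (subspaces-lower (pred c) (suc r) predc+) powers) ⟩
      length (subspaces (suc r)) * (q ^ t * (l P′ t)) * total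
        ≡⟨ solve 4 (λ s x p t → (s :* (x :* p)) :* t := (s :* t) :* (p :* x)) refl (length (subspaces (suc r))) (q ^ t) (l P′ t) total ⟩
      length (subspaces (suc r)) * total * ((l P′ t) * q ^ t)
        ≡⟨ cong (_* ((l P′ t) * q ^ t)) (first-moment≡ (suc r)) ⟨
      moment (suc r) * q ^ (m * (suc r C k)) * ((l P′ t) * q ^ t)
        ≡⟨ solve 4 (λ M e p y → (M :* e) :* (p :* y) := (M :* p) :* (e :* y)) refl (moment (suc r)) (q ^ (m * (suc r C k))) (l P′ t) (q ^ t) ⟩
      moment (suc r) * (l P′ t) * (q ^ (m * (suc r C k)) * q ^ t)
        ≤⟨ *-monoˡ-≤ _ (moment*falling≤ t 2≤t) ⟩
      falling-moment t * (q ^ (m * (suc r C k)) * q ^ t)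
        ≡⟨ cong (falling-moment t *_) (^-distribˡ-+-* q (m * (suc r C k)) t) ⟨
      falling-moment t * q ^ (m * (suc r C k) + t) ∎
      where
      open ≤-Reasoning
      l = hyperplanes q r
      predc+ : pred c + suc r ≡ r + c
      predc+ = trans (+-suc (pred c) r) (trans (cong (_+ r) (suc-pred c {{>-nonZero 0<c}})) (+-comm c r))
      powers : (q ^ r) ^ t ≤ q ^ t * (l P′ t)
      powers = begin
        (q ^ r) ^ t ≤⟨ ^-monoˡ-≤ t (power≤hyperplanes 1<q r l (hyperplanes-number 1<q r)) ⟩
        l ^ t ≤⟨ power≤falling t 2t≤l ⟩
        2 ^ t * (l P′ t) ≤⟨ *-monoˡ-≤ (l P′ t) (^-monoˡ-≤ t 1<q) ⟩
        q ^ t * (l P′ t) ∎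

-- Rational arithmetic and powers of q with rational exponent

module RationalPowers where

  open import Defs
  open import Data.Integer as ℤ using (ℤ; +_; -[1+_]; _⊖_)
  import Data.Integer.Properties as ℤ
  open import Data.Nat as ℕ using (ℕ; zero; suc; NonTrivial)
  import Data.Nat.Properties as ℕ
  open import Data.Product using (∃-syntax; _×_; _,_)
  open import Data.Rational hiding (NonZero)
  open import Data.Rational.Properties
  open import Data.Rational.Solver using (module +-*-Solver)
  open import Data.Rational.Unnormalised as ℚᵘ using (ℚᵘ; mkℚᵘ; *≡*; *<*)
  import Data.Rational.Unnormalised.Properties as ℚᵘ
  open import Data.Sum using (inj₁; inj₂)
  open import Relation.Binary.PropositionalEquality
  open import Relation.Nullary using (yes; no)

  open ℚ using (numerator; denominatorℕ; denominator-1)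
  open +-*-Solver using (solve; _:=_; _:+_; _:*_; _:-_; :-_; con)

  module _ {r : ℚ} (0<r : 0ℚ < r) where

    *-monoˡ-< : ∀ {p q} → p < q → p * r < q * r
    *-monoˡ-< = *-monoˡ-<-pos r {{positive 0<r}}

    *-monoˡ-≤ : ∀ {p q} → p ≤ q → p * r ≤ q * r
    *-monoˡ-≤ = *-monoʳ-≤-nonNeg r {{nonNegative (<⇒≤ 0<r)}}

    *-cancel-< : ∀ {p q} → p * r < q * r → p < q
    *-cancel-< = *-cancelʳ-<-nonNeg r {{nonNegative (<⇒≤ 0<r)}}

    *-cancel-≤ : ∀ {p q} → p * r ≤ q * r → p ≤ q
    *-cancel-≤ = *-cancelʳ-≤-pos r {{positive 0<r}}

    *-cancel-≡ : ∀ {p q} → p * r ≡ q * r → p ≡ q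
    *-cancel-≡ eq = ≤-antisym (*-cancel-≤ (≤-reflexive eq)) (*-cancel-≤ (≤-reflexive (sym eq)))

  0<* : ∀ {p q} → 0ℚ < p → 0ℚ < q → 0ℚ < p * q
  0<* {p} {q} 0<p 0<q = subst (_< p * q) (*-zeroˡ q) (*-monoˡ-< 0<q 0<p)

  *-mono-≤ : ∀ {a b c d} → 0ℚ ≤ a → a ≤ b → 0ℚ ≤ c → c ≤ d → a * c ≤ b * d
  *-mono-≤ {a} {b} {c} {d} 0≤a a≤b 0≤c c≤d = ≤-trans
    (*-monoʳ-≤-nonNeg c {{nonNegative 0≤c}} a≤b)
    (*-monoˡ-≤-nonNeg b {{nonNegative (≤-trans 0≤a a≤b)}} c≤d)

  0≤* : ∀ {p q} → 0ℚ ≤ p → 0ℚ ≤ q → 0ℚ ≤ p * q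
  0≤* {p} {q} 0≤p 0≤q = *-mono-≤ ≤-refl 0≤p ≤-refl 0≤q

  fromℤ : ℤ → ℚ
  fromℤ z = z / 1

  private
    toℚᵘ-/ : ∀ z d → toℚᵘ (z / suc d) ℚᵘ.≃ mkℚᵘ z d
    toℚᵘ-/ z d = toℚᵘ-fromℚᵘ (mkℚᵘ z d)

  fromℤ-+ : ∀ x y → fromℤ (x ℤ.+ y) ≡ fromℤ x + fromℤ y
  fromℤ-+ x y = toℚᵘ-injective (ℚᵘ.≃-trans (toℚᵘ-/ (x ℤ.+ y) 0) (ℚᵘ.≃-trans
    (*≡* (cong (ℤ._* + 1) (cong₂ ℤ._+_ (sym (ℤ.*-identityʳ x)) (sym (ℤ.*-identityʳ y)))))
    (ℚᵘ.≃-sym (ℚᵘ.≃-trans (toℚᵘ-homo-+ (fromℤ x) (fromℤ y)) (ℚᵘ.+-cong (toℚᵘ-/ x 0) (toℚᵘ-/ y 0))))))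

  fromℤ-* : ∀ x y → fromℤ (x ℤ.* y) ≡ fromℤ x * fromℤ y
  fromℤ-* x y = toℚᵘ-injective (ℚᵘ.≃-trans (toℚᵘ-/ (x ℤ.* y) 0)
    (ℚᵘ.≃-sym (ℚᵘ.≃-trans (toℚᵘ-homo-* (fromℤ x) (fromℤ y)) (ℚᵘ.*-cong (toℚᵘ-/ x 0) (toℚᵘ-/ y 0)))))

  fromℤ-neg : ∀ x → fromℤ (ℤ.- x) ≡ - fromℤ x
  fromℤ-neg x = toℚᵘ-injective (ℚᵘ.≃-trans (toℚᵘ-/ (ℤ.- x) 0)
    (ℚᵘ.≃-sym (ℚᵘ.≃-trans (toℚᵘ-homo‿- (fromℤ x)) (ℚᵘ.-‿cong (toℚᵘ-/ x 0)))))

  fromℤ-mono-< : ∀ {x y} → x ℤ.< y → fromℤ x < fromℤ y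
  fromℤ-mono-< {x} {y} x<y = toℚᵘ-cancel-< (ℚᵘ.<-respˡ-≃ (ℚᵘ.≃-sym (toℚᵘ-/ x 0))
    (ℚᵘ.<-respʳ-≃ (ℚᵘ.≃-sym (toℚᵘ-/ y 0)) (*<* (ℤ.*-monoʳ-<-pos (+ 1) x<y))))

  fromℤ-mono-≤ : ∀ {x y} → x ℤ.≤ y → fromℤ x ≤ fromℤ y
  fromℤ-mono-≤ {x} {y} x≤y with x ℤ.≟ y
  ... | yes refl = ≤-refl
  ... | no  x≢y  = <⇒≤ (fromℤ-mono-< (ℤ.≤∧≢⇒< x≤y x≢y))

  fromℤ-cancel-< : ∀ {x y} → fromℤ x < fromℤ y → x ℤ.< y
  fromℤ-cancel-< {x} {y} lt = ℤ.≰⇒> λ y≤x → <⇒≱ lt (fromℤ-mono-≤ y≤x)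
    where
    <⇒≱ : ∀ {p q} → p < q → q ≤ p → _
    <⇒≱ p<q q≤p = <-irrefl refl (<-≤-trans p<q q≤p)

  fromℤ-cancel-≤ : ∀ {x y} → fromℤ x ≤ fromℤ y → x ℤ.≤ y
  fromℤ-cancel-≤ {x} {y} le = ℤ.≮⇒≥ λ y<x → <-irrefl refl (<-≤-trans (fromℤ-mono-< y<x) le)

  ι-+ : ∀ a b → ι (a ℕ.+ b) ≡ ι a + ι b
  ι-+ a b = fromℤ-+ (+ a) (+ b)

  ι-* : ∀ a b → ι (a ℕ.* b) ≡ ι a * ι b
  ι-* a b = trans (cong fromℤ (ℤ.pos-* a b)) (fromℤ-* (+ a) (+ b))

  ι-mono-≤ : ∀ {a b} → a ℕ.≤ b → ι a ≤ ι b
  ι-mono-≤ a≤b = fromℤ-mono-≤ (ℤ.+≤+ a≤b)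

  ι-mono-< : ∀ {a b} → a ℕ.< b → ι a < ι b
  ι-mono-< a<b = fromℤ-mono-< (ℤ.+<+ a<b)

  ι-cancel-≤ : ∀ {a b} → ι a ≤ ι b → a ℕ.≤ b
  ι-cancel-≤ le = ℤ.drop‿+≤+ (fromℤ-cancel-≤ le)

  0<ι : ∀ {a} → 0 ℕ.< a → 0ℚ < ι a
  0<ι = ι-mono-<

  0≤ι : ∀ a → 0ℚ ≤ ι a
  0≤ι a = ι-mono-≤ {0} {a} ℕ.z≤n

  /-*-cancel : ∀ z n .{{_ : ℕ.NonZero n}} → (z / n) * ι n ≡ fromℤ z
  /-*-cancel z (suc d) = toℚᵘ-injective (ℚᵘ.≃-trans
    (ℚᵘ.≃-trans (toℚᵘ-homo-* (z / suc d) (ι (suc d))) (ℚᵘ.*-cong (toℚᵘ-/ z d) (toℚᵘ-/ (+ suc d) 0)))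
    (ℚᵘ.≃-trans (*≡* (trans (ℤ.*-identityʳ _) (cong (λ e → z ℤ.* (+ suc e)) (sym (ℕ.*-identityʳ d)))))
      (ℚᵘ.≃-sym (toℚᵘ-/ z 0))))

  numerator-denominator : ∀ p → p * ι (denominatorℕ p) ≡ fromℤ (numerator p)
  numerator-denominator p = trans (cong (_* ι (denominatorℕ p)) (sym (↥p/↧p≡p p)))
    (/-*-cancel (numerator p) (denominatorℕ p))

  0<denominator : ∀ p → 0ℚ < ι (denominatorℕ p)
  0<denominator p = 0<ι (ℕ.z<s {denominator-1 p})

  abstract

    archimedean : ∀ p → ∃[ n ] p ≤ ι n
    archimedean p = ℤ.∣ numerator p ∣ , *-cancel-≤ (0<denominator p) (begin
      p * ι (denominatorℕ p) ≡⟨ numerator-denominator p ⟩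
      fromℤ (numerator p) ≤⟨ fromℤ-mono-≤ (i≤∣i∣ (numerator p)) ⟩
      ι ℤ.∣ numerator p ∣ ≤⟨ ι-mono-≤ (ℕ.m≤m*n ℤ.∣ numerator p ∣ (denominatorℕ p)) ⟩
      ι (ℤ.∣ numerator p ∣ ℕ.* denominatorℕ p) ≡⟨ ι-* ℤ.∣ numerator p ∣ (denominatorℕ p) ⟩
      ι ℤ.∣ numerator p ∣ * ι (denominatorℕ p) ∎)
      where
      open ≤-Reasoning
      i≤∣i∣ : ∀ i → i ℤ.≤ + ℤ.∣ i ∣
      i≤∣i∣ (+ n)    = ℤ.≤-refl
      i≤∣i∣ -[1+ n ] = ℤ.-≤+

    -- A positive δ is at least the reciprocal of its denominator, so n times that denominator is
    -- enough when p ≤ n.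
    archimedean-* : ∀ p {δ} → 0ℚ < δ → ∃[ n ] p ≤ ι n * δ
    archimedean-* p {δ} 0<δ = let n , p≤n = archimedean p in n ℕ.* denominatorℕ δ , (begin
      p ≤⟨ p≤n ⟩
      ι n ≡⟨ *-identityʳ (ι n) ⟨
      ι n * 1ℚ ≤⟨ *-mono-≤ (0≤ι n) ≤-refl (0≤ι 1) (fromℤ-mono-≤ 1≤numerator) ⟩
      ι n * fromℤ (numerator δ) ≡⟨ cong (ι n *_) (numerator-denominator δ) ⟨
      ι n * (δ * ι (denominatorℕ δ)) ≡⟨ solve 3 (λ n δ d → n :* (δ :* d) := (n :* d) :* δ) refl (ι n) δ (ι (denominatorℕ δ)) ⟩
      ι n * ι (denominatorℕ δ) * δ ≡⟨ cong (_* δ) (ι-* n (denominatorℕ δ)) ⟨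
      ι (n ℕ.* denominatorℕ δ) * δ ∎)
      where
      open ≤-Reasoning
      1≤numerator : + 1 ℤ.≤ numerator δ
      1≤numerator = ℤ.i<j⇒suc[i]≤j {+ 0} (fromℤ-cancel-< {+ 0} {numerator δ} (subst₂ _<_ (*-zeroˡ (ι (denominatorℕ δ))) (numerator-denominator δ)
        (*-monoˡ-< (0<denominator δ) 0<δ)))

  ^-positive : ∀ {p} → 0ℚ < p → ∀ n → 0ℚ < p ^ℚ n
  ^-positive 0<p zero    = 0<ι {1} ℕ.z<s
  ^-positive 0<p (suc n) = 0<* 0<p (^-positive 0<p n)

  ^-nonNegative : ∀ {p} → 0ℚ ≤ p → ∀ n → 0ℚ ≤ p ^ℚ n
  ^-nonNegative 0≤p zero    = 0≤ι 1
  ^-nonNegative 0≤p (suc n) = 0≤* 0≤p (^-nonNegative 0≤p n)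

  ^-mono-≤ : ∀ {p q} → 0ℚ ≤ p → p ≤ q → ∀ n → p ^ℚ n ≤ q ^ℚ n
  ^-mono-≤ 0≤p p≤q zero    = ≤-refl
  ^-mono-≤ 0≤p p≤q (suc n) = *-mono-≤ 0≤p p≤q (^-nonNegative 0≤p n) (^-mono-≤ 0≤p p≤q n)

  ^-mono-< : ∀ {p q} → 0ℚ ≤ p → p < q → ∀ n → p ^ℚ suc n < q ^ℚ suc n
  ^-mono-< {p} {q} 0≤p p<q n = <-≤-trans′ (*-monoˡ-< (^-positive (≤-<-trans 0≤p p<q) n) p<q)
    where
    <-≤-trans′ : p * q ^ℚ n < q * q ^ℚ n → p ^ℚ suc n < q ^ℚ suc n
    <-≤-trans′ = ≤-<-trans (*-mono-≤ 0≤p ≤-refl (^-nonNegative 0≤p n) (^-mono-≤ 0≤p (<⇒≤ p<q) n))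

  ^-+ : ∀ p m n → p ^ℚ (m ℕ.+ n) ≡ p ^ℚ m * p ^ℚ n
  ^-+ p zero    n = sym (*-identityˡ (p ^ℚ n))
  ^-+ p (suc m) n = trans (cong (p *_) (^-+ p m n)) (sym (*-assoc p (p ^ℚ m) (p ^ℚ n)))

  ^-* : ∀ p m n → p ^ℚ (m ℕ.* n) ≡ (p ^ℚ n) ^ℚ m
  ^-* p zero    n = refl
  ^-* p (suc m) n = trans (^-+ p n (m ℕ.* n)) (cong (p ^ℚ n *_) (^-* p m n))

  -- With integers written as differences, `^ℤ-⊖` clears the denominator q^b and the laws of integer
  -- powers reduce to those of natural powers.
  ⊖-surjective : ∀ z → ∃[ a ] ∃[ b ] z ≡ a ⊖ b
  ⊖-surjective (+ n)    = n , 0 , refl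
  ⊖-surjective -[1+ n ] = 0 , suc n , refl

  module _ (q : ℕ) .{{nt : NonTrivial q}} where

    1<q : 1 ℕ.< q
    1<q = ℕ.nonTrivial⇒n>1 q

    0<ι^ : ∀ n → 0ℚ < ι (q ℕ.^ n)
    0<ι^ n = 0<ι (ℕ.>-nonZero⁻¹ (q ℕ.^ n) {{nonTrivial⇒pow-nonZero q n}})

    ι^-+ : ∀ m n → ι (q ℕ.^ (m ℕ.+ n)) ≡ ι (q ℕ.^ m) * ι (q ℕ.^ n)
    ι^-+ m n = trans (cong ι (ℕ.^-distribˡ-+-* q m n)) (ι-* (q ℕ.^ m) (q ℕ.^ n))

    ^ℤ-⊖ : ∀ a b → q ^ℤ (a ⊖ b) * ι (q ℕ.^ b) ≡ ι (q ℕ.^ a)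
    ^ℤ-⊖ a       zero    = *-identityʳ (ι (q ℕ.^ a))
    ^ℤ-⊖ zero    (suc b) = /-*-cancel (+ 1) (q ℕ.^ suc b) {{nonTrivial⇒pow-nonZero q (suc b)}}
    ^ℤ-⊖ (suc a) (suc b) = begin
      q ^ℤ (suc a ⊖ suc b) * ι (q ℕ.* q ℕ.^ b) ≡⟨ cong₂ (λ z x → q ^ℤ z * x) (ℤ.[1+m]⊖[1+n]≡m⊖n a b) (ι-* q (q ℕ.^ b)) ⟩
      q ^ℤ (a ⊖ b) * (ι q * ι (q ℕ.^ b)) ≡⟨ solve 3 (λ x y z → x :* (y :* z) := y :* (x :* z)) refl (q ^ℤ (a ⊖ b)) (ι q) (ι (q ℕ.^ b)) ⟩
      ι q * (q ^ℤ (a ⊖ b) * ι (q ℕ.^ b)) ≡⟨ cong (ι q *_) (^ℤ-⊖ a b) ⟩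
      ι q * ι (q ℕ.^ a) ≡⟨ ι-* q (q ℕ.^ a) ⟨
      ι (q ℕ.* q ℕ.^ a) ∎
      where open ≡-Reasoning

    ^ℤ-+ : ∀ x y → q ^ℤ (x ℤ.+ y) ≡ q ^ℤ x * q ^ℤ y
    ^ℤ-+ x y with ⊖-surjective x | ⊖-surjective y
    ... | a , b , refl | c , d , refl = *-cancel-≡ (0<ι^ (b ℕ.+ d)) (begin
      q ^ℤ ((a ⊖ b) ℤ.+ (c ⊖ d)) * ι (q ℕ.^ (b ℕ.+ d)) ≡⟨ cong (λ z → q ^ℤ z * ι (q ℕ.^ (b ℕ.+ d))) ⊖-+-⊖ ⟩
      q ^ℤ ((a ℕ.+ c) ⊖ (b ℕ.+ d)) * ι (q ℕ.^ (b ℕ.+ d)) ≡⟨ ^ℤ-⊖ (a ℕ.+ c) (b ℕ.+ d) ⟩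
      ι (q ℕ.^ (a ℕ.+ c)) ≡⟨ ι^-+ a c ⟩
      ι (q ℕ.^ a) * ι (q ℕ.^ c) ≡⟨ cong₂ _*_ (^ℤ-⊖ a b) (^ℤ-⊖ c d) ⟨
      q ^ℤ (a ⊖ b) * ι (q ℕ.^ b) * (q ^ℤ (c ⊖ d) * ι (q ℕ.^ d))
        ≡⟨ solve 4 (λ x b y d → (x :* b) :* (y :* d) := (x :* y) :* (b :* d)) refl
             (q ^ℤ (a ⊖ b)) (ι (q ℕ.^ b)) (q ^ℤ (c ⊖ d)) (ι (q ℕ.^ d)) ⟩
      q ^ℤ (a ⊖ b) * q ^ℤ (c ⊖ d) * (ι (q ℕ.^ b) * ι (q ℕ.^ d))
        ≡⟨ cong (q ^ℤ (a ⊖ b) * q ^ℤ (c ⊖ d) *_) (ι^-+ b d) ⟨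
      q ^ℤ (a ⊖ b) * q ^ℤ (c ⊖ d) * ι (q ℕ.^ (b ℕ.+ d)) ∎)
      where
      open ≡-Reasoning
      ⊖-+-⊖ : (a ⊖ b) ℤ.+ (c ⊖ d) ≡ (a ℕ.+ c) ⊖ (b ℕ.+ d)
      ⊖-+-⊖ = begin
        (a ⊖ b) ℤ.+ (c ⊖ d) ≡⟨ cong₂ ℤ._+_ (ℤ.m-n≡m⊖n a b) (ℤ.m-n≡m⊖n c d) ⟨
        (+ a ℤ.+ (ℤ.- + b)) ℤ.+ (+ c ℤ.+ (ℤ.- + d))
          ≡⟨ solve-ℤ (+ a) (ℤ.- + b) (+ c) (ℤ.- + d) ⟩
        (+ a ℤ.+ + c) ℤ.+ ((ℤ.- + b) ℤ.+ (ℤ.- + d)) ≡⟨ cong (λ z → (+ a ℤ.+ + c) ℤ.+ z) (ℤ.neg-distrib-+ (+ b) (+ d)) ⟨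
        + (a ℕ.+ c) ℤ.+ (ℤ.- + (b ℕ.+ d)) ≡⟨ ℤ.m-n≡m⊖n (a ℕ.+ c) (b ℕ.+ d) ⟩
        (a ℕ.+ c) ⊖ (b ℕ.+ d) ∎
        where
        open import Algebra.Properties.CommutativeSemigroup ℤ.+-commutativeSemigroup using (interchange)
        solve-ℤ = interchange

    ^ℤ-positive : ∀ z → 0ℚ < q ^ℤ z
    ^ℤ-positive z with ⊖-surjective z
    ... | a , b , refl = *-cancel-< (0<ι^ b) (subst₂ _<_ (sym (*-zeroˡ (ι (q ℕ.^ b)))) (sym (^ℤ-⊖ a b)) (0<ι^ a))

    ^ℤ-mono-≤ : ∀ {x y} → x ℤ.≤ y → q ^ℤ x ≤ q ^ℤ y
    ^ℤ-mono-≤ {x} {y} x≤y = begin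
      q ^ℤ x ≡⟨ *-identityʳ (q ^ℤ x) ⟨
      q ^ℤ x * 1ℚ ≤⟨ *-mono-≤ (<⇒≤ (^ℤ-positive x)) ≤-refl (0≤ι 1) (1≤^ (y ℤ.- x) (ℤ.i≤j⇒0≤j-i x≤y)) ⟩
      q ^ℤ x * q ^ℤ (y ℤ.- x) ≡⟨ ^ℤ-+ x (y ℤ.- x) ⟨
      q ^ℤ (x ℤ.+ (y ℤ.- x)) ≡⟨ cong (q ^ℤ_) x+[y-x]≡y ⟩
      q ^ℤ y ∎
      where
      open ≤-Reasoning
      1≤^ : ∀ z → ℤ.0ℤ ℤ.≤ z → 1ℚ ≤ q ^ℤ z
      1≤^ (+ n) _ = ι-mono-≤ (ℕ.>-nonZero⁻¹ (q ℕ.^ n) {{nonTrivial⇒pow-nonZero q n}})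
      x+[y-x]≡y : x ℤ.+ (y ℤ.- x) ≡ y
      x+[y-x]≡y = trans (ℤ.+-comm x (y ℤ.- x)) (trans (ℤ.+-assoc y (ℤ.- x) x)
        (trans (cong (λ z → y ℤ.+ z) (ℤ.+-inverseˡ x)) (ℤ.+-identityʳ y)))

    ^ℤ-suc : ∀ z → q ^ℤ (+ 1 ℤ.+ z) ≡ ι q * q ^ℤ z
    ^ℤ-suc z = trans (^ℤ-+ (+ 1) z) (cong (λ n → ι n * q ^ℤ z) (ℕ.*-identityʳ q))

    ^ℤ-mono-< : ∀ {x y} → x ℤ.< y → q ^ℤ x < q ^ℤ y
    ^ℤ-mono-< {x} {y} x<y = begin-strict
      q ^ℤ x ≡⟨ *-identityˡ (q ^ℤ x) ⟨
      1ℚ * q ^ℤ x <⟨ *-monoˡ-< (^ℤ-positive x) (ι-mono-< 1<q) ⟩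
      ι q * q ^ℤ x ≡⟨ ^ℤ-suc x ⟨
      q ^ℤ (+ 1 ℤ.+ x) ≤⟨ ^ℤ-mono-≤ (ℤ.i<j⇒suc[i]≤j x<y) ⟩
      q ^ℤ y ∎
      where open ≤-Reasoning

    ^ℤ-* : ∀ z n → q ^ℤ (z ℤ.* + n) ≡ (q ^ℤ z) ^ℚ n
    ^ℤ-* z zero    = cong (q ^ℤ_) (ℤ.*-zeroʳ z)
    ^ℤ-* z (suc n) = trans (cong (q ^ℤ_) (ℤ.*-suc z (+ n)))
      (trans (^ℤ-+ z (z ℤ.* + n)) (cong (q ^ℤ z *_) (^ℤ-* z n)))

    private
      scale : ∀ s z → fromℤ z * ι (denominatorℕ s) ≡ fromℤ (z ℤ.* + denominatorℕ s)
      scale s z = sym (fromℤ-* z (+ denominatorℕ s))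

    -- Multiplied by the denominator of `s`, the comparison of `s` with `z` becomes one of integers;
    -- raising to that denominator turns it into a comparison of powers.
    log-lower : ∀ {E z} → q ^ℤ z ≤ E → ∀ {s} → s < fromℤ z → [ q ^ s ]< E
    log-lower {E} {z} q^z≤E {s} s<z = begin-strict
      q ^ℤ numerator s <⟨ ^ℤ-mono-< (fromℤ-cancel-< {numerator s} {z ℤ.* + denominatorℕ s} (subst₂ _<_ (numerator-denominator s) (scale s z) (*-monoˡ-< (0<denominator s) s<z))) ⟩
      q ^ℤ (z ℤ.* + denominatorℕ s) ≡⟨ ^ℤ-* z (denominatorℕ s) ⟩
      (q ^ℤ z) ^ℚ denominatorℕ s ≤⟨ ^-mono-≤ (<⇒≤ (^ℤ-positive z)) q^z≤E (denominatorℕ s) ⟩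
      E ^ℚ denominatorℕ s ∎
      where open ≤-Reasoning

    power-below : ∀ {E z} → q ^ℤ z ≤ E → ∀ {s} → s ≤ fromℤ z → ∀ {p} → p <[ q ^ s ] → p < E
    power-below {E} {z} q^z≤E {s} s≤z (inj₁ p≤0) = ≤-<-trans p≤0 (<-≤-trans (^ℤ-positive z) q^z≤E)
    power-below {E} {z} q^z≤E {s} s≤z {p} (inj₂ p^d<) = ≰⇒> λ E≤p → <-irrefl refl (begin-strict
      q ^ℤ numerator s ≤⟨ ^ℤ-mono-≤ (fromℤ-cancel-≤ {numerator s} {z ℤ.* + denominatorℕ s} (subst₂ _≤_ (numerator-denominator s) (scale s z) (*-monoˡ-≤ (0<denominator s) s≤z))) ⟩
      q ^ℤ (z ℤ.* + denominatorℕ s) ≡⟨ ^ℤ-* z (denominatorℕ s) ⟩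
      (q ^ℤ z) ^ℚ denominatorℕ s ≤⟨ ^-mono-≤ (<⇒≤ (^ℤ-positive z)) (≤-trans q^z≤E E≤p) (denominatorℕ s) ⟩
      p ^ℚ denominatorℕ s <⟨ p^d< ⟩
      q ^ℤ numerator s ∎)
      where open ≤-Reasoning

  abstract

    -- With x = y + δ, induction on n gives xⁿ y ≥ yⁿ (y + n δ).
    bernoulli : ∀ {x y} → 0ℚ < y → y < x → ∀ c → ∃[ n ] c * y ^ℚ suc n < x ^ℚ suc n
    bernoulli {x} {y} 0<y y<x c =
      let n , cy≤nδ = archimedean-* (c * y) 0<δ in
      n , *-cancel-< 0<y (begin-strict
        c * y ^ℚ suc n * y ≡⟨ solve 3 (λ c p y → (c :* p) :* y := (c :* y) :* p) refl c (y ^ℚ suc n) y ⟩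
        c * y * y ^ℚ suc n ≤⟨ *-monoˡ-≤ (^-positive 0<y (suc n)) cy≤nδ ⟩
        ι n * δ * y ^ℚ suc n <⟨ *-monoˡ-< (^-positive 0<y (suc n)) (nδ<y+[1+n]δ n) ⟩
        (y + ι (suc n) * δ) * y ^ℚ suc n ≤⟨ growth (suc n) ⟩
        x ^ℚ suc n * y ∎)
      where
      open ≤-Reasoning
      δ : ℚ
      δ = x - y
      0<δ : 0ℚ < δ
      0<δ = subst (_< δ) (+-inverseʳ y) (+-monoˡ-< (- y) y<x)
      ι-suc : ∀ n → ι (suc n) ≡ 1ℚ + ι n
      ι-suc n = ι-+ 1 n
      nδ<y+[1+n]δ : ∀ n → ι n * δ < y + ι (suc n) * δ
      nδ<y+[1+n]δ n = begin-strict
        ι n * δ ≡⟨ +-identityˡ (ι n * δ) ⟨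
        0ℚ + ι n * δ <⟨ +-mono-<-≤ 0<y (*-monoˡ-≤ 0<δ (ι-mono-≤ (ℕ.n≤1+n n))) ⟩
        y + ι (suc n) * δ ∎
      x≡y+δ : x ≡ y + δ
      x≡y+δ = solve 2 (λ x y → x := y :+ (x :- y)) refl x y
      growth : ∀ n → (y + ι n * δ) * y ^ℚ n ≤ x ^ℚ n * y
      growth zero    = ≤-reflexive (trans (*-identityʳ _) (trans (cong (λ z → y + z) (*-zeroˡ δ))
        (trans (+-identityʳ y) (sym (*-identityˡ y)))))
      growth (suc n) = begin
        (y + ι (suc n) * δ) * (y * y ^ℚ n)
          ≡⟨ cong (λ i → (y + i * δ) * (y * y ^ℚ n)) (ι-suc n) ⟩
        (y + (1ℚ + ι n) * δ) * (y * y ^ℚ n)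
          ≡⟨ solve 4 (λ y i δ p → (y :+ (con 1ℚ :+ i) :* δ) :* (y :* p) :=
               (y :+ i :* δ) :* p :* y :+ y :* p :* δ) refl y (ι n) δ (y ^ℚ n) ⟩
        (y + ι n * δ) * y ^ℚ n * y + y * y ^ℚ n * δ
          ≤⟨ +-monoʳ-≤ ((y + ι n * δ) * y ^ℚ n * y) (*-monoˡ-≤ 0<δ (*-monoˡ-≤ (^-positive 0<y n) y≤y+nδ)) ⟩
        (y + ι n * δ) * y ^ℚ n * y + (y + ι n * δ) * y ^ℚ n * δ
          ≡⟨ *-distribˡ-+ ((y + ι n * δ) * y ^ℚ n) y δ ⟨
        (y + ι n * δ) * y ^ℚ n * (y + δ)
          ≡⟨ cong ((y + ι n * δ) * y ^ℚ n *_) x≡y+δ ⟨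
        (y + ι n * δ) * y ^ℚ n * x
          ≤⟨ *-monoˡ-≤ (<-trans 0<y y<x) (growth n) ⟩
        x ^ℚ n * y * x
          ≡⟨ solve 3 (λ x p y → p :* y :* x := x :* p :* y) refl x (x ^ℚ n) y ⟩
        x * x ^ℚ n * y ∎
        where
        y≤y+nδ : y ≤ y + ι n * δ
        y≤y+nδ = subst (_≤ y + ι n * δ) (+-identityʳ y) (+-monoʳ-≤ y (0≤* (0≤ι n) (<⇒≤ 0<δ)))

  module _ (q : ℕ) .{{nt : NonTrivial q}} where

    -- The order `_<[_^_]` is defined by the reduced numerator and denominator of `s`, while `s`
    -- arises as i / (n+1), possibly not reduced. Raising to the power n + 1 on one side and to the
    -- denominator on the other makes the two exponents agree.
    root-below : ∀ {b s i n} → 0ℚ < b → s * ι (suc n) ≡ fromℤ i → b ^ℚ suc n < q ^ℤ i → b <[ q ^ s ]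
    root-below {b} {s} {i} {n} 0<b s*n≡i b^n< = inj₂ (≰⇒> λ le → <-irrefl refl (contradicts le))
      where
      open ≤-Reasoning
      d = denominatorℕ s
      a = numerator s
      a*n≡i*d : a ℤ.* + suc n ≡ i ℤ.* + d
      a*n≡i*d = ℤ.≤-antisym
        (fromℤ-cancel-≤ {a ℤ.* + suc n} {i ℤ.* + d} (≤-reflexive eq))
        (fromℤ-cancel-≤ {i ℤ.* + d} {a ℤ.* + suc n} (≤-reflexive (sym eq)))
        where
        eq : fromℤ (a ℤ.* + suc n) ≡ fromℤ (i ℤ.* + d)
        eq = begin-equality
          fromℤ (a ℤ.* + suc n) ≡⟨ fromℤ-* a (+ suc n) ⟩
          fromℤ a * ι (suc n) ≡⟨ cong (_* ι (suc n)) (numerator-denominator s) ⟨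
          s * ι d * ι (suc n) ≡⟨ solve 3 (λ s d n → s :* d :* n := s :* n :* d) refl s (ι d) (ι (suc n)) ⟩
          s * ι (suc n) * ι d ≡⟨ cong (_* ι d) s*n≡i ⟩
          fromℤ i * ι d ≡⟨ fromℤ-* i (+ d) ⟨
          fromℤ (i ℤ.* + d) ∎
      contradicts : q ^ℤ a ≤ b ^ℚ d → q ^ℤ (i ℤ.* + d) < q ^ℤ (i ℤ.* + d)
      contradicts le = begin-strict
        q ^ℤ (i ℤ.* + d) ≡⟨ cong (q ^ℤ_) a*n≡i*d ⟨
        q ^ℤ (a ℤ.* + suc n) ≡⟨ ^ℤ-* q a (suc n) ⟩
        (q ^ℤ a) ^ℚ suc n ≤⟨ ^-mono-≤ (<⇒≤ (^ℤ-positive q a)) le (suc n) ⟩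
        (b ^ℚ d) ^ℚ suc n ≡⟨ ^-* b (suc n) d ⟨
        b ^ℚ (suc n ℕ.* d) ≡⟨ cong (b ^ℚ_) (ℕ.*-comm (suc n) d) ⟩
        b ^ℚ (d ℕ.* suc n) ≡⟨ ^-* b d (suc n) ⟩
        (b ^ℚ suc n) ^ℚ d <⟨ ^-mono-< (<⇒≤ (^-positive 0<b (suc n))) b^n< (denominator-1 s) ⟩
        (q ^ℤ i) ^ℚ d ≡⟨ ^ℤ-* q i d ⟨
        q ^ℤ (i ℤ.* + d) ∎

    root-exponent : ∀ {b z} i n → 0ℚ < b → ι q * b ^ℚ suc n < (q ^ℤ z) ^ℚ suc n → + 1 ℤ.+ i ≡ z ℤ.* + suc n →
      ∀ s → s * ι (suc n) ≡ fromℤ i → s < fromℤ z × b <[ q ^ s ]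
    root-exponent {b} {z} i n 0<b lt suc-i s s*n≡i = s<z , root-below {b} {s} {i} {n} 0<b s*n≡i b^n<
      where
      open ≤-Reasoning
      s<z : s < fromℤ z
      s<z = *-cancel-< (0<ι {suc n} ℕ.z<s) (begin-strict
        s * ι (suc n) ≡⟨ s*n≡i ⟩
        fromℤ i <⟨ fromℤ-mono-< {i} {z ℤ.* + suc n} (ℤ.suc[i]≤j⇒i<j {i} {z ℤ.* + suc n} (ℤ.≤-reflexive suc-i)) ⟩
        fromℤ (z ℤ.* + suc n) ≡⟨ fromℤ-* z (+ suc n) ⟩
        fromℤ z * ι (suc n) ∎)
      b^n< : b ^ℚ suc n < q ^ℤ i
      b^n< = *-cancel-< (0<ι {q} (ℕ.<-trans ℕ.z<s (1<q q))) (begin-strict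
        b ^ℚ suc n * ι q ≡⟨ *-comm (b ^ℚ suc n) (ι q) ⟩
        ι q * b ^ℚ suc n <⟨ lt ⟩
        (q ^ℤ z) ^ℚ suc n ≡⟨ ^ℤ-* q z (suc n) ⟨
        q ^ℤ (z ℤ.* + suc n) ≡⟨ cong (q ^ℤ_) suc-i ⟨
        q ^ℤ (+ 1 ℤ.+ i) ≡⟨ ^ℤ-suc q i ⟩
        ι q * q ^ℤ i ≡⟨ *-comm (ι q) (q ^ℤ i) ⟩
        q ^ℤ i * ι q ∎)

    abstract

      -- The supremum q^z is approached by rational exponents. The witness is s = z - 1/(n+1): b <
      -- q^s means q b^(n+1) < (q^z)^(n+1), and `bernoulli` provides such an n because the ratio q^z
      -- / b exceeds 1.
      power-above : ∀ {b z} → 0ℚ < b → b < q ^ℤ z → ∃[ s ] s < fromℤ z × b <[ q ^ s ]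
      power-above {b} {z} 0<b b<q^z =
        let n , lt = bernoulli 0<b b<q^z (ι q)
            i , suc-i = predecessor (z ℤ.* + suc n)
            s , s*n≡i = quotient i n
        in s , root-exponent {z = z} i n 0<b lt suc-i s s*n≡i
        where
        predecessor : ∀ x → ∃[ i ] + 1 ℤ.+ i ≡ x
        predecessor x = ℤ.pred x , ℤ.suc-pred x
        quotient : ∀ i n → ∃[ s ] s * ι (suc n) ≡ fromℤ i
        quotient i n = i / suc n , /-*-cancel i (suc n)

-- Binomial identities and inequalities behind the exponents

module Exponents where

  open import Data.Nat
  open import Data.Nat.Combinatorics using (_C_; nCk≡nPk/k!; nCk+nC[k+1]≡[n+1]C[k+1]; nC1≡n)
  open import Data.Nat.Combinatorics.Base using (_P′_)
  open import Data.Nat.Combinatorics.Specification using (k!∣nP′k; nP′k≡n[n∸1P′k∸1])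
  open import Data.Nat.DivMod using (m/n*n≡m)
  open import Data.Nat.Properties
  open import Data.Nat.Solver using (module +-*-Solver)
  open import Relation.Binary.PropositionalEquality
  open FrameBounds using (P≡P′; *-cancelʳ-≤′)

  open +-*-Solver using (solve; _:=_; _:+_; _:*_; con)

  C*k!≡P′ : ∀ {n k} → k ≤ n → (n C k) * k ! ≡ n P′ k
  C*k!≡P′ {n} {k} k≤n = begin
    (n C k) * k ! ≡⟨ cong (_* k !) (trans (nCk≡nPk/k! k≤n) (cong (λ p → (p / k !) {{k !≢0}}) (P≡P′ n k))) ⟩
    ((n P′ k) / k !) {{k !≢0}} * k ! ≡⟨ m/n*n≡m {{k !≢0}} (k!∣nP′k k≤n) ⟩
    n P′ k ∎
    where open ≡-Reasoning

  -- Times k!, both sides are the falling factorial of n + 1 with k + 1 factors, taken apart at its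
  -- last and at its first factor.
  C-absorb : ∀ {n k} → k ≤ n → (suc n C k) * (suc n ∸ k) ≡ suc n * (n C k)
  C-absorb {n} {k} k≤n = *-cancelʳ-≡ _ _ (k !) {{k !≢0}} (begin
    (suc n C k) * (suc n ∸ k) * k ! ≡⟨ solve 3 (λ c d f → (c :* d) :* f := d :* (c :* f)) refl (suc n C k) (suc n ∸ k) (k !) ⟩
    (suc n ∸ k) * ((suc n C k) * k !) ≡⟨ cong ((suc n ∸ k) *_) (C*k!≡P′ (m≤n⇒m≤1+n k≤n)) ⟩
    suc n P′ suc k ≡⟨ nP′k≡n[n∸1P′k∸1] (suc n) (suc k) ⟩
    suc n * (n P′ k) ≡⟨ cong (suc n *_) (C*k!≡P′ k≤n) ⟨
    suc n * ((n C k) * k !) ≡⟨ *-assoc (suc n) (n C k) (k !) ⟨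
    suc n * (n C k) * k ! ∎)
    where open ≡-Reasoning

  -- The excess of the factor r + 1 is absorbed by the third factor, as (r+1)(r-1) ≤ r². This takes
  -- at least three factors, and it is where k ≥ 3 enters part (ii) with the sharp constant.
  falling≤power : ∀ r j → suc r P′ (3 + j) ≤ r ^ (3 + j)
  falling≤power r zero    = begin
    (suc r ∸ 2) * (r * (suc r * 1)) ≡⟨ solve 3 (λ a b c → a :* (b :* (c :* con 1)) := b :* (a :* c)) refl (suc r ∸ 2) r (suc r) ⟩
    r * ((suc r ∸ 2) * suc r) ≤⟨ *-monoʳ-≤ r ([r∸1][r+1]≤r² r) ⟩
    r * (r * (r * 1)) ∎
    where
    open ≤-Reasoning
    [r∸1][r+1]≤r² : ∀ r → (suc r ∸ 2) * suc r ≤ r * (r * 1)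
    [r∸1][r+1]≤r² zero    = z≤n
    [r∸1][r+1]≤r² (suc r) = begin
      r * suc (suc r) ≤⟨ m≤m+n (r * suc (suc r)) 1 ⟩
      r * suc (suc r) + 1 ≡⟨ solve 1 (λ r → r :* (con 2 :+ r) :+ con 1 := (con 1 :+ r) :* ((con 1 :+ r) :* con 1)) refl r ⟩
      suc r * (suc r * 1) ∎
  falling≤power r (suc j) = *-mono-≤ (m∸n≤m r (2 + j)) (falling≤power r j)

  module _ {k r m c : ℕ} (k≤r : k ≤ r) (0<r : 0 < r) (c-eq : c * r ≡ m * (r C k)) where

    binomial-step : m * (suc r C k) * suc (r ∸ k) ≡ suc r * (c * r)
    binomial-step = begin
      m * (suc r C k) * suc (r ∸ k) ≡⟨ *-assoc m (suc r C k) (suc (r ∸ k)) ⟩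
      m * ((suc r C k) * suc (r ∸ k)) ≡⟨ cong (λ d → m * ((suc r C k) * d)) (+-∸-assoc 1 k≤r) ⟨
      m * ((suc r C k) * (suc r ∸ k)) ≡⟨ cong (m *_) (C-absorb k≤r) ⟩
      m * (suc r * (r C k)) ≡⟨ solve 3 (λ m s b → m :* (s :* b) := s :* (m :* b)) refl m (suc r) (r C k) ⟩
      suc r * (m * (r C k)) ≡⟨ cong (suc r *_) c-eq ⟨
      suc r * (c * r) ∎
      where open ≡-Reasoning

    -- This is A_r + (r+1)(c-1) = m C(r+1,k) multiplied by r + 1 - k, hence the integrality of A_r.
    -- It holds because (r+1-k) + (k-1)c + (c-1)(r+1-k) = cr.
    exponent-identity : 0 < k → 0 < c →
      suc r * (suc (r ∸ k) + (k ∸ 1) * c) + suc r * pred c * suc (r ∸ k) ≡ m * (suc r C k) * suc (r ∸ k)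
    exponent-identity 0<k 0<c = trans (lemma k c r 0<k 0<c k≤r) (sym binomial-step)
      where
      lemma : ∀ k c r → 0 < k → 0 < c → k ≤ r →
        suc r * (suc (r ∸ k) + (k ∸ 1) * c) + suc r * pred c * suc (r ∸ k) ≡ suc r * (c * r)
      lemma (suc k) (suc c) r _ _ k<r = begin
        suc r * (g + k * suc c) + suc r * c * g
          ≡⟨ solve 4 (λ s g k c → s :* (g :+ k :* (con 1 :+ c)) :+ (s :* c) :* g := s :* ((con 1 :+ c) :* (g :+ k))) refl (suc r) g k c ⟩
        suc r * (suc c * (g + k)) ≡⟨ cong (λ x → suc r * (suc c * x)) (trans (sym (+-suc (r ∸ suc k) k)) (m∸n+n≡m k<r)) ⟩
        suc r * (suc c * r) ∎
        where
        open ≡-Reasoning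
        g = suc (r ∸ suc k)

    -- By `binomial-step`, (r+1)c / (r+1-k) equals m C(r+1,k) / r, and k! C(r+1,k) is a falling
    -- factorial that `falling≤power` bounds by r^k.
    codimension-bound : ∀ j → k ≡ 3 + j → suc r * c * k ! ≤ m * r ^ (k ∸ 1) * suc (r ∸ k)
    codimension-bound j refl = *-cancelʳ-≤′ r 0<r (begin
      suc r * c * k ! * r ≡⟨ solve 4 (λ s c f r → ((s :* c) :* f) :* r := (s :* (c :* r)) :* f) refl (suc r) c (k !) r ⟩
      suc r * (c * r) * k ! ≡⟨ cong (_* k !) binomial-step ⟨
      m * (suc r C k) * g * k ! ≡⟨ solve 4 (λ m b g f → ((m :* b) :* g) :* f := (m :* g) :* (b :* f)) refl m (suc r C k) g (k !) ⟩
      m * g * ((suc r C k) * k !) ≡⟨ cong (m * g *_) (C*k!≡P′ (m≤n⇒m≤1+n k≤r)) ⟩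
      m * g * (suc r P′ k) ≤⟨ *-monoʳ-≤ (m * g) (falling≤power r j) ⟩
      m * g * (r * r ^ (2 + j)) ≡⟨ solve 4 (λ m g r p → (m :* g) :* (r :* p) := ((m :* p) :* g) :* r) refl m g r (r ^ (2 + j)) ⟩
      m * r ^ (2 + j) * g * r ∎)
      where
      open ≤-Reasoning
      g = suc (r ∸ k)

  -- For k = 2 one has 2c = m(r-1) and A_r = (r+1)(m+2)/2. Twice the exponent tr - A_r - t is
  -- therefore r(2t - m - 2) - (m+2) - 2t, and 2t ≥ m + 3 makes it at least r - (m+2) - 2t; the
  -- lower bound on r is what makes this at least 2B.
  quadratic-exponent : ∀ {r m c t B} → 0 < c → c * r ≡ m * (r C 2) → 2 ≤ r → m + 2 < 2 * t →
    m + 2 + 2 * t + 2 * B ≤ r → m * (suc r C 2) + t + B ≤ suc r * pred c + t * r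
  quadratic-exponent {suc r} {m} {suc c} {t} {B} _ c-eq 2≤r m+2<2t large = *-cancelˡ-≤ 2 (begin
    2 * (m * (suc (suc r) C 2) + t + B)
      ≡⟨ cong (λ x → 2 * (x + t + B)) pascal ⟩
    2 * (suc c * suc r + m * suc r + t + B)
      ≡⟨ solve 5 (λ c r m t B → con 2 :* ((con 1 :+ c) :* (con 1 :+ r) :+ m :* (con 1 :+ r) :+ t :+ B) :=
           con 2 :* c :* (con 1 :+ r) :+ (m :* (con 1 :+ r) :+ con 2 :* (con 1 :+ r) :+ (m :+ con 2 :* t :+ con 2 :* B)) :+ m :* r) refl c r m t B ⟩
    2 * c * suc r + (m * suc r + 2 * suc r + (m + 2 * t + 2 * B)) + m * r
      ≡⟨ cong (2 * c * suc r + (m * suc r + 2 * suc r + (m + 2 * t + 2 * B)) +_) 2c≡ ⟨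
    2 * c * suc r + (m * suc r + 2 * suc r + (m + 2 * t + 2 * B)) + 2 * suc c
      ≡⟨ solve 6 (λ c r m t B x → con 2 :* c :* (con 1 :+ r) :+ x :+ con 2 :* (con 1 :+ c) := con 2 :* ((con 2 :+ r) :* c) :+ (x :+ con 2)) refl c r m t B (m * suc r + 2 * suc r + (m + 2 * t + 2 * B)) ⟩
    2 * (suc (suc r) * c) + (m * suc r + 2 * suc r + (m + 2 * t + 2 * B) + 2)
      ≡⟨ cong (2 * (suc (suc r) * c) +_) (solve 4 (λ r m t B → m :* (con 1 :+ r) :+ con 2 :* (con 1 :+ r) :+ (m :+ con 2 :* t :+ con 2 :* B) :+ con 2 :=
           (m :+ con 2) :* (con 1 :+ r) :+ (m :+ con 2 :+ con 2 :* t :+ con 2 :* B)) refl r m t B) ⟩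
    2 * (suc (suc r) * c) + ((m + 2) * suc r + (m + 2 + 2 * t + 2 * B))
      ≤⟨ +-monoʳ-≤ (2 * (suc (suc r) * c)) (+-monoʳ-≤ ((m + 2) * suc r) large) ⟩
    2 * (suc (suc r) * c) + ((m + 2) * suc r + suc r)
      ≡⟨ cong (2 * (suc (suc r) * c) +_) (+-comm ((m + 2) * suc r) (suc r)) ⟩
    2 * (suc (suc r) * c) + suc (m + 2) * suc r
      ≤⟨ +-monoʳ-≤ (2 * (suc (suc r) * c)) (*-monoˡ-≤ (suc r) m+2<2t) ⟩
    2 * (suc (suc r) * c) + 2 * t * suc r
      ≡⟨ solve 3 (λ x t r → con 2 :* x :+ con 2 :* t :* r := con 2 :* (x :+ t :* r)) refl (suc (suc r) * c) t (suc r) ⟩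
    2 * (suc (suc r) * c + t * suc r) ∎)
    where
    open ≤-Reasoning
    pascal : m * (suc (suc r) C 2) ≡ suc c * suc r + m * suc r
    pascal = begin-equality
      m * (suc (suc r) C 2) ≡⟨ cong (m *_) (nCk+nC[k+1]≡[n+1]C[k+1] (suc r) 1) ⟨
      m * ((suc r C 1) + (suc r C 2)) ≡⟨ cong (λ x → m * (x + (suc r C 2))) (nC1≡n (suc r)) ⟩
      m * (suc r + (suc r C 2)) ≡⟨ *-distribˡ-+ m (suc r) (suc r C 2) ⟩
      m * suc r + m * (suc r C 2) ≡⟨ cong (m * suc r +_) c-eq ⟨
      m * suc r + suc c * suc r ≡⟨ +-comm (m * suc r) (suc c * suc r) ⟩
      suc c * suc r + m * suc r ∎
    2c≡ : 2 * suc c ≡ m * r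
    2c≡ = *-cancelʳ-≡ _ _ (suc r) (begin-equality
      2 * suc c * suc r ≡⟨ *-assoc 2 (suc c) (suc r) ⟩
      2 * (suc c * suc r) ≡⟨ cong (2 *_) c-eq ⟩
      2 * (m * (suc r C 2)) ≡⟨ solve 2 (λ m b → con 2 :* (m :* b) := m :* (b :* con 2)) refl m (suc r C 2) ⟩
      m * ((suc r C 2) * 2) ≡⟨ cong (m *_) (C*k!≡P′ 2≤r) ⟩
      m * (r * (suc r * 1)) ≡⟨ solve 3 (λ m r s → m :* (r :* (s :* con 1)) := (m :* r) :* s) refl m r (suc r) ⟩
      m * r * suc r ∎)

-- Bounds on expectations with integer exponents

module Expectation where

  open import Defs
  open SubspaceCounts using (frames)
  open FrameBounds using (frames-shift; frames-positive; power≤hyperplanes)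
  open Moments
  open RationalPowers
  open Exponents
  open import Data.Integer as ℤ using (ℤ; +_; _⊖_)
  import Data.Integer.Properties as ℤ
  open import Data.List as List using ()
  open import Data.Nat as ℕ using (ℕ; zero; suc; NonTrivial; pred)
  open import Data.Nat.Combinatorics using (_C_; _P_)
  open import Data.Nat.ListAction using (sum)
  import Data.Nat.Properties as ℕ
  open import Data.Product using (∃-syntax; _×_; _,_)
  open import Data.Rational hiding (NonZero)
  open import Data.Rational.Properties
  open import Data.Rational.Solver using (module +-*-Solver)
  open import Relation.Binary.PropositionalEquality

  open +-*-Solver using (solve; _:=_; _:+_; _:*_; _:-_; :-_; con)

  fromℤ-⊖ : ∀ a b → fromℤ (a ⊖ b) ≡ ι a - ι b
  fromℤ-⊖ a b = begin
    fromℤ (a ⊖ b) ≡⟨ cong fromℤ (ℤ.m-n≡m⊖n a b) ⟨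
    fromℤ (+ a ℤ.+ (ℤ.- + b)) ≡⟨ fromℤ-+ (+ a) (ℤ.- + b) ⟩
    ι a + fromℤ (ℤ.- + b) ≡⟨ cong (λ x → ι a + x) (fromℤ-neg (+ b)) ⟩
    ι a - ι b ∎
    where open ≡-Reasoning

  divide : ∀ {r} → 0ℚ < r → ∀ x → ∃[ y ] y * r ≡ x
  divide {r} 0<r x = x * 1/ r , trans (*-assoc x (1/ r) r) (trans (cong (x *_) (*-inverseˡ r)) (*-identityʳ x))
    where
    instance
      r≢0 = pos⇒nonZero r {{positive 0<r}}

  -- Any b strictly between e / r and a. It makes room for the strict inequalities in products of
  -- cuts.
  interpolate : ∀ {a e r} → 0ℚ < r → 0ℚ ≤ e → e < a * r → ∃[ b ] 0ℚ < b × b < a × e < b * r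
  interpolate {a} {e} {r} 0<r 0≤e e<ar =
    let x , xr≡e = divide 0<r e
        b , x<b , b<a = <-dense {x} {a} (*-cancel-< 0<r {x} {a} (subst (_< a * r) (sym xr≡e) e<ar))
        0≤x = *-cancel-≤ 0<r {0ℚ} {x} (subst₂ _≤_ (sym (*-zeroˡ r)) (sym xr≡e) 0≤e)
    in b , ≤-<-trans 0≤x x<b , b<a , subst (_< b * r) xr≡e (*-monoˡ-< 0<r {x} {b} x<b)

  module _ (q : ℕ) .{{nt : NonTrivial q}} where

    private
      factor : ℕ → ℚ
      factor j = (+ (q ℕ.^ suc j) / (q ℕ.^ suc j ℕ.∸ 1)) {{q^j∸1≢0 q j}}

      factor-* : ∀ j → factor j * ι (q ℕ.^ suc j ℕ.∸ 1) ≡ ι (q ℕ.^ suc j)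
      factor-* j = /-*-cancel (+ (q ℕ.^ suc j)) (q ℕ.^ suc j ℕ.∸ 1) {{q^j∸1≢0 q j}}

      0<q^∸1 : ∀ j → 0ℚ < ι (q ℕ.^ suc j ℕ.∸ 1)
      0<q^∸1 j = 0<ι (ℕ.>-nonZero⁻¹ _ {{q^j∸1≢0 q j}})

      1<factor : ∀ j → 1ℚ < factor j
      1<factor j = *-cancel-< (0<q^∸1 j) (begin-strict
        1ℚ * ι (q ℕ.^ suc j ℕ.∸ 1) ≡⟨ *-identityˡ _ ⟩
        ι (q ℕ.^ suc j ℕ.∸ 1) <⟨ ι-mono-< (ℕ.∸-monoʳ-< ℕ.z<s (ℕ.>-nonZero⁻¹ (q ℕ.^ suc j) {{nonTrivial⇒pow-nonZero q (suc j)}})) ⟩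
        ι (q ℕ.^ suc j) ≡⟨ factor-* j ⟨
        factor j * ι (q ℕ.^ suc j ℕ.∸ 1) ∎)
        where open ≤-Reasoning

    partialProduct-positive : ∀ j → 0ℚ < partialProduct q j
    partialProduct-positive zero    = 0<ι {1} ℕ.z<s
    partialProduct-positive (suc j) = 0<* (partialProduct-positive j) (<-trans (0<ι {1} ℕ.z<s) (1<factor j))

    partialProduct-increasing : ∀ j → partialProduct q j < partialProduct q (suc j)
    partialProduct-increasing j = begin-strict
      partialProduct q j ≡⟨ *-identityˡ _ ⟨
      1ℚ * partialProduct q j <⟨ *-monoˡ-< (partialProduct-positive j) (1<factor j) ⟩
      factor j * partialProduct q j ≡⟨ *-comm (factor j) (partialProduct q j) ⟩
      partialProduct q (suc j) ∎
      where open ≤-Reasoning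

    -- The order of GL_s is q^(s²) times the product of 1 - q^(-j) over j ≤ s. Passing from s to s +
    -- 1 changes both arguments of `frames`, which is why `frames-shift` is used; its factor q^(s+1)
    -- - 1 is the new factor of the product.
    partialProduct-frames : ∀ s → partialProduct q s * ι (frames q s s) ≡ ι (q ℕ.^ (s ℕ.* s))
    partialProduct-frames zero    = refl
    partialProduct-frames (suc s) = begin
      partialProduct q s * factor s * ι (frames q (suc s) (suc s))
        ≡⟨ cong (λ f → partialProduct q s * factor s * f) (trans (cong ι (frames-shift (1<q q) s s))
             (trans (ι-* (q ℕ.^ suc s ℕ.∸ 1) (q ℕ.^ s ℕ.* frames q s s)) (cong (ι (q ℕ.^ suc s ℕ.∸ 1) *_) (ι-* (q ℕ.^ s) (frames q s s))))) ⟩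
      partialProduct q s * factor s * (ι (q ℕ.^ suc s ℕ.∸ 1) * (ι (q ℕ.^ s) * ι (frames q s s)))
        ≡⟨ solve 5 (λ p f e y d → p :* f :* (e :* (y :* d)) := (p :* d) :* ((f :* e) :* y)) refl
             (partialProduct q s) (factor s) (ι (q ℕ.^ suc s ℕ.∸ 1)) (ι (q ℕ.^ s)) (ι (frames q s s)) ⟩
      partialProduct q s * ι (frames q s s) * (factor s * ι (q ℕ.^ suc s ℕ.∸ 1) * ι (q ℕ.^ s))
        ≡⟨ cong₂ (λ x y → x * (y * ι (q ℕ.^ s))) (partialProduct-frames s) (factor-* s) ⟩
      ι (q ℕ.^ (s ℕ.* s)) * (ι (q ℕ.^ suc s) * ι (q ℕ.^ s))
        ≡⟨ cong (ι (q ℕ.^ (s ℕ.* s)) *_) (ι^-+ q (suc s) s) ⟨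
      ι (q ℕ.^ (s ℕ.* s)) * ι (q ℕ.^ (suc s ℕ.+ s))
        ≡⟨ ι^-+ q (s ℕ.* s) (suc s ℕ.+ s) ⟨
      ι (q ℕ.^ (s ℕ.* s ℕ.+ (suc s ℕ.+ s)))
        ≡⟨ cong (λ n → ι (q ℕ.^ n)) square ⟩
      ι (q ℕ.^ (suc s ℕ.* suc s)) ∎
      where
      open ≡-Reasoning
      square : s ℕ.* s ℕ.+ (suc s ℕ.+ s) ≡ suc s ℕ.* suc s
      square = trans (ℕ.+-comm (s ℕ.* s) (suc s ℕ.+ s))
        (trans (ℕ.+-assoc (suc s) s (s ℕ.* s)) (cong (suc s ℕ.+_) (sym (ℕ.*-suc s s))))

    L≡hyperplanes : ∀ r → L q r ≡ ι (hyperplanes q r)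
    L≡hyperplanes r = *-cancel-≡ 0<ι[q∸1] (begin
      L q r * ι (q ℕ.∸ 1) ≡⟨ /-*-cancel (+ (q ℕ.^ suc r ℕ.∸ 1)) (q ℕ.∸ 1) {{pred-nonZero q}} ⟩
      ι (q ℕ.^ suc r ℕ.∸ 1) ≡⟨ cong ι (hyperplanes-number (1<q q) r) ⟨
      ι (hyperplanes q r ℕ.* (q ℕ.∸ 1)) ≡⟨ ι-* (hyperplanes q r) (q ℕ.∸ 1) ⟩
      ι (hyperplanes q r) * ι (q ℕ.∸ 1) ∎)
      where
      open ≡-Reasoning
      0<ι[q∸1] : 0ℚ < ι (q ℕ.∸ 1)
      0<ι[q∸1] = 0<ι (ℕ.m<n⇒0<n∸m (1<q q))

    half-L : ∀ {r t} → ι t ≤ L q r * ½ → 2 ℕ.* t ℕ.≤ hyperplanes q r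
    half-L {r} {t} t≤ = ι-cancel-≤ (begin
      ι (2 ℕ.* t) ≡⟨ ι-* 2 t ⟩
      ι 2 * ι t ≡⟨ *-comm (ι 2) (ι t) ⟩
      ι t * ι 2 ≤⟨ *-monoˡ-≤ (0<ι {2} ℕ.z<s) t≤ ⟩
      L q r * ½ * ι 2 ≡⟨ *-assoc (L q r) ½ (ι 2) ⟩
      L q r * 1ℚ ≡⟨ *-identityʳ (L q r) ⟩
      L q r ≡⟨ L≡hyperplanes r ⟩
      ι (hyperplanes q r) ∎)
      where open ≤-Reasoning

    n<q^n : ∀ n → n ℕ.< q ℕ.^ n
    n<q^n zero    = ℕ.z<s
    n<q^n (suc n) = begin-strict
      suc n ≤⟨ n<q^n n ⟩
      q ℕ.^ n <⟨ ℕ.m<m*n (q ℕ.^ n) q {{nonTrivial⇒pow-nonZero q n}} (1<q q) ⟩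
      q ℕ.^ n ℕ.* q ≡⟨ ℕ.*-comm (q ℕ.^ n) q ⟩
      q ℕ.* q ℕ.^ n ∎
      where open ℕ.≤-Reasoning

    -- Part (i) fixes t and does not assume t ≤ L_r / 2; for r ≥ 2t the condition follows from r <
    -- q^r ≤ L_r.
    half-hyperplanes : ∀ {r t} → 2 ℕ.* t ℕ.≤ r → 2 ℕ.* t ℕ.≤ hyperplanes q r
    half-hyperplanes {r} {t} 2t≤r = ℕ.≤-trans 2t≤r (ℕ.≤-trans (ℕ.<⇒≤ (n<q^n r))
      (power≤hyperplanes (1<q q) r (hyperplanes q r) (hyperplanes-number (1<q q) r)))

  module Expectations {q : ℕ} .{{nt : NonTrivial q}} (F : FiniteField q) {k r m c : ℕ} (admissible : Admissible k r m c) where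

    open Admissible admissible
    open RandomForm F (r ℕ.+ c) k m
    open MomentBounds (1<q q) F admissible

    private
      0<r : 0 ℕ.< r
      0<r = ℕ.<-≤-trans ℕ.z<s (ℕ.≤-trans 2≤k k≤r)

      0<ιtotal : 0ℚ < ι total
      0<ιtotal = 0<ι 0<total

      codimension : ℕ
      codimension = m ℕ.* (suc r C k)

      -- The dimension (r+1)(c-1) of the Grassmannian of (r+1)-spaces in V_N; `codimension` is the
      -- number of linear conditions for such a space to be null.
      d : ℕ
      d = suc r ℕ.* pred c

    expectation-* : ∀ f → 𝔼 f * ι total ≡ ι (sum (List.map f forms))
    expectation-* f = /-*-cancel (+ sum (List.map f forms)) total {{forms-nonZero}}

    extension-exponent : ℤ
    extension-exponent = d ⊖ codimension

    -- A_r is the number of conditions minus the dimension of the Grassmannian, so q^(-A_r) is an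
    -- integer power of q. The fraction in A_r disappears after multiplication by r + 1 - k and
    -- `exponent-identity`.
    A≡ : A k r c ≡ - fromℤ extension-exponent
    A≡ = begin
      A k r c ≡⟨ solve 2 (λ a d → a := (a :+ d) :- d) refl (A k r c) (ι d) ⟩
      A k r c + ι d - ι d ≡⟨ cong (λ x → x - ι d) A+d≡ ⟩
      ι codimension - ι d ≡⟨ solve 2 (λ x y → x :- y := :- (y :- x)) refl (ι codimension) (ι d) ⟩
      - (ι d - ι codimension) ≡⟨ cong (λ x → - x) (fromℤ-⊖ d codimension) ⟨
      - fromℤ extension-exponent ∎
      where
      open ≡-Reasoning
      g = suc (r ℕ.∸ k)
      A+d≡ : A k r c + ι d ≡ ι codimension
      A+d≡ = *-cancel-≡ (0<ι {g} ℕ.z<s) (begin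
        (ι (suc r) * (1ℚ + (+ ((k ℕ.∸ 1) ℕ.* c)) / g) + ι d) * ι g
          ≡⟨ solve 4 (λ s x d g → (s :* (con 1ℚ :+ x) :+ d) :* g := s :* (g :+ x :* g) :+ d :* g) refl
               (ι (suc r)) ((+ ((k ℕ.∸ 1) ℕ.* c)) / g) (ι d) (ι g) ⟩
        ι (suc r) * (ι g + (+ ((k ℕ.∸ 1) ℕ.* c)) / g * ι g) + ι d * ι g
          ≡⟨ cong (λ x → ι (suc r) * (ι g + x) + ι d * ι g) (/-*-cancel (+ ((k ℕ.∸ 1) ℕ.* c)) g) ⟩
        ι (suc r) * (ι g + ι ((k ℕ.∸ 1) ℕ.* c)) + ι d * ι g
          ≡⟨ cong₂ _+_ (trans (ι-* (suc r) (g ℕ.+ (k ℕ.∸ 1) ℕ.* c)) (cong (ι (suc r) *_) (ι-+ g ((k ℕ.∸ 1) ℕ.* c)))) (ι-* d g) ⟨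
        ι (suc r ℕ.* (g ℕ.+ (k ℕ.∸ 1) ℕ.* c)) + ι (d ℕ.* g)
          ≡⟨ ι-+ (suc r ℕ.* (g ℕ.+ (k ℕ.∸ 1) ℕ.* c)) (d ℕ.* g) ⟨
        ι (suc r ℕ.* (g ℕ.+ (k ℕ.∸ 1) ℕ.* c) ℕ.+ d ℕ.* g)
          ≡⟨ cong ι (exponent-identity {k} {r} {m} {c} k≤r 0<r c-eq (ℕ.<-≤-trans ℕ.z<s 2≤k) 0<c) ⟩
        ι (codimension ℕ.* g)
          ≡⟨ ι-* codimension g ⟩
        ι codimension * ι g ∎)

    extension-expectation : 𝔼 (X (suc r)) < partialProduct q (suc r) * q ^ℤ extension-exponent
    extension-expectation = *-cancel-< 0<scale (begin-strict
      𝔼 (X (suc r)) * (ι total * (ι (q ℕ.^ codimension) * ι D))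
        ≡⟨ solve 4 (λ e t y d → e :* (t :* (y :* d)) := ((e :* t) :* y) :* d) refl (𝔼 (X (suc r))) (ι total) (ι (q ℕ.^ codimension)) (ι D) ⟩
      𝔼 (X (suc r)) * ι total * ι (q ℕ.^ codimension) * ι D
        ≡⟨ cong (λ x → x * ι (q ℕ.^ codimension) * ι D) (expectation-* (X (suc r))) ⟩
      ι (moment (suc r)) * ι (q ℕ.^ codimension) * ι D
        ≡⟨ trans (ι-* (moment (suc r) ℕ.* q ℕ.^ codimension) D) (cong (_* ι D) (ι-* (moment (suc r)) (q ℕ.^ codimension))) ⟨
      ι (moment (suc r) ℕ.* q ℕ.^ codimension ℕ.* D)
        <⟨ ι-mono-< moment-above ⟩
      ι ((q ℕ.^ (r ℕ.+ c)) ℕ.^ suc r ℕ.* total)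
        ≡⟨ trans (ι-* ((q ℕ.^ (r ℕ.+ c)) ℕ.^ suc r) total) (cong (_* ι total) (trans (cong ι exponents) (ι^-+ q (suc r ℕ.* suc r) d))) ⟩
      ι (q ℕ.^ (suc r ℕ.* suc r)) * ι (q ℕ.^ d) * ι total
        ≡⟨ cong₂ (λ x y → x * y * ι total) (partialProduct-frames q (suc r)) (^ℤ-⊖ q d codimension) ⟨
      partialProduct q (suc r) * ι D * (q ^ℤ extension-exponent * ι (q ℕ.^ codimension)) * ι total
        ≡⟨ solve 5 (λ p d z y t → ((p :* d) :* (z :* y)) :* t := (p :* z) :* (t :* (y :* d))) refl
             (partialProduct q (suc r)) (ι D) (q ^ℤ extension-exponent) (ι (q ℕ.^ codimension)) (ι total) ⟩
      partialProduct q (suc r) * q ^ℤ extension-exponent * (ι total * (ι (q ℕ.^ codimension) * ι D)) ∎)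
      where
      open ≤-Reasoning
      D = frames q (suc r) (suc r)
      0<D : 0ℚ < ι D
      0<D = 0<ι (frames-positive (1<q q) {suc r} {suc r} ℕ.≤-refl)
      0<scale : 0ℚ < ι total * (ι (q ℕ.^ codimension) * ι D)
      0<scale = 0<* 0<ιtotal (0<* (0<ι^ q codimension) 0<D)
      exponents : (q ℕ.^ (r ℕ.+ c)) ℕ.^ suc r ≡ q ℕ.^ (suc r ℕ.* suc r ℕ.+ d)
      exponents = trans (ℕ.^-*-assoc q (r ℕ.+ c) (suc r)) (cong (q ℕ.^_)
        (trans (ℕ.*-comm (r ℕ.+ c) (suc r)) (trans (cong (suc r ℕ.*_) r+c≡) (ℕ.*-distribˡ-+ (suc r) (suc r) (pred c)))))
        where
        r+c≡ : r ℕ.+ c ≡ suc r ℕ.+ pred c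
        r+c≡ = trans (cong (r ℕ.+_) (sym (ℕ.suc-pred c {{ℕ.>-nonZero 0<c}}))) (ℕ.+-suc r (pred c))

    falling-exponent : ℕ → ℤ
    falling-exponent t = (d ℕ.+ t ℕ.* r) ⊖ (codimension ℕ.+ t)

    falling-exponent≡ : ∀ t → fromℤ (falling-exponent t) ≡ ι (t ℕ.* r) - A k r c - ι t
    falling-exponent≡ t = begin
      fromℤ (falling-exponent t) ≡⟨ fromℤ-⊖ (d ℕ.+ t ℕ.* r) (codimension ℕ.+ t) ⟩
      ι (d ℕ.+ t ℕ.* r) - ι (codimension ℕ.+ t) ≡⟨ cong₂ _-_ (ι-+ d (t ℕ.* r)) (ι-+ codimension t) ⟩
      ι d + ι (t ℕ.* r) - (ι codimension + ι t)
        ≡⟨ solve 4 (λ d x y t → (d :+ x) :- (y :+ t) := (x :- :- (d :- y)) :- t) refl (ι d) (ι (t ℕ.* r)) (ι codimension) (ι t) ⟩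
      ι (t ℕ.* r) - (- (ι d - ι codimension)) - ι t ≡⟨ cong (λ a → ι (t ℕ.* r) - (- a) - ι t) (fromℤ-⊖ d codimension) ⟨
      ι (t ℕ.* r) - (- fromℤ extension-exponent) - ι t ≡⟨ cong (λ a → ι (t ℕ.* r) - a - ι t) A≡ ⟨
      ι (t ℕ.* r) - A k r c - ι t ∎
      where open ≡-Reasoning

    falling-expectation : ∀ t → 2 ℕ.≤ t → 2 ℕ.* t ℕ.≤ hyperplanes q r →
      q ^ℤ falling-exponent t ≤ 𝔼 (λ θ → X r θ P t)
    falling-expectation t 2≤t 2t≤l = *-cancel-≤ (0<* (0<ι^ q w) 0<ιtotal) (begin
      q ^ℤ falling-exponent t * (ι (q ℕ.^ w) * ι total) ≡⟨ *-assoc (q ^ℤ falling-exponent t) (ι (q ℕ.^ w)) (ι total) ⟨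
      q ^ℤ falling-exponent t * ι (q ℕ.^ w) * ι total ≡⟨ cong (_* ι total) (^ℤ-⊖ q (d ℕ.+ t ℕ.* r) w) ⟩
      ι (q ℕ.^ (d ℕ.+ t ℕ.* r)) * ι total ≡⟨ ι-* (q ℕ.^ (d ℕ.+ t ℕ.* r)) total ⟨
      ι (q ℕ.^ (d ℕ.+ t ℕ.* r) ℕ.* total) ≤⟨ ι-mono-≤ (falling-moment-below t 2≤t 2t≤l) ⟩
      ι (falling-moment t ℕ.* q ℕ.^ w) ≡⟨ ι-* (falling-moment t) (q ℕ.^ w) ⟩
      ι (falling-moment t) * ι (q ℕ.^ w) ≡⟨ cong (_* ι (q ℕ.^ w)) (expectation-* (λ θ → X r θ P t)) ⟨
      E * ι total * ι (q ℕ.^ w) ≡⟨ solve 3 (λ e t y → (e :* t) :* y := e :* (y :* t)) refl E (ι total) (ι (q ℕ.^ w)) ⟩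
      E * (ι (q ℕ.^ w) * ι total) ∎)
      where
      open ≤-Reasoning
      w = codimension ℕ.+ t
      E = 𝔼 (λ θ → X r θ P t)

    0<μ : 0ℚ < 𝔼 (X r)
    0<μ = *-cancel-< 0<ιtotal (subst₂ _<_ (sym (*-zeroˡ (ι total))) (sym (expectation-* (X r))) (0<ι 0<moment))

    μ≤q² : 𝔼 (X r) ≤ q ^ℤ (+ 2)
    μ≤q² = *-cancel-≤ 0<ιtotal (begin
      𝔼 (X r) * ι total ≡⟨ expectation-* (X r) ⟩
      ι (moment r) ≤⟨ ι-mono-≤ moment≤q²total ⟩
      ι (q ℕ.^ 2 ℕ.* total) ≡⟨ ι-* (q ℕ.^ 2) total ⟩
      ι (q ℕ.^ 2) * ι total ∎)
      where open ≤-Reasoning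

    -- Division by μ^t costs at most q^(2t), since μ ≤ q².
    normalized-falling-expectation : ∀ t → 2 ℕ.≤ t → 2 ℕ.* t ℕ.≤ hyperplanes q r → .{{_ : Data.Rational.NonZero (𝔼 (X r) ^ℚ t)}} →
      q ^ℤ (falling-exponent t ℤ.- + 2 ℤ.* + t) ≤ 𝔼 (λ θ → X r θ P t) ÷ (𝔼 (X r) ^ℚ t)
    normalized-falling-expectation t 2≤t 2t≤l = *-cancel-≤ 0<μ^t (begin
      q ^ℤ (falling-exponent t ℤ.- e) * μ^t ≤⟨ *-mono-≤ (<⇒≤ (^ℤ-positive q (falling-exponent t ℤ.- e))) ≤-refl (<⇒≤ 0<μ^t) μ^t≤ ⟩
      q ^ℤ (falling-exponent t ℤ.- e) * q ^ℤ e ≡⟨ ^ℤ-+ q (falling-exponent t ℤ.- e) e ⟨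
      q ^ℤ (falling-exponent t ℤ.- e ℤ.+ e) ≡⟨ cong (q ^ℤ_) (trans (ℤ.+-assoc (falling-exponent t) (ℤ.- e) e)
                                                            (trans (cong (λ z → falling-exponent t ℤ.+ z) (ℤ.+-inverseˡ e)) (ℤ.+-identityʳ (falling-exponent t)))) ⟩
      q ^ℤ falling-exponent t ≤⟨ falling-expectation t 2≤t 2t≤l ⟩
      E ≡⟨ *-identityʳ E ⟨
      E * 1ℚ ≡⟨ cong (E *_) (*-inverseˡ μ^t) ⟨
      E * (1/ μ^t * μ^t) ≡⟨ *-assoc E (1/ μ^t) μ^t ⟨
      E ÷ μ^t * μ^t ∎)
      where
      open ≤-Reasoning
      e = + 2 ℤ.* + t
      E = 𝔼 (λ θ → X r θ P t)
      μ^t = 𝔼 (X r) ^ℚ t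
      0<μ^t : 0ℚ < μ^t
      0<μ^t = ^-positive 0<μ t
      μ^t≤ : μ^t ≤ q ^ℤ e
      μ^t≤ = ≤-trans (^-mono-≤ (<⇒≤ 0<μ) μ≤q² t) (≤-reflexive (sym (^ℤ-* q (+ 2) t)))

-- The two general bounds and the quadratic case

module GrowthBounds where

  open import Defs
  open Moments
  open RationalPowers
  open Exponents
  open Expectation
  open import Data.Integer as ℤ using (ℤ; +_; _⊖_)
  import Data.Integer.Properties as ℤ
  open import Data.List as List using ()
  open import Data.Nat as ℕ using (ℕ; suc; NonTrivial)
  open import Data.Nat.Combinatorics using (_P_; _C_)
  open import Data.Nat.ListAction using (sum)
  import Data.Nat.Properties as ℕ
  open import Data.Product using (_,_)
  open import Data.Rational as ℚ hiding (NonZero)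
  open import Data.Rational.Properties
  open import Data.Rational.Solver using (module +-*-Solver)
  open import Relation.Binary.PropositionalEquality

  open +-*-Solver using (solve; _:=_; _:+_; _:*_; _:-_; :-_; con)

  0≤- : ∀ {x y} → x ≤ y → 0ℚ ≤ y - x
  0≤- {x} {y} x≤y = subst (_≤ y - x) (+-inverseʳ x) (+-monoˡ-≤ (- x) x≤y)

  0≤+ : ∀ {x y} → 0ℚ ≤ x → 0ℚ ≤ y → 0ℚ ≤ x + y
  0≤+ {x} {y} 0≤x 0≤y = +-mono-≤ 0≤x 0≤y

  module _ {q : ℕ} .{{nt : NonTrivial q}} (F : FiniteField q) {k r m c : ℕ} (admissible : Admissible k r m c) where

    open RandomForm F (r ℕ.+ c) k m
    open MomentBounds (1<q q) F admissible using (0<total; total)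
    open Expectations F admissible

    -- The rational bound is strict, so q^(-A_r) can be lowered to some b and then to a rational
    -- power q^s above b with s < -A_r. The partial product with r + 1 factors lies strictly below
    -- C_q because the next one is larger.
    extension-bound : ⌜ 𝔼 (X (suc r)) ⌝ ≤ʳ Cq q *ʳ (q ^ʳ ⌜ - A k r c ⌝)
    extension-bound p p<E =
      let b , 0<b , b<Q , E<b*PP = interpolate {q ^ℤ extension-exponent} {𝔼 (X (suc r))} {PP} 0<PP 0≤E
            (subst (𝔼 (X (suc r)) <_) (*-comm PP (q ^ℤ extension-exponent)) extension-expectation)
          s , s<z , b<q^s = power-above q {b} {extension-exponent} 0<b b<Q
      in PP , b , 0<PP , 0<b , (suc (suc r) , partialProduct-increasing q (suc r)) ,
         (s , subst (s <_) z≡-A s<z , b<q^s) ,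
         <-trans p<E (subst (𝔼 (X (suc r)) <_) (*-comm b PP) E<b*PP)
      where
      PP : ℚ
      PP = partialProduct q (suc r)
      0<PP : 0ℚ < PP
      0<PP = partialProduct-positive q (suc r)
      0≤E : 0ℚ ≤ 𝔼 (X (suc r))
      0≤E = *-cancel-≤ (0<ι 0<total) {0ℚ} {𝔼 (X (suc r))} (subst₂ _≤_ (sym (*-zeroˡ (ι total))) (sym (expectation-* (X (suc r))))
        (0≤ι (sum (List.map (X (suc r)) forms))))
      z≡-A : fromℤ extension-exponent ≡ - A k r c
      z≡-A = trans (solve 1 (λ x → x := :- :- x) refl (fromℤ extension-exponent)) (cong (λ x → - x) (sym A≡))

    falling-log-bound : ∀ t → 2 ℕ.≤ t → ι t ≤ L q r * ½ →
      ⌜ ι (t ℕ.* r) - A k r c - ι (1 ℕ.* t) ⌝ ≤ʳ log q (𝔼 (λ θ → X r θ P t))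
    falling-log-bound t 2≤t t≤ s s< = log-lower q {z = falling-exponent t} (falling-expectation t 2≤t (half-L q {r} {t} t≤))
      (subst (s <_) (trans (cong (λ n → ι (t ℕ.* r) - A k r c - ι n) (ℕ.*-identityˡ t)) (sym (falling-exponent≡ t))) s<)

    normalized-exponent≡ : ∀ t → fromℤ (falling-exponent t ℤ.- + 2 ℤ.* + t) ≡ ι t * ι r - A k r c - ι t - ι 2 * ι t
    normalized-exponent≡ t = begin
      fromℤ (falling-exponent t ℤ.- + 2 ℤ.* + t)
        ≡⟨ fromℤ-+ (falling-exponent t) (ℤ.- (+ 2 ℤ.* + t)) ⟩
      fromℤ (falling-exponent t) + fromℤ (ℤ.- (+ 2 ℤ.* + t))
        ≡⟨ cong₂ _+_ (falling-exponent≡ t) (trans (fromℤ-neg (+ 2 ℤ.* + t)) (cong (λ x → - x) (fromℤ-* (+ 2) (+ t)))) ⟩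
      ι (t ℕ.* r) - A k r c - ι t - ι 2 * ι t
        ≡⟨ cong (λ x → x - A k r c - ι t - ι 2 * ι t) (ι-* t r) ⟩
      ι t * ι r - A k r c - ι t - ι 2 * ι t ∎
      where open ≡-Reasoning

  module _ {q : ℕ} .{{nt : NonTrivial q}} (F : FiniteField q) {r m c : ℕ} (admissible : Admissible 2 r m c) where

    open Admissible admissible
    open RandomForm F (r ℕ.+ c) 2 m
    open MomentBounds (1<q q) F admissible using (0<c)
    open Expectations F admissible

    quadratic-growth : ∀ t → m ℕ.+ 2 ℕ.< 2 ℕ.* t → ∀ B → m ℕ.+ 2 ℕ.+ 2 ℕ.* t ℕ.+ 2 ℕ.* B ℕ.≤ r →
      ι B ≤ 𝔼 (λ θ → X r θ P t)
    quadratic-growth t m+2<2t B large = begin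
      ι B ≤⟨ ι-mono-≤ {B} {q ℕ.^ B} (ℕ.<⇒≤ (n<q^n q B)) ⟩
      q ^ℤ (+ B) ≤⟨ ^ℤ-mono-≤ q B≤exponent ⟩
      q ^ℤ falling-exponent t ≤⟨ falling-expectation t 2≤t (half-hyperplanes q {r} {t} 2t≤r) ⟩
      𝔼 (λ θ → X r θ P t) ∎
      where
      open ≤-Reasoning
      u = suc r ℕ.* ℕ.pred c ℕ.+ t ℕ.* r
      w = m ℕ.* (suc r C 2) ℕ.+ t
      2≤t : 2 ℕ.≤ t
      2≤t = ℕ.*-cancelˡ-< 2 1 t (ℕ.≤-trans (ℕ.+-monoˡ-≤ 2 1≤m) (ℕ.<⇒≤ m+2<2t))
      2t≤r : 2 ℕ.* t ℕ.≤ r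
      2t≤r = ℕ.≤-trans (ℕ.m≤n+m (2 ℕ.* t) (m ℕ.+ 2)) (ℕ.≤-trans (ℕ.m≤m+n (m ℕ.+ 2 ℕ.+ 2 ℕ.* t) (2 ℕ.* B)) large)
      B≤exponent : + B ℤ.≤ falling-exponent t
      B≤exponent = subst (ℤ._≤ falling-exponent t) w+B⊖w≡B
        (ℤ.⊖-monoˡ-≤ w {w ℕ.+ B} {u} (quadratic-exponent {r} {m} {c} {t} {B} 0<c c-eq k≤r m+2<2t large))
        where
        w+B⊖w≡B : (w ℕ.+ B) ⊖ w ≡ + B
        w+B⊖w≡B = trans (ℤ.⊖-≥ (ℕ.m≤m+n w B)) (cong +_ (ℕ.m+n∸m≡n w B))

  -- The difference of the two sides is written as a sum of nonnegative terms.
  exponent-bound : ∀ {h e e₀ t w r a s} → 0ℚ ≤ w → 0ℚ ≤ e → e₀ ≤ e →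
    (h + e) * w ≤ t → a ≤ s + h * (w * r) → s ≤ ι 2 * w → ι 12 ≤ r → ι 4 * (ι 3 * h + ι 2) ≤ r * e₀ →
    e * ½ * (w * r) ≤ t * r - a - t - ι 2 * t
  exponent-bound {h} {e} {e₀} {t} {w} {r} {a} {s} 0≤w 0≤e e₀≤e t≥ a≤ s≤ 12≤r e₀r≥ = begin
    e * ½ * (w * r) ≡⟨ +-identityʳ (e * ½ * (w * r)) ⟨
    e * ½ * (w * r) + 0ℚ ≤⟨ +-monoʳ-≤ (e * ½ * (w * r)) nonNegativeTerms ⟩
    e * ½ * (w * r) + (t₁ + t₂ + t₃ + t₄) ≡⟨ identity h e e₀ t w r a s ⟩
    t * r - a - t - ι 2 * t ∎
    where
    open ≤-Reasoning
    ¼ t₁ t₂ t₃ t₄ : ℚ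
    ¼ = ½ * ½
    -- The 3 collects the losses t from the falling factorial and 2t from μ^t.
    t₁ = (t - (h + e) * w) * (r - ι 3)
    t₂ = s + h * (w * r) - a
    t₃ = ι 2 * w - s
    -- The bracket is er/2 - 3e - 3h - 2. One quarter of er pays for 3e once r ≥ 12, the other for
    -- 3h + 2 once r e₀ ≥ 4(3h + 2).
    t₄ = w * (¼ * (e * (r - ι 12)) + ¼ * ((e - e₀) * r) + ¼ * (r * e₀ - ι 4 * (ι 3 * h + ι 2)))
    3≤r : ι 3 ≤ r
    3≤r = ≤-trans (ι-mono-≤ {3} {12} (ℕ.s≤s (ℕ.s≤s (ℕ.s≤s ℕ.z≤n)))) 12≤r
    0≤r : 0ℚ ≤ r
    0≤r = ≤-trans (0≤ι 12) 12≤r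
    0≤¼ : 0ℚ ≤ ¼
    0≤¼ = nonNegative⁻¹ ¼
    nonNegativeTerms : 0ℚ ≤ t₁ + t₂ + t₃ + t₄
    nonNegativeTerms = 0≤+ (0≤+ (0≤+ (0≤* (0≤- t≥) (0≤- 3≤r)) (0≤- a≤)) (0≤- s≤))
      (0≤* 0≤w (0≤+ (0≤+ (0≤* 0≤¼ (0≤* 0≤e (0≤- 12≤r))) (0≤* 0≤¼ (0≤* (0≤- e₀≤e) 0≤r))) (0≤* 0≤¼ (0≤- e₀r≥))))
    identity : ∀ h e e₀ t w r a s → e * ½ * (w * r) +
      ((t - (h + e) * w) * (r - ι 3) + (s + h * (w * r) - a) + (ι 2 * w - s) +
       w * (¼ * (e * (r - ι 12)) + ¼ * ((e - e₀) * r) + ¼ * (r * e₀ - ι 4 * (ι 3 * h + ι 2))))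
      ≡ t * r - a - t - ι 2 * t
    identity = solve 8 (λ h e e₀ t w r a s → e :* con ½ :* (w :* r) :+
      ((t :- (h :+ e) :* w) :* (r :- con (ι 3)) :+ (s :+ h :* (w :* r) :- a) :+ (con (ι 2) :* w :- s) :+
       w :* (con ¼ :* (e :* (r :- con (ι 12))) :+ con ¼ :* ((e :- e₀) :* r) :+ con ¼ :* (r :* e₀ :- con (ι 4) :* (con (ι 3) :* h :+ con (ι 2)))))
      := t :* r :- a :- t :- con (ι 2) :* t) refl

-- Normalized moments for k at least 3

module NormalizedGrowth where

  open import Defs
  open RationalPowers
  open Exponents
  open Expectation
  open GrowthBounds
  open import Data.Integer as ℤ using (ℤ; +_)
  import Data.Integer.Properties as ℤ
  open import Data.Nat as ℕ using (ℕ; suc; NonTrivial)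
  open import Data.Nat.Combinatorics using (_P_)
  import Data.Nat.Properties as ℕ
  open import Data.Product using (∃-syntax; _×_; _,_)
  open import Data.Rational as ℚ hiding (NonZero)
  open import Data.Rational.Properties
  open import Data.Rational.Solver using (module +-*-Solver)
  open import Data.Sum using (inj₁; inj₂)
  open import Relation.Binary.PropositionalEquality

  open +-*-Solver using (solve; _:=_; _:+_; _:*_; _:-_; :-_; con)

  private
    0<½ : 0ℚ < ½
    0<½ = positive⁻¹ ½

  half-product-below : ∀ {ε : Cut} {M s} → ((ε *ʳ ⌜ ½ ⌝) *ʳ ⌜ M ⌝) s →
    ∃[ e ] ε e × 0ℚ < e × s ≤ e * ½ * M
  half-product-below {M = M} {s} (a , b , 0<a , 0<b , (e , h , 0<e , 0<h , e∈ε , h<½ , a<eh) , b<M , s<ab) =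
    e , e∈ε , 0<e , (begin
      s ≤⟨ <⇒≤ s<ab ⟩
      a * b ≤⟨ *-mono-≤ (<⇒≤ 0<a) (<⇒≤ a<eh) (<⇒≤ 0<b) (<⇒≤ b<M) ⟩
      e * h * M ≤⟨ *-monoˡ-≤ (<-trans 0<b b<M) (*-mono-≤ (<⇒≤ 0<e) ≤-refl (<⇒≤ 0<h) (<⇒≤ h<½)) ⟩
      e * ½ * M ∎)
    where open ≤-Reasoning

  half-product-above : ∀ {ε : Cut} {e M s} → ε e → 0ℚ < e → 0ℚ < M → s < e * ½ * ½ * ½ * (M * ½) →
    ((ε *ʳ ⌜ ½ ⌝) *ʳ ⌜ M ⌝) s
  half-product-above {e = e} {M} {s} e∈ε 0<e 0<M s< =
    -- All inequalities in a product of cuts are strict: 1/4 stands below 1/2, e/8 below e/4, and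
    -- M/2 below M. The constant lost is harmless, because this direction is used only for
    -- divergence.
    e * ½ * ½ * ½ , M * ½ , 0<* 0<e½½ 0<½ , 0<* 0<M 0<½ ,
    (e , ½ * ½ , 0<e , 0<* 0<½ 0<½ , e∈ε , half< 0<½ , subst (e * ½ * ½ * ½ <_) (*-assoc e ½ ½) (half< 0<e½½)) ,
    half< 0<M , s<
    where
    0<e½½ : 0ℚ < e * ½ * ½
    0<e½½ = 0<* (0<* 0<e 0<½) 0<½
    ½<1 : ½ < 1ℚ
    ½<1 = *-cancel-< (0<ι {2} ℕ.z<s) {½} {1ℚ} (ι-mono-< {1} {2} (ℕ.s≤s (ℕ.s≤s ℕ.z≤n)))
    half< : ∀ {x} → 0ℚ < x → x * ½ < x
    half< {x} 0<x = subst₂ _<_ (*-comm ½ x) (*-identityˡ x) (*-monoˡ-< 0<x ½<1)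

  module _ {ε : Cut} (real : IsReal ε) where
    open IsReal real

    -- Otherwise t < (h + e) b for some b < M. As the cut is open, some e′ > e lies below ε, and x +
    -- e′ exceeds h + e for a suitable x < h. So t would belong to the left-hand cut and, by
    -- hypothesis, t < t.
    threshold-reached : ∀ {h M e t} → ε e → 0ℚ < h + e → 0ℚ ≤ t →
      (⌜ h ⌝ +ʳ ε) *ʳ ⌜ M ⌝ ≤ʳ ⌜ t ⌝ → (h + e) * M ≤ t
    threshold-reached {h} {M} {e} {t} e∈ε 0<h+e 0≤t below = ≮⇒≥ λ t<[h+e]M →
      let b , 0<b , b<M , t<b[h+e] = interpolate {M} {t} {h + e} 0<h+e 0≤t (subst (t <_) (*-comm (h + e) M) t<[h+e]M)
          e′ , e<e′ , e′∈ε = open′ e∈ε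
          x , h+e-e′<x , x<h = <-dense {h + e - e′} {h} (room e<e′)
      in <-irrefl refl (below t (h + e , b , 0<h+e , 0<b ,
        (x , e′ , x<h , e′∈ε , subst (_< x + e′) (solve 2 (λ y z → (y :- z) :+ z := y) refl (h + e) e′) (+-monoˡ-< e′ h+e-e′<x)) ,
        b<M , subst (t <_) (*-comm b (h + e)) t<b[h+e]))
      where
      room : ∀ {e′} → e < e′ → h + e - e′ < h
      room {e′} e<e′ = subst (h + e - e′ <_) (solve 2 (λ h z → (h :+ z) :- z := h) refl h e′)
        (+-monoˡ-< (- e′) (+-monoʳ-< h e<e′))

    -- A point of the cut on the left of (ii) comes with an `e` that may be arbitrarily small.
    -- Raising it to at least a fixed `e₀` below ε allows the bound on r to be chosen in advance.
    larger-member : ∀ {e e₀} → ε e → ε e₀ → ∃[ e′ ] ε e′ × e ≤ e′ × e₀ ≤ e′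
    larger-member {e} {e₀} e∈ε e₀∈ε with ≤-total e e₀
    ... | inj₁ e≤e₀ = e₀ , e₀∈ε , e≤e₀ , ≤-refl
    ... | inj₂ e₀≤e = e , e∈ε , ≤-refl , e₀≤e

    -- Since B < q^B, it is enough that the exponent exceeds B. It is at least a fixed positive
    -- multiple of m r^(k-1), hence of r, so the bound on r is uniform in q and m.
    half-product-unbounded : ∀ k → 3 ℕ.≤ k → ε 0ℚ → ∀ (B : ℕ) →
      ∃[ R ] ∀ r → R ℕ.≤ r → ∀ q .{{_ : NonTrivial q}} m → 1 ℕ.≤ m →
      ⌜ ι B ⌝ ≤ʳ q ^ʳ ((ε *ʳ ⌜ ½ ⌝) *ʳ ⌜ ι (m ℕ.* r ℕ.^ (k ℕ.∸ 1)) ⌝)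
    half-product-unbounded k@(suc (suc (suc j))) (ℕ.s≤s (ℕ.s≤s (ℕ.s≤s _))) ε0 B =
      let e , 0<e , e∈ε = open′ ε0
          -- e/16 is the multiple of M that `half-product-above` allows, namely e/8 times M/2;
          -- `suc B` makes the comparison with B strict.
          δ = e * ½ * ½ * ½ * ½
          n , B<nδ = archimedean-* (ι (suc B)) {δ} (0<* (0<* (0<* (0<* 0<e 0<½) 0<½) 0<½) 0<½)
      in suc n , λ r n<r q m 1≤m p p<B → member e∈ε 0<e B<nδ r n<r q m 1≤m p p<B
      where
      member : ∀ {e n} → ε e → 0ℚ < e → ι (suc B) ≤ ι n * (e * ½ * ½ * ½ * ½) →
        ∀ r → suc n ℕ.≤ r → ∀ q .{{_ : NonTrivial q}} m → 1 ℕ.≤ m → ⌜ ι B ⌝ ≤ʳ q ^ʳ ((ε *ʳ ⌜ ½ ⌝) *ʳ ⌜ ι (m ℕ.* r ℕ.^ (k ℕ.∸ 1)) ⌝)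
      member {e} {n} e∈ε 0<e B<nδ r n<r q m 1≤m p p<B =
        let s , s<B , p<q^s = exponent in s , half-product-above {M = M} e∈ε 0<e 0<M (<-trans s<B B<) , p<q^s
        where
        open ≤-Reasoning
        M : ℚ
        M = ι (m ℕ.* r ℕ.^ (2 ℕ.+ j))
        n<M : n ℕ.< m ℕ.* r ℕ.^ (2 ℕ.+ j)
        n<M = ℕ.≤-trans n<r (ℕ.≤-trans (ℕ.m≤m*n r (r ℕ.^ (1 ℕ.+ j)) {{ℕ.m^n≢0 r (1 ℕ.+ j) {{ℕ.>-nonZero (ℕ.≤-trans (ℕ.s≤s ℕ.z≤n) n<r)}}}})
          (ℕ.m≤n*m (r ℕ.^ (2 ℕ.+ j)) m {{ℕ.>-nonZero 1≤m}}))
        0<M : 0ℚ < M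
        0<M = 0<ι (ℕ.≤-trans (ℕ.s≤s ℕ.z≤n) n<M)
        B< : ι B < e * ½ * ½ * ½ * (M * ½)
        B< = begin-strict
          ι B <⟨ ι-mono-< {B} {suc B} ℕ.≤-refl ⟩
          ι (suc B) ≤⟨ B<nδ ⟩
          ι n * (e * ½ * ½ * ½ * ½) ≤⟨ *-monoˡ-≤ (0<* (0<* (0<* (0<* 0<e 0<½) 0<½) 0<½) 0<½) (ι-mono-≤ (ℕ.<⇒≤ n<M)) ⟩
          M * (e * ½ * ½ * ½ * ½) ≡⟨ solve 3 (λ M e h → M :* (e :* h) := e :* (M :* h)) refl M (e * ½ * ½ * ½) ½ ⟩
          e * ½ * ½ * ½ * (M * ½) ∎
        exponent : ∃[ s ] s < ι B × p <[ q ^ s ]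
        exponent with ≤-total p 0ℚ
        -- For p ≤ 0 every exponent is admissible; -1 is below B even if B = 0.
        ... | inj₁ p≤0 = - 1ℚ , <-≤-trans (negative⁻¹ (- 1ℚ)) (0≤ι B) , inj₁ p≤0
        ... | inj₂ 0≤p =
          let b , p<b , b<B = <-dense {p} {ι B} p<B
              s , s<B , b<q^s = power-above q {b} {+ B} (≤-<-trans 0≤p p<b) (<-≤-trans b<B (ι-mono-≤ (ℕ.<⇒≤ (n<q^n q B))))
          in s , s<B , <[^]-trans {b = b} {s} p<b 0≤p b<q^s
          where
          <[^]-trans : ∀ {p b s} → p < b → 0ℚ ≤ p → b <[ q ^ s ] → p <[ q ^ s ]
          <[^]-trans p<b 0≤p (inj₁ b≤0) = inj₁ (≤-trans (<⇒≤ p<b) b≤0)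
          <[^]-trans {s = s} p<b 0≤p (inj₂ b^d<) = inj₂ (≤-<-trans (^-mono-≤ 0≤p (<⇒≤ p<b) (ℚ.ℚ.denominatorℕ s)) b^d<)

  module _ {k r m c : ℕ} (admissible : Admissible k r m c) {j : ℕ} (k≡ : k ≡ 3 ℕ.+ j) where
    open Admissible admissible

    private
      0<r : 0 ℕ.< r
      0<r = ℕ.<-≤-trans ℕ.z<s (ℕ.≤-trans 2≤k k≤r)

      M : ℚ
      M = ι (m ℕ.* r ℕ.^ (k ℕ.∸ 1))

    threshold-* : threshold k * ι (k ℕ.!) ≡ ι (k ℕ.∸ 1)
    threshold-* = /-*-cancel (+ (k ℕ.∸ 1)) (k ℕ.!) {{ℕ._!≢0 k}}

    0<k! : 0ℚ < ι (k ℕ.!)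
    0<k! = 0<ι (ℕ.>-nonZero⁻¹ (k ℕ.!) {{ℕ._!≢0 k}})

    -- Origin of the constant (k-1)/k!: the fractional summand of A_r is k - 1 times (r+1)c /
    -- (r+1-k), which `codimension-bound` compares with m r^(k-1) / k!.
    A-bound : A k r c ≤ ι (suc r) + threshold k * M
    A-bound = begin
      ι (suc r) * (1ℚ + x) ≡⟨ trans (*-distribˡ-+ (ι (suc r)) 1ℚ x) (cong (_+ ι (suc r) * x) (*-identityʳ (ι (suc r)))) ⟩
      ι (suc r) + ι (suc r) * x ≤⟨ +-monoʳ-≤ (ι (suc r)) (*-cancel-≤ 0<scale scaled) ⟩
      ι (suc r) + threshold k * M ∎
      where
      open ≤-Reasoning
      g = suc (r ℕ.∸ k)
      x = + ((k ℕ.∸ 1) ℕ.* c) / g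
      0<scale : 0ℚ < ι g * ι (k ℕ.!)
      0<scale = 0<* (0<ι {g} ℕ.z<s) 0<k!
      scaled : ι (suc r) * x * (ι g * ι (k ℕ.!)) ≤ threshold k * M * (ι g * ι (k ℕ.!))
      scaled = begin
        ι (suc r) * x * (ι g * ι (k ℕ.!))
          ≡⟨ solve 4 (λ s x g f → (s :* x) :* (g :* f) := (s :* (x :* g)) :* f) refl (ι (suc r)) x (ι g) (ι (k ℕ.!)) ⟩
        ι (suc r) * (x * ι g) * ι (k ℕ.!)
          ≡⟨ cong (λ y → ι (suc r) * y * ι (k ℕ.!)) (trans (/-*-cancel (+ ((k ℕ.∸ 1) ℕ.* c)) g) (ι-* (k ℕ.∸ 1) c)) ⟩
        ι (suc r) * (ι (k ℕ.∸ 1) * ι c) * ι (k ℕ.!)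
          ≡⟨ solve 4 (λ s l c f → (s :* (l :* c)) :* f := ((s :* c) :* f) :* l) refl (ι (suc r)) (ι (k ℕ.∸ 1)) (ι c) (ι (k ℕ.!)) ⟩
        ι (suc r) * ι c * ι (k ℕ.!) * ι (k ℕ.∸ 1)
          ≡⟨ cong (_* ι (k ℕ.∸ 1)) (trans (ι-* (suc r ℕ.* c) (k ℕ.!)) (cong (_* ι (k ℕ.!)) (ι-* (suc r) c))) ⟨
        ι (suc r ℕ.* c ℕ.* k ℕ.!) * ι (k ℕ.∸ 1)
          ≤⟨ *-mono-≤ (0≤ι (suc r ℕ.* c ℕ.* k ℕ.!)) (ι-mono-≤ (codimension-bound {k} {r} {m} {c} k≤r 0<r c-eq j k≡)) (0≤ι (k ℕ.∸ 1)) ≤-refl ⟩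
        ι (m ℕ.* r ℕ.^ (k ℕ.∸ 1) ℕ.* g) * ι (k ℕ.∸ 1)
          ≡⟨ cong₂ _*_ (ι-* (m ℕ.* r ℕ.^ (k ℕ.∸ 1)) g) (sym threshold-*) ⟩
        M * ι g * (threshold k * ι (k ℕ.!))
          ≡⟨ solve 4 (λ M g h f → (M :* g) :* (h :* f) := (h :* M) :* (g :* f)) refl M (ι g) (threshold k) (ι (k ℕ.!)) ⟩
        threshold k * M * (ι g * ι (k ℕ.!)) ∎

  0≤threshold : ∀ k → 0ℚ ≤ threshold k
  0≤threshold k = *-cancel-≤ 0<ιk! {0ℚ} {threshold k} (subst₂ _≤_ (sym (*-zeroˡ (ι (k ℕ.!))))
    (sym (/-*-cancel (+ (k ℕ.∸ 1)) (k ℕ.!) {{ℕ._!≢0 k}})) (0≤ι (k ℕ.∸ 1)))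
    where
    0<ιk! : 0ℚ < ι (k ℕ.!)
    0<ιk! = 0<ι (ℕ.>-nonZero⁻¹ (k ℕ.!) {{ℕ._!≢0 k}})

  module _ {q : ℕ} .{{nt : NonTrivial q}} (F : FiniteField q) {k r m c : ℕ} (admissible : Admissible k r m c)
    {j : ℕ} (k≡ : k ≡ 3 ℕ.+ j) {ε : Cut} (real : IsReal ε) {e₀ : ℚ} (e₀∈ε : ε e₀) (0<e₀ : 0ℚ < e₀)
    (12≤r : 12 ℕ.≤ r) (e₀r≥ : ι 4 * (ι 3 * threshold k + ι 2) ≤ ι r * e₀) where

    open Admissible admissible
    open RandomForm F (r ℕ.+ c) k m
    open Expectations F admissible

    private
      M M′ : ℚ
      M  = ι (m ℕ.* r ℕ.^ (k ℕ.∸ 1))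
      M′ = ι (m ℕ.* r ℕ.^ (k ℕ.∸ 2))

      r≤M′ : r ℕ.≤ m ℕ.* r ℕ.^ (k ℕ.∸ 2)
      r≤M′ = subst (λ k → r ℕ.≤ m ℕ.* r ℕ.^ (k ℕ.∸ 2)) (sym k≡)
        (ℕ.≤-trans (ℕ.m≤m*n r (r ℕ.^ j) {{ℕ.m^n≢0 r j {{ℕ.>-nonZero 0<r}}}}) (ℕ.m≤n*m (r ℕ.^ (1 ℕ.+ j)) m {{ℕ.>-nonZero 1≤m}}))
        where
        0<r : 0 ℕ.< r
        0<r = ℕ.≤-trans (ℕ.s≤s ℕ.z≤n) 12≤r

      M≡ : M ≡ M′ * ι r
      M≡ = trans (cong ι exponents) (ι-* (m ℕ.* r ℕ.^ (k ℕ.∸ 2)) r)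
        where
        exponents : m ℕ.* r ℕ.^ (k ℕ.∸ 1) ≡ m ℕ.* r ℕ.^ (k ℕ.∸ 2) ℕ.* r
        exponents = subst (λ k → m ℕ.* r ℕ.^ (k ℕ.∸ 1) ≡ m ℕ.* r ℕ.^ (k ℕ.∸ 2) ℕ.* r) (sym k≡)
          (trans (cong (m ℕ.*_) (ℕ.*-comm r (r ℕ.^ (1 ℕ.+ j)))) (sym (ℕ.*-assoc m (r ℕ.^ (1 ℕ.+ j)) r)))

      0≤M′ : 0ℚ ≤ M′
      0≤M′ = 0≤ι (m ℕ.* r ℕ.^ (k ℕ.∸ 2))

      suc-r≤2M′ : ι (suc r) ≤ ι 2 * M′
      suc-r≤2M′ = ≤-trans (ι-mono-≤ {suc r} {2 ℕ.* (m ℕ.* r ℕ.^ (k ℕ.∸ 2))} (ℕ.≤-trans suc-r≤2r (ℕ.*-monoʳ-≤ 2 r≤M′)))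
        (≤-reflexive (ι-* 2 (m ℕ.* r ℕ.^ (k ℕ.∸ 2))))
        where
        suc-r≤2r : suc r ℕ.≤ 2 ℕ.* r
        suc-r≤2r = subst (suc r ℕ.≤_) (cong (r ℕ.+_) (sym (ℕ.+-identityʳ r)))
          (ℕ.+-monoˡ-≤ r (ℕ.≤-trans (ℕ.s≤s ℕ.z≤n) 12≤r))

    module _ (t : ℕ) (t≥ : (⌜ threshold k ⌝ +ʳ ε) *ʳ ⌜ M′ ⌝ ≤ʳ ⌜ ι t ⌝) (t≤ : ι t ≤ L q r * ½) where

      private
        reached : ∀ {e} → ε e → e₀ ≤ e → (threshold k + e) * M′ ≤ ι t
        reached {e} e∈ε e₀≤e = threshold-reached real {threshold k} {M′} {e} {ι t} e∈ε
          (≤-<-trans (0≤threshold k) (subst (_< threshold k + e) (+-identityʳ (threshold k))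
            (+-monoʳ-< (threshold k) (<-≤-trans 0<e₀ e₀≤e)))) (0≤ι t) t≥

        -- Part (ii) does not state t ≥ 2; it follows from the threshold, because t ≥ e₀ m r^(k-2) ≥
        -- e₀ r ≥ 8.
        2≤t : 2 ℕ.≤ t
        2≤t = ι-cancel-≤ {2} {t} (begin
          ι 2 ≤⟨ 2≤4[3h+2] ⟩
          ι 4 * (ι 3 * threshold k + ι 2) ≤⟨ e₀r≥ ⟩
          ι r * e₀ ≤⟨ *-monoˡ-≤ 0<e₀ (ι-mono-≤ r≤M′) ⟩
          M′ * e₀ ≡⟨ *-comm M′ e₀ ⟩
          e₀ * M′ ≤⟨ *-mono-≤ (<⇒≤ 0<e₀) e₀≤h+e₀ 0≤M′ ≤-refl ⟩
          (threshold k + e₀) * M′ ≤⟨ reached e₀∈ε ≤-refl ⟩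
          ι t ∎)
          where
          open ≤-Reasoning
          e₀≤h+e₀ : e₀ ≤ threshold k + e₀
          e₀≤h+e₀ = subst (_≤ threshold k + e₀) (+-identityˡ e₀) (+-monoˡ-≤ e₀ (0≤threshold k))
          2≤4[3h+2] : ι 2 ≤ ι 4 * (ι 3 * threshold k + ι 2)
          2≤4[3h+2] = begin
            ι 2 ≤⟨ ι-mono-≤ {2} {8} (ℕ.s≤s (ℕ.s≤s ℕ.z≤n)) ⟩
            ι 4 * ι 2 ≡⟨ cong (ι 4 *_) (+-identityˡ (ι 2)) ⟨
            ι 4 * (0ℚ + ι 2) ≤⟨ *-mono-≤ (0≤ι 4) ≤-refl (0≤ι 2) (+-monoˡ-≤ (ι 2) (0≤* (0≤ι 3) (0≤threshold k))) ⟩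
            ι 4 * (ι 3 * threshold k + ι 2) ∎

      μ^t≢0 : ℚ.NonZero (𝔼 (X r) ^ℚ t)
      μ^t≢0 = pos⇒nonZero (𝔼 (X r) ^ℚ t) {{positive (^-positive 0<μ t)}}

      normalized-growth : q ^ʳ ((ε *ʳ ⌜ ½ ⌝) *ʳ ⌜ M ⌝) ≤ʳ ⌜ (𝔼 (λ θ → X r θ P t) ÷ (𝔼 (X r) ^ℚ t)) {{μ^t≢0}} ⌝
      normalized-growth p (s , s∈ , p<q^s) =
        let e , e∈ε , 0<e , s≤ = half-product-below {ε} {M} {s} s∈
            e′ , e′∈ε , e≤e′ , e₀≤e′ = larger-member real e∈ε e₀∈ε
        in power-below q {z = falling-exponent t ℤ.- + 2 ℤ.* + t}
             (normalized-falling-expectation t 2≤t (half-L q {r} {t} t≤) {{μ^t≢0}})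
             {s} (≤-trans s≤ (exponent-reached e′∈ε e≤e′ e₀≤e′ 0<e)) {p} p<q^s
        where
        open ≤-Reasoning
        exponent-reached : ∀ {e e′} → ε e′ → e ≤ e′ → e₀ ≤ e′ → 0ℚ < e →
          e * ½ * M ≤ fromℤ (falling-exponent t ℤ.- + 2 ℤ.* + t)
        exponent-reached {e} {e′} e′∈ε e≤e′ e₀≤e′ 0<e = begin
          e * ½ * M
            ≤⟨ *-mono-≤ (0≤* (<⇒≤ 0<e) (<⇒≤ 0<½)) (*-monoˡ-≤ 0<½ e≤e′) (0≤ι (m ℕ.* r ℕ.^ (k ℕ.∸ 1))) ≤-refl ⟩
          e′ * ½ * M
            ≡⟨ cong (e′ * ½ *_) M≡ ⟩
          e′ * ½ * (M′ * ι r)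
            ≤⟨ exponent-bound {threshold k} {e′} {e₀} {ι t} {M′} {ι r} {A k r c} {ι (suc r)}
                 0≤M′ (<⇒≤ (<-≤-trans 0<e e≤e′)) e₀≤e′ (reached e′∈ε e₀≤e′)
                 (subst (λ M → A k r c ≤ ι (suc r) + threshold k * M) M≡ (A-bound admissible {j} k≡))
                 suc-r≤2M′ (ι-mono-≤ {12} {r} 12≤r) e₀r≥ ⟩
          ι t * ι r - A k r c - ι t - ι 2 * ι t
            ≡⟨ normalized-exponent≡ F admissible t ⟨
          fromℤ (falling-exponent t ℤ.- + 2 ℤ.* + t) ∎

-- Assembly of the four statements

open import Defs
open import Data.Nat as ℕ using (ℕ; suc; NonTrivial)
open import Data.Nat.Combinatorics using (_P_)
open import Data.Product using (Σ; ∃; ∃-syntax; _×_; _,_)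
open import Data.Rational as ℚ using (ℚ; 0ℚ; ½)
import Data.Nat.Properties as ℕ
import Data.Rational.Properties as ℚ
open import Relation.Binary.PropositionalEquality using (sym)
open RationalPowers using (archimedean-*; *-monoˡ-≤; ι-mono-≤)
open GrowthBounds using (extension-bound; falling-log-bound; quadratic-growth)
open NormalizedGrowth using (half-product-unbounded; μ^t≢0; normalized-growth)

proposition6p11 :
  (∀ q .{{_ : NonTrivial q}} (F : FiniteField q) k r m c → Admissible k r m c →
     let open RandomForm F (r ℕ.+ c) k m in
     ⌜ 𝔼 (X (suc r)) ⌝ ≤ʳ Cq q *ʳ (q ^ʳ ⌜ ℚ.- A k r c ⌝))
  ×
  (∃[ K ] ∀ q .{{_ : NonTrivial q}} (F : FiniteField q) k r m c → Admissible k r m c →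
     ∀ t → 2 ℕ.≤ t → ι t ℚ.≤ L q r ℚ.* ½ →
     let open RandomForm F (r ℕ.+ c) k m in
     ⌜ ι (t ℕ.* r) ℚ.- A k r c ℚ.- ι (K ℕ.* t) ⌝ ≤ʳ log q (𝔼 (λ θ → X r θ P t)))
  ×
  (∀ m t → m ℕ.+ 2 ℕ.< 2 ℕ.* t → ∀ (B : ℕ) →
     ∃[ R ] ∀ q .{{_ : NonTrivial q}} (F : FiniteField q) r c → R ℕ.≤ r → Admissible 2 r m c →
     let open RandomForm F (r ℕ.+ c) 2 m in
     ι B ℚ.≤ 𝔼 (λ θ → X r θ P t))
  ×
  (∀ k → 3 ℕ.≤ k → ∀ (ε : Cut) → IsReal ε → ε 0ℚ →
     (∃[ R ] ∀ r → R ℕ.≤ r → ∀ q .{{_ : NonTrivial q}} (F : FiniteField q) m c → Admissible k r m c →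
        ∀ t → (⌜ threshold k ⌝ +ʳ ε) *ʳ ⌜ ι (m ℕ.* r ℕ.^ (k ℕ.∸ 2)) ⌝ ≤ʳ ⌜ ι t ⌝ →
        ι t ℚ.≤ L q r ℚ.* ½ →
        let open RandomForm F (r ℕ.+ c) k m
            μ = 𝔼 (X r) in
        Σ (ℚ.NonZero (μ ^ℚ t)) λ nz →
          q ^ʳ ((ε *ʳ ⌜ ½ ⌝) *ʳ ⌜ ι (m ℕ.* r ℕ.^ (k ℕ.∸ 1)) ⌝)
            ≤ʳ ⌜ (𝔼 (λ θ → X r θ P t) ℚ.÷ (μ ^ℚ t)) {{nz}} ⌝)
     ×
     (∀ (B : ℕ) →
        ∃[ R ] ∀ r → R ℕ.≤ r → ∀ q .{{_ : NonTrivial q}} m → 1 ℕ.≤ m →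
        ⌜ ι B ⌝ ≤ʳ q ^ʳ ((ε *ʳ ⌜ ½ ⌝) *ʳ ⌜ ι (m ℕ.* r ℕ.^ (k ℕ.∸ 1)) ⌝)))
proposition6p11 =
  (λ q F k r m c admissible → extension-bound F admissible) ,
  -- The absolute constant is 1, since the whole loss is the factor 2^t ≤ q^t from the falling
  -- factorial.
  (1 , λ q F k r m c admissible → falling-log-bound F admissible) ,
  (λ m t m+2<2t B → m ℕ.+ 2 ℕ.+ 2 ℕ.* t ℕ.+ 2 ℕ.* B , λ q F r c large admissible →
    quadratic-growth F admissible t m+2<2t B large) ,
  (λ k 3≤k ε real ε0 →
    (let e , 0<e , e∈ε = IsReal.open′ real ε0
         n , n≥ = archimedean-* (ι 4 ℚ.* (ι 3 ℚ.* threshold k ℚ.+ ι 2)) {e} 0<e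
     -- The summand 12 and the bound n with 4(3h + 2) ≤ n e, where h is the threshold constant, are
     -- the two conditions on r in `exponent-bound`. Both depend only on k and on a rational `e`
     -- fixed below ε, hence the uniformity in q and m.
     in 12 ℕ.+ n , λ r large q F m c admissible t t≥ t≤ →
       let 12≤r = ℕ.≤-trans (ℕ.m≤m+n 12 n) large
           e*r≥ = ℚ.≤-trans n≥ (*-monoˡ-≤ 0<e (ι-mono-≤ (ℕ.≤-trans (ℕ.m≤n+m n 12) large)))
           k≡ = sym (ℕ.m+[n∸m]≡n 3≤k)
       in μ^t≢0 F admissible k≡ real e∈ε 0<e 12≤r e*r≥ t t≥ t≤ ,
          normalized-growth F admissible k≡ real e∈ε 0<e 12≤r e*r≥ t t≥ t≤) ,
    half-product-unbounded real k 3≤k ε0)
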